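{- Let $d\ge 1$ be a fixed constant. There is a randomized algorithm which, given the vertex set $U(\mathcal{H})$ with $|U(\mathcal{H})|=n$ of an unknown $d$-uniform hypergraph $\mathcal{H}$, a parameter $\epsilon\in(0,1)$, and access to $\mathcal{H}$ only through a GPIS oracle, outputs with high probability (that is, with probability at least $1-n^{ -c}$ for an absolute constant $c>0$) a number $\widehat{m}$ satisfying $$(1-\epsilon)\cdot m(\mathcal{H})\le \widehat{m}\le (1+\epsilon)\cdot m(\mathcal{H}),$$ using $\mathcal{O}_d\!\left(\frac{\log^{5d+5} n}{\epsilon^4}\right)$ GPIS queries, where the constant hidden in $\mathcal{O}_d(\cdot)$ is a function of $d$ only.
   Context: A hypergraph $\mathcal{H}=(U(\mathcal{H}),\mathcal{F}(\mathcal{H}))$ consists of a finite vertex set $U(\mathcal{H})$ and a set $\mathcal{F}(\mathcal{H})$ of subsets of $U(\mathcal{H})$ called hyperedges; it is $d$-uniform if every hyperedge has exactly $d$ vertices. $m(\mathcal{H})=|\mathcal{F}(\mathcal{H})|$. GPIS (generalized $d$-partite independent set) oracle: given $d$ pairwise disjoint non-empty subsets $A_1,\ldots,A_d\subseteq U(\mathcal{H})$, the oracle answers Yes if and only if there is a hyperedge of $\mathcal{H}$ having exactly one vertex in each $A_i$, $i\in\{1,\ldots,d\}$. The cost of an algorithm is the number of oracle queries it makes. -}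

module Defs where

import Algebra.Definitions.RawSemiring
open import Data.Bool using (Bool; if_then_else_)
open import Data.Fin using (Fin)
open import Data.Fin.Properties using (all?)
open import Data.Fin.Subset using (Subset; _∩_; ∣_∣; Nonempty; Empty)
open import Data.Integer using (+_)
import Data.Integer as ℤ
open import Data.List using (List; length)
open import Data.List.Relation.Unary.All using (All)
open import Data.List.Relation.Unary.Any using (any?)
open import Data.List.Relation.Unary.Unique.Propositional using (Unique)
open import Data.Nat using (ℕ; suc; _⊔_)
import Data.Nat as ℕ
open import Data.Product using (_×_)
open import Data.Rational using (ℚ; 0ℚ; 1ℚ; _+_; _-_; _*_; _/_; _≤_; _≤?_; ↥_; ↧ₙ_; +-*-rawSemiring)
open import Data.Vec.Functional using (foldr)
open import Relation.Binary.PropositionalEquality using (_≡_; _≢_)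
open import Relation.Nullary using (Dec; ⌊_⌋)
open import Relation.Nullary.Decidable using (_×-dec_)

open Algebra.Definitions.RawSemiring +-*-rawSemiring public using (_^_; sum)

ℕ→ℚ : ℕ → ℚ
ℕ→ℚ k = + k / 1

-- The vertex set is Fin n.  The set of hyperedges is a duplicate-free list,
-- so that its length is its cardinality.
record Hypergraph (n : ℕ) : Set where
  field
    hyperedges : List (Subset n)
    distinct   : Unique hyperedges

open Hypergraph public

Uniform : ∀ {n} → ℕ → Hypergraph n → Set
Uniform d H = All (λ e → ∣ e ∣ ≡ d) (hyperedges H)

m : ∀ {n} → Hypergraph n → ℕ
m H = length (hyperedges H)

record Query (d n : ℕ) : Set where
  field
    part     : Fin d → Subset n
    nonempty : ∀ i → Nonempty (part i)
    disjoint : ∀ i j → i ≢ j → Empty (part i ∩ part j)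

open Query public

Crosses : ∀ {d n} → Query d n → Subset n → Set
Crosses A e = ∀ i → ∣ e ∩ part A i ∣ ≡ 1

crosses? : ∀ {d n} (A : Query d n) (e : Subset n) → Dec (Crosses A e)
crosses? A e = all? (λ i → ∣ e ∩ part A i ∣ ℕ.≟ 1)

Oracle : ℕ → ℕ → Set
Oracle d n = Query d n → Bool

gpis : ∀ {d n} → Hypergraph n → Oracle d n
gpis H A = ⌊ any? (crosses? A) (hyperedges H) ⌋

-- A randomized algorithm on a known vertex set Fin n, as an adaptive decision
-- tree: its only access to the hypergraph is through the answers at `ask`
-- nodes.  `toss k` draws a fresh uniform element of Fin (suc k), independent
-- of all earlier draws.
data Algorithm (d n : ℕ) : Set where
  return : ℚ → Algorithm d n
  ask    : Query d n → (Bool → Algorithm d n) → Algorithm d n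
  toss   : (k : ℕ) → (Fin (suc k) → Algorithm d n) → Algorithm d n

-- The worst case, over all outcomes of the draws, of the number of queries
-- made when running with the given oracle.
queries : ∀ {d n} → Oracle d n → Algorithm d n → ℕ
queries O (return x) = 0
queries O (ask A t)  = suc (queries O (t (O A)))
queries O (toss k t) = foldr _⊔_ 0 (λ i → queries O (t i))

-- The probability that the output satisfies P when running with the given
-- oracle.
Pr : ∀ {d n} {P : ℚ → Set} → (∀ x → Dec (P x)) → Oracle d n → Algorithm d n → ℚ
Pr P? O (return x) = if ⌊ P? x ⌋ then 1ℚ else 0ℚ
Pr P? O (ask A t)  = Pr P? O (t (O A))
Pr P? O (toss k t) = (+ 1 / suc k) * sum (λ i → Pr P? O (t i))

Approximates : ℚ → ℕ → ℚ → Set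
Approximates ε k x = ((1ℚ - ε) * ℕ→ℚ k ≤ x) × (x ≤ (1ℚ + ε) * ℕ→ℚ k)

approximates? : ∀ ε k x → Dec (Approximates ε k x)
approximates? ε k x = ((1ℚ - ε) * ℕ→ℚ k ≤? x) ×-dec (x ≤? (1ℚ + ε) * ℕ→ℚ k)

-- For c = a / b > 0, n ≥ 1 and p ≤ 1 this says p ≥ 1 - n ^ (- c): the
-- inequality 1 - p ≤ n ^ (- a / b) is raised to the power b and multiplied
-- by n ^ a, which avoids irrational powers.
HighProbability : (c : ℚ) (n : ℕ) (p : ℚ) → Set
HighProbability c n p =
  (1ℚ - p) ^ (↧ₙ c) * ℕ→ℚ n ^ ℤ.∣ ↥ c ∣ ≤ 1ℚ

{-# OPTIONS --safe #-}
module Submission where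

-- The number of edges is estimated by sequential importance sampling.  A uniformly random colouring
-- of the vertices makes every edge cross the d colour classes with the same positive probability, so
-- the number of crossing edges, rescaled, is unbiased.  A population of N weighted boxes (partial
-- colourings) is then refined: a step splits every box in two along a binary digit of the vertices of
-- one colour, discards the boxes without crossing edges, computes for each box a coarse estimate c of
-- its number M of crossing edges, and redraws N boxes with probabilities proportional to weight times
-- c.  After d ⌈log₂ n⌉ steps every box holds at most one edge.  The redrawing keeps the total unbiased
-- and multiplies its second moment by at most 1 + β₁ β₂ / N, where E c ≤ β₁ M and M E (1 / c) ≤ β₂, so
-- no union bound over the coarse estimates is needed.  With N of order β₁ β₂ d ⌈log₂ n⌉ / ε²,
-- Chebyshev's inequality gives a constant success probability, and the median of ⌈log₂ n⌉ independent
-- repetitions succeeds with probability at least 1 - 1 / n.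
--
-- A coarse estimate adds up independent trials.  A trial keeps each vertex of the i-th colour with
-- probability 2 ^ (- jᵢ), for uniformly random j₁, …, j_d ≤ ⌈log₂ n⌉, and returns 2 ^ (j₁ + … + j_d)
-- if an edge still crosses the kept vertices, and 0 otherwise.  Its expectation is at most M, and
-- choosing jᵢ according to the heaviest degree class, one colour at a time, shows that it is at least
-- M / polylog n with probability at least 1 / polylog n.

open import Defs
open import Data.Bool using (Bool; true; false; if_then_else_; _∧_; _∨_; not; _xor_)
import Data.Bool.Properties as Bool
open import Data.Empty using (⊥; ⊥-elim)
import Data.Fin as Fin
open import Data.Fin using (Fin; zero; suc; toℕ)
import Data.Fin.Properties as Fin
open import Data.Fin.Subset using (Subset; _∩_; ∣_∣; Nonempty; _⊆_) renaming (_∈_ to _∈ˢ_)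
open import Data.Fin.Subset.Properties using (nonempty?; x∈p∩q⁺; x∈p∩q⁻; ⊆-antisym)
import Data.Integer as ℤ
open import Data.Integer using () renaming (+_ to pos)
import Data.Integer.Properties as ℤ
import Data.List as List
open import Data.List using (List; []; _∷_; _++_; length; map; replicate; filter; allFin; cartesianProduct)
open import Data.List.Membership.Propositional using (_∈_; find; lose)
open import Data.List.Membership.Propositional.Properties using (∈-filter⁺; ∈-filter⁻; ∈-cartesianProduct⁺; ∈-allFin)
import Data.List.Properties as List
import Data.List.Relation.Unary.All as All
open import Data.List.Relation.Unary.All using (All; []; _∷_)
open import Data.List.Relation.Unary.AllPairs using (_∷_)
open import Data.List.Relation.Unary.Any using (here; there; any?)
open import Data.List.Relation.Unary.Unique.Propositional using (Unique)
open import Data.Maybe using (Maybe; just; nothing; is-nothing)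
import Data.Nat as ℕ
open import Data.Nat using (ℕ; zero; suc; z≤n; s≤s) renaming (_+_ to _+ℕ_; _*_ to _*ℕ_; _≤_ to _≤ℕ_; _<_ to _<ℕ_; _^_ to _^ℕ_)
open import Data.Nat.DivMod using (m≡m%n+[m/n]*n; m%n<n; m/n*n≤m)
open import Data.Nat.Induction using (<-rec)
open import Data.Nat.Logarithm using (⌈log₂_⌉; ⌈log₂⌉-mono-≤; ⌈log₂⌈n/2⌉⌉≡⌈log₂n⌉∸1)
import Data.Nat.Properties as ℕ
open import Data.Nat.Tactic.RingSolver using () renaming (solve-∀ to ℕ-solve-∀)
open import Data.Product using (_×_; _,_; proj₁; proj₂; ∃-syntax; Σ-syntax)
import Data.Rational as ℚ
open import Data.Rational using (ℚ; 0ℚ; 1ℚ; ½; negative; _+_; _*_; _-_; -_; _<_; _≤_; _/_; nonNegative; positive; Positive)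
import Data.Rational.Properties as ℚ
open import Data.Rational.Properties using (≤-refl; ≤-trans; ≤-reflexive; +-mono-≤; +-monoˡ-≤; +-monoʳ-≤; *-identityˡ; *-identityʳ; *-zeroˡ; *-zeroʳ; +-identityˡ; +-identityʳ; *-comm; *-assoc; +-comm; +-assoc; *-distribˡ-+)
import Data.Rational.Unnormalised as ℚᵘ
import Data.Rational.Unnormalised.Properties as ℚᵘ
open import Data.Sum using (_⊎_; inj₁; inj₂)
import Data.Vec as Vec
open import Data.Vec using (Vec; []; _∷_; lookup; toList)
open import Data.Vec.Functional using (foldr)
import Data.Vec.Properties as Vec
open import Function using (_∘_; id; case_of_)
open import Level using (0ℓ)
open import Relation.Binary.Bundles using (DecTotalOrder)
open import Relation.Binary.Definitions using (tri<; tri≈; tri>)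
open import Relation.Binary.PropositionalEquality using (_≡_; refl; sym; trans; cong; cong₂; subst; subst₂; module ≡-Reasoning)
open import Relation.Nullary using (Dec; yes; no; ¬_; ⌊_⌋; does)
open import Relation.Nullary.Decidable using (dec⇒maybe)
open import Tactic.RingSolver using (solve-∀)
open import Tactic.RingSolver.Core.AlmostCommutativeRing using (AlmostCommutativeRing; fromCommutativeRing)
open import Data.List.Extrema (DecTotalOrder.totalOrder ℚ.≤-decTotalOrder) using (min; max; v≤min⁺; min≤xs; xs≤max)

-- Rational arithmetic

-- Why rough estimates suffice: redrawing N particles of weight w and mass M adds at most (1 / N) (Σ
-- w c) (Σ w M² / c) to the second moment of the total Σ w M. Estimates of different particles are
-- independent, so a cross term contributes w w' E c · M'² E (1 / c') ≤ β₁ β₂ (w M) (w' M'); in a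
-- diagonal term c cancels. Only the means of c and 1 / c matter, so an estimate may occasionally be
-- far off. The danger is 1 / c when all trials of a box fail. Adding 1 to every estimate keeps 1 /
-- c at most 1, and the number of trials is chosen so that total failure has probability at most 1 /
-- M, which adds at most 1 to M E (1 / c).
--
-- The only random primitive is a uniform draw, so weights and estimates are natural numbers, a
-- biased draw is a uniform draw from a list with repetitions, and all rational factors are
-- collected in one scalar.
--
-- With L = ⌈log₂ n⌉, the degrees in L are d + 1 for β₁, d for β₂, hence 2 d + 2 for N ε². The
-- factors L (repetitions), d L (steps) and degree d + 1 (trials per box) bring the cost to degree 3
-- d + 5, with ε only to the power -2: the stated bound is met with room to spare.

ℚ-ring : AlmostCommutativeRing 0ℓ 0ℓ
ℚ-ring = fromCommutativeRing ℚ.+-*-commutativeRing (λ x → dec⇒maybe (0ℚ ℚ.≟ x))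

0≤1 : 0ℚ ≤ 1ℚ
0≤1 = ℚ.nonNegative⁻¹ 1ℚ

0≤+ : ∀ {a b} → 0ℚ ≤ a → 0ℚ ≤ b → 0ℚ ≤ a + b
0≤+ {a} {b} 0≤a 0≤b = +-mono-≤ 0≤a 0≤b

*-mono-≤ : ∀ {a b c d} → 0ℚ ≤ a → a ≤ b → 0ℚ ≤ c → c ≤ d → a * c ≤ b * d
*-mono-≤ {a} {b} {c} {d} 0≤a a≤b 0≤c c≤d = ≤-trans
  (ℚ.*-monoʳ-≤-nonNeg c {{nonNegative 0≤c}} a≤b)
  (ℚ.*-monoˡ-≤-nonNeg b {{nonNegative (≤-trans 0≤a a≤b)}} c≤d)

*-monoˡ : ∀ {a b} c → 0ℚ ≤ c → a ≤ b → c * a ≤ c * b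
*-monoˡ c 0≤c = ℚ.*-monoˡ-≤-nonNeg c {{nonNegative 0≤c}}

*-monoʳ : ∀ {a b} c → 0ℚ ≤ c → a ≤ b → a * c ≤ b * c
*-monoʳ c 0≤c = ℚ.*-monoʳ-≤-nonNeg c {{nonNegative 0≤c}}

*-cancelʳ : ∀ {a b} c → 0ℚ < c → a * c ≤ b * c → a ≤ b
*-cancelʳ c 0<c = ℚ.*-cancelʳ-≤-pos c {{positive 0<c}}

0≤* : ∀ {a b} → 0ℚ ≤ a → 0ℚ ≤ b → 0ℚ ≤ a * b
0≤* {a} {b} 0≤a 0≤b = subst (_≤ a * b) (*-zeroʳ a) (*-monoˡ a 0≤a 0≤b)

≤-slack : ∀ {a b} x → 0ℚ ≤ x → b ≡ a + x → a ≤ b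
≤-slack {a} {b} x 0≤x b≡a+x =
  ≤-trans (≤-reflexive (sym (+-identityʳ a))) (≤-trans (+-monoʳ-≤ a 0≤x) (≤-reflexive (sym b≡a+x)))

0≤-diff : ∀ {a b} → a ≤ b → 0ℚ ≤ b - a
0≤-diff {a} {b} a≤b = subst (_≤ b - a) (ℚ.+-inverseʳ a) (+-monoˡ-≤ (- a) a≤b)

≤-diff : ∀ {a b} → 0ℚ ≤ b - a → a ≤ b
≤-diff {a} {b} 0≤b-a = ≤-slack (b - a) 0≤b-a (eq a b)
  where
  eq : ∀ a b → b ≡ a + (b - a)
  eq = solve-∀ ℚ-ring

0≤square : ∀ x → 0ℚ ≤ x * x
0≤square x with ℚ.≤-total 0ℚ x
... | inj₁ 0≤x = 0≤* 0≤x 0≤x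
... | inj₂ x≤0 = subst (0ℚ ≤_) (eq x) (0≤* (0≤-diff x≤0) (0≤-diff x≤0))
  where
  eq : ∀ x → (0ℚ - x) * (0ℚ - x) ≡ x * x
  eq = solve-∀ ℚ-ring

-- ι and inv are opaque so that the type checker never unfolds the normalisation of fractions.
opaque
  ι : ℕ → ℚ
  ι = ℕ→ℚ

  ι-def : ∀ k → ι k ≡ ℕ→ℚ k
  ι-def k = refl

  ι-toℚᵘ : ∀ k → ℚ.toℚᵘ (ι k) ℚᵘ.≃ ℚᵘ.mkℚᵘ (pos k) 0
  ι-toℚᵘ k = ℚ.toℚᵘ-fromℚᵘ (ℚᵘ.mkℚᵘ (pos k) 0)

  ι-+ : ∀ a b → ι (a +ℕ b) ≡ ι a + ι b
  ι-+ a b = ℚ.toℚᵘ-injective (begin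
    ℚ.toℚᵘ (ι (a +ℕ b))                  ≈⟨ ι-toℚᵘ (a +ℕ b) ⟩
    ℚᵘ.mkℚᵘ (pos (a +ℕ b)) 0                 ≈⟨ ℚᵘ.*≡*
        (cong (ℤ._* pos 1) (sym (cong₂ ℤ._+_ (ℤ.*-identityʳ (pos a)) (ℤ.*-identityʳ (pos b))))) ⟩
    ℚᵘ.mkℚᵘ (pos a) 0 ℚᵘ.+ ℚᵘ.mkℚᵘ (pos b) 0  ≈⟨ ℚᵘ.+-cong (ℚᵘ.≃-sym (ι-toℚᵘ a)) (ℚᵘ.≃-sym (ι-toℚᵘ b)) ⟩
    ℚ.toℚᵘ (ι a) ℚᵘ.+ ℚ.toℚᵘ (ι b)    ≈⟨ ℚ.toℚᵘ-homo-+ (ι a) (ι b) ⟨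
    ℚ.toℚᵘ (ι a + ι b)                 ∎)
    where open import Relation.Binary.Reasoning.Setoid ℚᵘ.≃-setoid

  ι-* : ∀ a b → ι (a *ℕ b) ≡ ι a * ι b
  ι-* a b = ℚ.toℚᵘ-injective (begin
    ℚ.toℚᵘ (ι (a *ℕ b))                  ≈⟨ ι-toℚᵘ (a *ℕ b) ⟩
    ℚᵘ.mkℚᵘ (pos (a *ℕ b)) 0                 ≈⟨ ℚᵘ.*≡* (cong (ℤ._* pos 1) (ℤ.pos-* a b)) ⟩
    ℚᵘ.mkℚᵘ (pos a) 0 ℚᵘ.* ℚᵘ.mkℚᵘ (pos b) 0  ≈⟨ ℚᵘ.*-cong (ℚᵘ.≃-sym (ι-toℚᵘ a)) (ℚᵘ.≃-sym (ι-toℚᵘ b)) ⟩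
    ℚ.toℚᵘ (ι a) ℚᵘ.* ℚ.toℚᵘ (ι b)    ≈⟨ ℚ.toℚᵘ-homo-* (ι a) (ι b) ⟨
    ℚ.toℚᵘ (ι a * ι b)                 ∎)
    where open import Relation.Binary.Reasoning.Setoid ℚᵘ.≃-setoid

  ι-mono : ∀ {a b} → a ≤ℕ b → ι a ≤ ι b
  ι-mono {a} {b} a≤b = ℚ.toℚᵘ-cancel-≤ (begin
    ℚ.toℚᵘ (ι a)   ≃⟨ ι-toℚᵘ a ⟩
    ℚᵘ.mkℚᵘ (pos a) 0  ≤⟨ ℚᵘ.*≤* (ℤ.*-monoʳ-≤-nonNeg (pos 1) (ℤ.+≤+ a≤b)) ⟩
    ℚᵘ.mkℚᵘ (pos b) 0  ≃⟨ ι-toℚᵘ b ⟨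
    ℚ.toℚᵘ (ι b)   ∎)
    where open ℚᵘ.≤-Reasoning

  inv : ℕ → ℚ
  inv zero    = 0ℚ
  inv (suc k) = pos 1 / suc k

  inv-def : ∀ k → inv (suc k) ≡ pos 1 / suc k
  inv-def k = refl

  ι-zero : ι 0 ≡ 0ℚ
  ι-zero = refl

  ι-one : ι 1 ≡ 1ℚ
  ι-one = refl

  inv-zero : inv 0 ≡ 0ℚ
  inv-zero = refl

  inv-inverseʳ : ∀ k → ι (suc k) * inv (suc k) ≡ 1ℚ
  inv-inverseʳ k = ℚ.toℚᵘ-injective (begin
    ℚ.toℚᵘ (ι (suc k) * inv (suc k))               ≈⟨ ℚ.toℚᵘ-homo-* (ι (suc k)) (inv (suc k)) ⟩
    ℚ.toℚᵘ (ι (suc k)) ℚᵘ.* ℚ.toℚᵘ (inv (suc k))  ≈⟨ ℚᵘ.*-cong (ι-toℚᵘ (suc k)) (ℚ.toℚᵘ-fromℚᵘ (ℚᵘ.mkℚᵘ (pos 1) k)) ⟩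
    ℚᵘ.mkℚᵘ (pos (suc k)) 0 ℚᵘ.* ℚᵘ.mkℚᵘ (pos 1) k         ≈⟨ ℚᵘ.*≡* eq ⟩
    ℚ.toℚᵘ 1ℚ                                        ∎)
    where
    open import Relation.Binary.Reasoning.Setoid ℚᵘ.≃-setoid
    eq : pos (suc k) ℤ.* pos 1 ℤ.* pos 1 ≡ pos 1 ℤ.* pos (1 *ℕ suc k)
    eq = trans (ℤ.*-identityʳ (pos (suc k) ℤ.* pos 1)) (trans (ℤ.*-identityʳ (pos (suc k)))
           (sym (trans (ℤ.*-identityˡ (pos (1 *ℕ suc k))) (cong pos (ℕ.*-identityˡ (suc k))))))

0≤ι : ∀ k → 0ℚ ≤ ι k
0≤ι k = subst (_≤ ι k) ι-zero (ι-mono z≤n)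

ι-suc : ∀ k → ι (suc k) ≡ 1ℚ + ι k
ι-suc k = trans (ι-+ 1 k) (cong (_+ ι k) ι-one)

1≤ι : ∀ {k} → 1 ≤ℕ k → 1ℚ ≤ ι k
1≤ι {k} 1≤k = subst (_≤ ι k) ι-one (ι-mono 1≤k)

0<ι-suc : ∀ k → 0ℚ < ι (suc k)
0<ι-suc k = ℚ.<-≤-trans (ℚ.positive⁻¹ 1ℚ) (1≤ι (s≤s z≤n))

inv-inverseˡ : ∀ k → inv (suc k) * ι (suc k) ≡ 1ℚ
inv-inverseˡ k = trans (*-comm (inv (suc k)) (ι (suc k))) (inv-inverseʳ k)

0≤inv : ∀ k → 0ℚ ≤ inv k
0≤inv zero    = ≤-reflexive (sym inv-zero)
0≤inv (suc k) = *-cancelʳ (ι (suc k)) (0<ι-suc k)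
  (subst (0ℚ * ι (suc k) ≤_) (sym (inv-inverseˡ k)) (subst (_≤ 1ℚ) (sym (*-zeroˡ (ι (suc k)))) 0≤1))

inv≤1 : ∀ k → inv k ≤ 1ℚ
inv≤1 zero    = subst (_≤ 1ℚ) (sym inv-zero) 0≤1
inv≤1 (suc k) = *-cancelʳ (ι (suc k)) (0<ι-suc k)
  (subst (_≤ 1ℚ * ι (suc k)) (sym (inv-inverseˡ k))
    (subst (1ℚ ≤_) (sym (*-identityˡ (ι (suc k)))) (1≤ι (s≤s z≤n))))

[_] : Bool → ℚ
[ b ] = if b then 1ℚ else 0ℚ

0≤[] : ∀ b → 0ℚ ≤ [ b ]
0≤[] true  = 0≤1
0≤[] false = ≤-refl

[]≤1 : ∀ b → [ b ] ≤ 1ℚ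
[]≤1 true  = ≤-refl
[]≤1 false = 0≤1

sum-cong : ∀ {k} {f g : Fin k → ℚ} → (∀ i → f i ≡ g i) → sum f ≡ sum g
sum-cong {zero}  eq = refl
sum-cong {suc k} eq = cong₂ _+_ (eq zero) (sum-cong (eq ∘ suc))

sum-mono : ∀ {k} {f g : Fin k → ℚ} → (∀ i → f i ≤ g i) → sum f ≤ sum g
sum-mono {zero}  le = ≤-refl
sum-mono {suc k} le = +-mono-≤ (le zero) (sum-mono (le ∘ suc))

sum-+ : ∀ {k} (f g : Fin k → ℚ) → sum (λ i → f i + g i) ≡ sum f + sum g
sum-+ {zero}  f g = refl
sum-+ {suc k} f g = trans (cong (f zero + g zero +_) (sum-+ (f ∘ suc) (g ∘ suc)))
  (eq (f zero) (g zero) (sum (f ∘ suc)) (sum (g ∘ suc)))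
  where
  eq : ∀ a b c d → a + b + (c + d) ≡ a + c + (b + d)
  eq = solve-∀ ℚ-ring

sum-* : ∀ {k} c (f : Fin k → ℚ) → sum (λ i → c * f i) ≡ c * sum f
sum-* {zero}  c f = sym (*-zeroʳ c)
sum-* {suc k} c f = trans (cong (c * f zero +_) (sum-* c (f ∘ suc))) (sym (*-distribˡ-+ c (f zero) _))

sum-const : ∀ k c → sum {k} (λ _ → c) ≡ ι k * c
sum-const zero    c = sym (trans (cong (_* c) ι-zero) (*-zeroˡ c))
sum-const (suc k) c = trans (cong (c +_) (sum-const k c))
  (trans (eq c (ι k)) (cong (_* c) (sym (ι-suc k))))
  where
  eq : ∀ c k → c + k * c ≡ (1ℚ + k) * c
  eq = solve-∀ ℚ-ring

sum-0≤ : ∀ {k} {f : Fin k → ℚ} → (∀ i → 0ℚ ≤ f i) → 0ℚ ≤ sum f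
sum-0≤ {zero}  nn = ≤-refl
sum-0≤ {suc k} nn = 0≤+ (nn zero) (sum-0≤ (nn ∘ suc))

term≤sum : ∀ {k} {f : Fin k → ℚ} → (∀ i → 0ℚ ≤ f i) → ∀ i → f i ≤ sum f
term≤sum {suc k} {f} nn zero    = ≤-slack (sum (f ∘ suc)) (sum-0≤ (nn ∘ suc)) refl
term≤sum {suc k} {f} nn (suc i) = ≤-trans (term≤sum (nn ∘ suc) i) (≤-slack (f zero) (nn zero) (+-comm (f zero) _))

-- Randomized programs

-- `Algorithm` with an arbitrary result type, so that randomized subroutines can be sequenced.
data Prog (d n : ℕ) (A : Set) : Set where
  ret  : A → Prog d n A
  ask  : Query d n → (Bool → Prog d n A) → Prog d n A
  toss : (k : ℕ) → (Fin (suc k) → Prog d n A) → Prog d n A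

infixl 1 _>>=_
_>>=_ : ∀ {d n} {A B : Set} → Prog d n A → (A → Prog d n B) → Prog d n B
ret a    >>= k = k a
ask q t  >>= k = ask q (λ b → t b >>= k)
toss j t >>= k = toss j (λ i → t i >>= k)

toAlgorithm : ∀ {d n} → Prog d n ℚ → Algorithm d n
toAlgorithm (ret x)    = return x
toAlgorithm (ask q t)  = ask q (λ b → toAlgorithm (t b))
toAlgorithm (toss k t) = toss k (λ i → toAlgorithm (t i))

-- Expectations of arbitrary test functions also express laws: `∀ f → E O p f ≡ f b` says that `p`
-- surely returns `b`. The specifications of subroutines below are stated in this form.
E : ∀ {d n} {A : Set} → Oracle d n → Prog d n A → (A → ℚ) → ℚ
E O (ret a)    f = f a
E O (ask q t)  f = E O (t (O q)) f
E O (toss k t) f = inv (suc k) * sum (λ i → E O (t i) f)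

cost : ∀ {d n} {A : Set} → Oracle d n → Prog d n A → ℕ
cost O (ret a)    = 0
cost O (ask q t)  = suc (cost O (t (O q)))
cost O (toss k t) = foldr ℕ._⊔_ 0 (λ i → cost O (t i))

Pr-toAlgorithm : ∀ {d n} {P : ℚ → Set} (P? : ∀ x → Dec (P x)) (O : Oracle d n) (p : Prog d n ℚ) →
  Pr P? O (toAlgorithm p) ≡ E O p (λ x → [ ⌊ P? x ⌋ ])
Pr-toAlgorithm P? O (ret x)    = refl
Pr-toAlgorithm P? O (ask q t)  = Pr-toAlgorithm P? O (t (O q))
Pr-toAlgorithm P? O (toss k t) = cong₂ _*_ (sym (inv-def k)) (sum-cong (λ i → Pr-toAlgorithm P? O (t i)))

⨆ : ∀ {k} → (Fin k → ℕ) → ℕ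
⨆ = foldr ℕ._⊔_ 0

⨆-cong : ∀ {k} {f g : Fin k → ℕ} → (∀ i → f i ≡ g i) → ⨆ f ≡ ⨆ g
⨆-cong {zero}  eq = refl
⨆-cong {suc k} eq = cong₂ ℕ._⊔_ (eq zero) (⨆-cong (eq ∘ suc))

⨆-≤ : ∀ {k b} {f : Fin k → ℕ} → (∀ i → f i ≤ℕ b) → ⨆ f ≤ℕ b
⨆-≤ {zero}  le = z≤n
⨆-≤ {suc k} le = ℕ.⊔-lub (le zero) (⨆-≤ (le ∘ suc))

term≤⨆ : ∀ {k} (f : Fin k → ℕ) i → f i ≤ℕ ⨆ f
term≤⨆ {suc k} f zero    = ℕ.m≤m⊔n (f zero) _
term≤⨆ {suc k} f (suc i) = ℕ.≤-trans (term≤⨆ (f ∘ suc) i) (ℕ.m≤n⊔m (f zero) _)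

queries-toAlgorithm : ∀ {d n} (O : Oracle d n) (p : Prog d n ℚ) → queries O (toAlgorithm p) ≡ cost O p
queries-toAlgorithm O (ret x)    = refl
queries-toAlgorithm O (ask q t)  = cong suc (queries-toAlgorithm O (t (O q)))
queries-toAlgorithm O (toss k t) = ⨆-cong (λ i → queries-toAlgorithm O (t i))

module _ {d n : ℕ} (O : Oracle d n) where

  cost->>= : ∀ {A B : Set} (p : Prog d n A) (k : A → Prog d n B) {b} →
    (∀ a → cost O (k a) ≤ℕ b) → cost O (p >>= k) ≤ℕ cost O p +ℕ b
  cost->>= (ret a)    k le = le a
  cost->>= (ask q t)  k le = s≤s (cost->>= (t (O q)) k le)
  cost->>= (toss j t) k {b} le = ⨆-≤ (λ i → ℕ.≤-trans (cost->>= (t i) k le)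
    (ℕ.+-monoˡ-≤ b (term≤⨆ (λ i → cost O (t i)) i)))

  E->>= : ∀ {A B : Set} (p : Prog d n A) (k : A → Prog d n B) (f : B → ℚ) →
    E O (p >>= k) f ≡ E O p (λ a → E O (k a) f)
  E->>= (ret a)    k f = refl
  E->>= (ask q t)  k f = E->>= (t (O q)) k f
  E->>= (toss j t) k f = cong (inv (suc j) *_) (sum-cong (λ i → E->>= (t i) k f))

  E-cong : ∀ {A : Set} (p : Prog d n A) {f g : A → ℚ} → (∀ a → f a ≡ g a) → E O p f ≡ E O p g
  E-cong (ret a)    eq = eq a
  E-cong (ask q t)  eq = E-cong (t (O q)) eq
  E-cong (toss k t) eq = cong (inv (suc k) *_) (sum-cong (λ i → E-cong (t i) eq))

  E-mono : ∀ {A : Set} (p : Prog d n A) {f g : A → ℚ} → (∀ a → f a ≤ g a) → E O p f ≤ E O p g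
  E-mono (ret a)    le = le a
  E-mono (ask q t)  le = E-mono (t (O q)) le
  E-mono (toss k t) le = *-monoˡ (inv (suc k)) (0≤inv (suc k)) (sum-mono (λ i → E-mono (t i) le))

  E-+ : ∀ {A : Set} (p : Prog d n A) (f g : A → ℚ) → E O p (λ a → f a + g a) ≡ E O p f + E O p g
  E-+ (ret a)    f g = refl
  E-+ (ask q t)  f g = E-+ (t (O q)) f g
  E-+ (toss k t) f g = trans
    (cong (inv (suc k) *_) (trans (sum-cong (λ i → E-+ (t i) f g)) (sum-+ (λ i → E O (t i) f) (λ i → E O (t i) g))))
    (*-distribˡ-+ (inv (suc k)) _ _)

  E-* : ∀ {A : Set} (p : Prog d n A) c (f : A → ℚ) → E O p (λ a → c * f a) ≡ c * E O p f
  E-* (ret a)    c f = refl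
  E-* (ask q t)  c f = E-* (t (O q)) c f
  E-* (toss k t) c f = trans
    (cong (inv (suc k) *_) (trans (sum-cong (λ i → E-* (t i) c f)) (sum-* c (λ i → E O (t i) f))))
    (eq (inv (suc k)) c (sum (λ i → E O (t i) f)))
    where
    eq : ∀ a b c → a * (b * c) ≡ b * (a * c)
    eq = solve-∀ ℚ-ring

  E-const : ∀ {A : Set} (p : Prog d n A) c → E O p (λ _ → c) ≡ c
  E-const (ret a)    c = refl
  E-const (ask q t)  c = E-const (t (O q)) c
  E-const (toss k t) c = begin
    inv (suc k) * sum (λ i → E O (t i) (λ _ → c))  ≡⟨ cong (inv (suc k) *_)
        (trans (sum-cong (λ i → E-const (t i) c)) (sum-const (suc k) c)) ⟩
    inv (suc k) * (ι (suc k) * c)                  ≡⟨ *-assoc (inv (suc k)) (ι (suc k)) c ⟨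
    inv (suc k) * ι (suc k) * c                    ≡⟨ cong (_* c) (inv-inverseˡ k) ⟩
    1ℚ * c                                         ≡⟨ *-identityˡ c ⟩
    c                                              ∎
    where open ≡-Reasoning

  E-*ʳ : ∀ {A : Set} (p : Prog d n A) c (f : A → ℚ) → E O p (λ a → f a * c) ≡ E O p f * c
  E-*ʳ p c f = trans (E-cong p (λ a → *-comm (f a) c)) (trans (E-* p c f) (*-comm c (E O p f)))

  E-0≤ : ∀ {A : Set} (p : Prog d n A) {f : A → ℚ} → (∀ a → 0ℚ ≤ f a) → 0ℚ ≤ E O p f
  E-0≤ p {f} nn = subst (_≤ E O p f) (E-const p 0ℚ) (E-mono p nn)

  E-not : ∀ {A : Set} (p : Prog d n A) (b : A → Bool) → E O p (λ a → [ not (b a) ]) ≡ 1ℚ - E O p (λ a → [ b a ])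
  E-not p b = begin
    E O p (λ a → [ not (b a) ])                                ≡⟨ E-cong p (λ a → flipped (b a)) ⟩
    E O p (λ a → 1ℚ + (- 1ℚ) * [ b a ])                        ≡⟨ E-+ p (λ _ → 1ℚ) (λ a → (- 1ℚ) * [ b a ]) ⟩
    E O p (λ _ → 1ℚ) + E O p (λ a → (- 1ℚ) * [ b a ])          ≡⟨ cong₂ _+_ (E-const p 1ℚ)
        (E-* p (- 1ℚ) (λ a → [ b a ])) ⟩
    1ℚ + (- 1ℚ) * E O p (λ a → [ b a ])                        ≡⟨ eq (E O p (λ a → [ b a ])) ⟩
    1ℚ - E O p (λ a → [ b a ])                                 ∎
    where
    open ≡-Reasoning
    flipped : ∀ b → [ not b ] ≡ 1ℚ + (- 1ℚ) * [ b ]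
    flipped true  = refl
    flipped false = refl
    eq : ∀ x → 1ℚ + (- 1ℚ) * x ≡ 1ℚ - x
    eq = solve-∀ ℚ-ring

  E-product : ∀ {A B : Set} (p : Prog d n A) (q : Prog d n B) (f : A → ℚ) (g : B → ℚ) →
    E O p (λ a → E O q (λ b → f a * g b)) ≡ E O p f * E O q g
  E-product p q f g = trans (E-cong p (λ a → E-* q (f a) g)) (E-*ʳ p (E O q g) f)

  E-shift² : ∀ {A : Set} (p : Prog d n A) x (g : A → ℚ) →
    E O p (λ a → (x + g a) * (x + g a)) ≡ x * x + (x + x) * E O p g + E O p (λ a → g a * g a)
  E-shift² p x g = begin
    E O p (λ a → (x + g a) * (x + g a))                                   ≡⟨ E-cong p (λ a → eq x (g a)) ⟩
    E O p (λ a → x * x + (x + x) * g a + g a * g a)                       ≡⟨ E-+ p (λ a → x * x + (x + x) * g a)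
        (λ a → g a * g a) ⟩
    E O p (λ a → x * x + (x + x) * g a) + E O p (λ a → g a * g a)         ≡⟨ cong (_+ _)
        (E-+ p (λ _ → x * x) (λ a → (x + x) * g a)) ⟩
    E O p (λ a → x * x) + E O p (λ a → (x + x) * g a) + E O p (λ a → g a * g a)
      ≡⟨ cong (_+ E O p (λ a → g a * g a)) (cong₂ _+_ (E-const p (x * x)) (E-* p (x + x) g)) ⟩
    x * x + (x + x) * E O p g + E O p (λ a → g a * g a)                   ∎
    where
    open ≡-Reasoning
    eq : ∀ x y → (x + y) * (x + y) ≡ x * x + (x + x) * y + y * y
    eq = solve-∀ ℚ-ring

  -- Every outcome of the draws has positive probability, so a nonnegative `f` of mean 0 vanishes at
  -- every outcome. This serves hypergraphs without edges, where Chebyshev's inequality would divide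
  -- by 0.
  E-vanish : ∀ {A : Set} (p : Prog d n A) {f : A → ℚ} {g : A → ℚ} → (∀ a → 0ℚ ≤ f a) →
    (∀ a → f a ≤ 0ℚ → g a ≤ 0ℚ) → E O p f ≤ 0ℚ → E O p g ≤ 0ℚ
  E-vanish (ret a)    nn imp le = imp a le
  E-vanish (ask q t)  nn imp le = E-vanish (t (O q)) nn imp le
  E-vanish (toss k t) {f} {g} nn imp le = subst (inv (suc k) * sum (λ i → E O (t i) g) ≤_) (*-zeroʳ (inv (suc k)))
    (*-monoˡ (inv (suc k)) (0≤inv (suc k)) (subst (sum (λ i → E O (t i) g) ≤_)
      (trans (sum-const (suc k) 0ℚ) (*-zeroʳ (ι (suc k))))
      (sum-mono (λ i → E-vanish (t i) nn imp (≤-trans (term≤sum (λ i → E-0≤ (t i) nn) i) S≤0)))))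
    where
    S = sum (λ i → E O (t i) f)
    S≤0 : S ≤ 0ℚ
    S≤0 = subst (_≤ 0ℚ) eq (subst (ι (suc k) * (inv (suc k) * S) ≤_) (*-zeroʳ (ι (suc k)))
        (*-monoˡ (ι (suc k)) (0≤ι (suc k)) le))
      where
      eq : ι (suc k) * (inv (suc k) * S) ≡ S
      eq = trans (sym (*-assoc (ι (suc k)) (inv (suc k)) S)) (trans (cong (_* S) (inv-inverseʳ k)) (*-identityˡ S))

iid : ∀ {d n} {A : Set} → (N : ℕ) → Prog d n A → Prog d n (Vec A N)
iid zero    p = ret []
iid (suc N) p = p >>= λ a → iid N p >>= λ v → ret (a ∷ v)

sumV : ∀ {N} {A : Set} → (A → ℚ) → Vec A N → ℚ
sumV g []      = 0ℚ
sumV g (a ∷ v) = g a + sumV g v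

prodV : ∀ {N} {A : Set} → (A → ℚ) → Vec A N → ℚ
prodV g []      = 1ℚ
prodV g (a ∷ v) = g a * prodV g v

module _ {d n : ℕ} (O : Oracle d n) {A : Set} (p : Prog d n A) where

  cost-iid : ∀ N {b} → cost O p ≤ℕ b → cost O (iid N p) ≤ℕ N *ℕ b
  cost-iid zero    le = z≤n
  cost-iid (suc N) {b} le = ℕ.≤-trans
    (cost->>= O p _ (λ a → ℕ.≤-trans (cost->>= O (iid N p) _ (λ v → z≤n))
        (ℕ.≤-trans (ℕ.≤-reflexive (ℕ.+-identityʳ _)) (cost-iid N le))))
    (ℕ.+-monoˡ-≤ (N *ℕ b) le)

  E-iid-suc : ∀ N (f : Vec A (suc N) → ℚ) →
    E O (iid (suc N) p) f ≡ E O p (λ a → E O (iid N p) (λ v → f (a ∷ v)))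
  E-iid-suc N f = trans (E->>= O p _ f) (E-cong O p (λ a → E->>= O (iid N p) _ f))

  E-iid-sum : ∀ N (g : A → ℚ) → E O (iid N p) (sumV g) ≡ ι N * E O p g
  E-iid-sum zero    g = sym (trans (cong (_* E O p g) ι-zero) (*-zeroˡ (E O p g)))
  E-iid-sum (suc N) g = begin
    E O (iid (suc N) p) (sumV g)                         ≡⟨ E-iid-suc N (sumV g) ⟩
    E O p (λ a → E O (iid N p) (λ v → g a + sumV g v))   ≡⟨ E-cong O p
        (λ a → trans (E-+ O (iid N p) (λ _ → g a) (sumV g)) (cong₂ _+_ (E-const O (iid N p) (g a)) (E-iid-sum N g))) ⟩
    E O p (λ a → g a + ι N * E O p g)                    ≡⟨ trans (E-+ O p g (λ _ → ι N * E O p g))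
        (cong (E O p g +_) (E-const O p (ι N * E O p g))) ⟩
    E O p g + ι N * E O p g                              ≡⟨ eq (E O p g) (ι N) ⟩
    (1ℚ + ι N) * E O p g                                 ≡⟨ cong (_* E O p g) (ι-suc N) ⟨
    ι (suc N) * E O p g                                  ∎
    where
    open ≡-Reasoning
    eq : ∀ x k → x + k * x ≡ (1ℚ + k) * x
    eq = solve-∀ ℚ-ring

  -- Independence factors the cross terms. The exact coefficient of the squared mean is N (N - 1);
  -- rounding it up to N² leaves a square as slack in each step.
  E-iid-square : ∀ N (g : A → ℚ) → E O (iid N p) (λ v → sumV g v * sumV g v)
    ≤ ι N * E O p (λ a → g a * g a) + ι N * ι N * (E O p g * E O p g)
  E-iid-square zero    g = subst (_≤ ι 0 * E O p (λ a → g a * g a) + ι 0 * ι 0 * (E O p g * E O p g))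
      (sym (*-zeroˡ 0ℚ))
    (0≤+ (0≤* (0≤ι 0) (E-0≤ O p (λ a → 0≤square (g a)))) (0≤* (0≤square (ι 0)) (0≤square (E O p g))))
  E-iid-square (suc N) g = begin
    E O (iid (suc N) p) (λ v → sumV g v * sumV g v)
      ≡⟨ E-iid-suc N (λ v → sumV g v * sumV g v) ⟩
    E O p (λ a → E O (iid N p) (λ v → (g a + sumV g v) * (g a + sumV g v)))
      ≡⟨ E-cong O p (λ a → E-shift² O (iid N p) (g a) (sumV g)) ⟩
    E O p (λ a → g a * g a + (g a + g a) * E O (iid N p) (sumV g) + S²)
      ≡⟨ E-cong O p (λ a → cong (λ z → g a * g a + (g a + g a) * z + S²) (E-iid-sum N g)) ⟩
    E O p (λ a → g a * g a + (g a + g a) * (ι N * μ) + S²)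
      ≡⟨ trans (E-+ O p _ _) (cong₂ _+_ (E-+ O p _ _) (E-const O p S²)) ⟩
    μ² + E O p (λ a → (g a + g a) * (ι N * μ)) + S²
      ≡⟨ cong (λ z → μ² + z + S²) (trans (E-*ʳ O p (ι N * μ) (λ a → g a + g a)) (cong (_* (ι N * μ)) (E-+ O p g g))) ⟩
    μ² + (μ + μ) * (ι N * μ) + S²
      ≤⟨ +-monoʳ-≤ (μ² + (μ + μ) * (ι N * μ)) (E-iid-square N g) ⟩
    μ² + (μ + μ) * (ι N * μ) + (ι N * μ² + ι N * ι N * (μ * μ))
      ≤⟨ ≤-slack (μ * μ) (0≤square μ) (eq μ μ² (ι N)) ⟩
    (1ℚ + ι N) * μ² + (1ℚ + ι N) * (1ℚ + ι N) * (μ * μ)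
      ≡⟨ cong (λ z → z * μ² + z * z * (μ * μ)) (ι-suc N) ⟨
    ι (suc N) * μ² + ι (suc N) * ι (suc N) * (μ * μ) ∎
    where
    open ℚ.≤-Reasoning
    μ = E O p g
    μ² = E O p (λ a → g a * g a)
    S² = E O (iid N p) (λ v → sumV g v * sumV g v)
    eq : ∀ μ μ² k → (1ℚ + k) * μ² + (1ℚ + k) * (1ℚ + k) * (μ * μ)
      ≡ μ² + (μ + μ) * (k * μ) + (k * μ² + k * k * (μ * μ)) + μ * μ
    eq = solve-∀ ℚ-ring

  E-iid-prod : ∀ N (g : A → ℚ) → E O (iid N p) (prodV g) ≡ E O p g ^ N
  E-iid-prod zero    g = refl
  E-iid-prod (suc N) g = trans (E-iid-suc N (prodV g))
    (trans (E-product O p (iid N p) g (prodV g)) (cong (E O p g *_) (E-iid-prod N g)))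

-- Amplification by medians

cnt : (ℚ → Bool) → List ℚ → ℕ
cnt b []       = 0
cnt b (x ∷ xs) = (if b x then 1 else 0) +ℕ cnt b xs

cnt-mono : ∀ {b c} xs → (∀ {x} → x ∈ xs → b x ≡ true → c x ≡ true) → cnt b xs ≤ℕ cnt c xs
cnt-mono []       imp = z≤n
cnt-mono {b} {c} (x ∷ xs) imp with b x | c x | imp (here refl)
... | false | false | _ = cnt-mono xs (imp ∘ there)
... | false | true  | _ = ℕ.m≤n⇒m≤1+n (cnt-mono xs (imp ∘ there))
... | true  | true  | _ = s≤s (cnt-mono xs (imp ∘ there))
... | true  | false | i with i refl
...   | ()

cnt-complement : ∀ b xs → cnt b xs +ℕ cnt (not ∘ b) xs ≡ length xs
cnt-complement b []       = refl
cnt-complement b (x ∷ xs) with b x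
... | true  = cong suc (cnt-complement b xs)
... | false = trans (ℕ.+-suc (cnt b xs) _) (cong suc (cnt-complement b xs))

_≤b_ : ℚ → ℚ → Bool
x ≤b y = ⌊ x ℚ.≤? y ⌋

⌊⌋-true : ∀ {P : Set} (P? : Dec P) → P → ⌊ P? ⌋ ≡ true
⌊⌋-true (yes _) p = refl
⌊⌋-true (no ¬p) p = ⊥-elim (¬p p)

⌊⌋-false : ∀ {P : Set} (P? : Dec P) → ¬ P → ⌊ P? ⌋ ≡ false
⌊⌋-false (yes p) ¬p = ⊥-elim (¬p p)
⌊⌋-false (no _)  ¬p = refl

⌊⌋-true⁻ : ∀ {P : Set} (P? : Dec P) → ⌊ P? ⌋ ≡ true → P
⌊⌋-true⁻ (yes p) eq = p

-- The least entry with more than half of the entries at or below it. The default `max 0ℚ xs` is no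
-- smaller than any entry, so it never lowers the minimum.
median : List ℚ → ℚ
median xs = min (max 0ℚ xs) (filter (λ y → length xs ℕ.<? cnt (_≤b y) xs +ℕ cnt (_≤b y) xs) xs)

cnt≡0⇒none : ∀ {b} xs → cnt b xs ≡ 0 → ∀ {y} → y ∈ xs → b y ≡ true → ⊥
cnt≡0⇒none {b} (z ∷ zs) c≡0 (here refl) by with b z
cnt≡0⇒none {b} (z ∷ zs) () (here refl) by | true
cnt≡0⇒none {b} (z ∷ zs) c≡0 (there y∈) by with b z
cnt≡0⇒none {b} (z ∷ zs) () (there y∈) by | true
cnt≡0⇒none {b} (z ∷ zs) c≡0 (there y∈) by | false = cnt≡0⇒none zs c≡0 y∈ by

greatest : ∀ (b : ℚ → Bool) xs → 0 <ℕ cnt b xs → ∃[ g ] g ∈ xs × b g ≡ true × (∀ {x} → x ∈ xs → b x ≡ true → x ≤ g)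
greatest b (x ∷ xs) 0<c with b x in bx | cnt b xs in eq
... | false | suc k with greatest b xs (subst (0 <ℕ_) (sym eq) (s≤s z≤n))
...   | g , g∈ , bg , ub = g , there g∈ , bg , λ where
          (here refl) bx′ → case trans (sym bx) bx′ of λ ()
          (there x∈)  bx′ → ub x∈ bx′
greatest b (x ∷ xs) 0<c | true | zero = x , here refl , bx , λ where
  (here refl) _   → ≤-refl
  (there x∈)  bx′ → ⊥-elim (cnt≡0⇒none xs eq x∈ bx′)
greatest b (x ∷ xs) 0<c | true | suc k with greatest b xs (subst (0 <ℕ_) (sym eq) (s≤s z≤n))
...   | g , g∈ , bg , ub with ℚ.≤-total x g
...     | inj₁ x≤g = g , there g∈ , bg , λ where
            (here refl) _   → x≤g
            (there x∈)  bx′ → ub x∈ bx′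
...     | inj₂ g≤x = x , here refl , bx , λ where
            (here refl) _   → ≤-refl
            (there x∈)  bx′ → ≤-trans (ub x∈ bx′) g≤x

0≤^ : ∀ {x} k → 0ℚ ≤ x → 0ℚ ≤ x ^ k
0≤^ zero    0≤x = 0≤1
0≤^ (suc k) 0≤x = 0≤* 0≤x (0≤^ k 0≤x)

^-mono : ∀ {x y} k → 0ℚ ≤ x → x ≤ y → x ^ k ≤ y ^ k
^-mono zero    0≤x x≤y = ≤-refl
^-mono (suc k) 0≤x x≤y = *-mono-≤ 0≤x x≤y (0≤^ k 0≤x) (^-mono k 0≤x x≤y)

^-+ : ∀ x j k → x ^ (j +ℕ k) ≡ x ^ j * x ^ k
^-+ x zero    k = sym (*-identityˡ (x ^ k))
^-+ x (suc j) k = trans (cong (x *_) (^-+ x j k)) (sym (*-assoc x (x ^ j) (x ^ k)))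

module _ (a b : ℚ) (in? : ∀ x → Dec (a ≤ x × x ≤ b)) where

  good : ℚ → Bool
  good x = ⌊ in? x ⌋

  -- All good entries lie at or below the greatest good one, `g`, so `g` passes the filter and
  -- bounds the median from above. An entry below `a` has only bad entries at or below it, and these
  -- are a minority, so it does not pass.
  median-good : ∀ xs → cnt (not ∘ good) xs <ℕ cnt good xs → a ≤ median xs × median xs ≤ b
  median-good xs maj with greatest good xs (ℕ.≤-trans (s≤s z≤n) maj)
  ... | g , g∈ , gg , ub = v≤min⁺ a≤max (All.tabulate majority⇒a≤) , ≤-trans (All.lookup (min≤xs _ _) g∈filter)
      (proj₂ (⌊⌋-true⁻ (in? g) gg))
    where
    Maj? = λ y → length xs ℕ.<? cnt (_≤b y) xs +ℕ cnt (_≤b y) xs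
    G B : ℕ
    G = cnt good xs
    B = cnt (not ∘ good) xs
    a≤max : a ≤ max 0ℚ xs
    a≤max = ≤-trans (proj₁ (⌊⌋-true⁻ (in? g) gg)) (All.lookup (xs≤max 0ℚ xs) g∈)
    majority⇒a≤ : ∀ {y} → y ∈ filter Maj? xs → a ≤ y
    majority⇒a≤ {y} y∈ with a ℚ.≤? y
    ... | yes a≤y = a≤y
    ... | no a≰y = ⊥-elim (ℕ.<-irrefl refl (begin-strict
      length xs                          <⟨ proj₂ (∈-filter⁻ Maj? {xs = xs} y∈) ⟩
      cnt (_≤b y) xs +ℕ cnt (_≤b y) xs   ≤⟨ ℕ.+-mono-≤ le le ⟩
      B +ℕ B                             ≤⟨ ℕ.+-monoˡ-≤ B (ℕ.<⇒≤ maj) ⟩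
      G +ℕ B                             ≡⟨ cnt-complement good xs ⟩
      length xs                          ∎))
      where
      open ℕ.≤-Reasoning
      le : cnt (_≤b y) xs ≤ℕ B
      le = cnt-mono xs (λ {x} _ x≤y → cong not (⌊⌋-false (in? x)
          (λ (a≤x , _) → a≰y (≤-trans a≤x (⌊⌋-true⁻ (x ℚ.≤? y) x≤y)))))
    g∈filter : g ∈ filter Maj? xs
    g∈filter = ∈-filter⁺ Maj? g∈ (begin-strict
      length xs                          ≡⟨ cnt-complement good xs ⟨
      G +ℕ B                             <⟨ ℕ.+-monoʳ-< G maj ⟩
      G +ℕ G                             ≤⟨ ℕ.+-mono-≤ le le ⟩
      cnt (_≤b g) xs +ℕ cnt (_≤b g) xs   ∎)
      where
      open ℕ.≤-Reasoning
      le : G ≤ℕ cnt (_≤b g) xs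
      le = cnt-mono xs (λ {x} x∈ gx → ⌊⌋-true (x ℚ.≤? g) (ub x∈ gx))

  4ℚ ¼ : ℚ
  4ℚ = pos 4 / 1
  ¼ = pos 1 / 4

  -- Exponential moment: the product of the penalties is 4 ^ (#bad - #good).
  penalty : ℚ → ℚ
  penalty x = ¼ + (4ℚ - ¼) * [ not (good x) ]

  -- Multiplied through by the power of 4 for the good entries, which avoids negative exponents.
  penalty-prod : ∀ {N} (v : Vec ℚ N) →
    prodV penalty v * 4ℚ ^ cnt good (toList v) ≡ 4ℚ ^ cnt (not ∘ good) (toList v)
  penalty-prod []      = refl
  penalty-prod (x ∷ v) with good x
  ... | true  = trans (eq (prodV penalty v) (4ℚ ^ cnt good (toList v))) (penalty-prod v)
    where
    eq : ∀ p g → (¼ + (4ℚ - ¼) * 0ℚ) * p * (4ℚ * g) ≡ p * g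
    eq = solve-∀ ℚ-ring
  ... | false = trans (eq (prodV penalty v) (4ℚ ^ cnt good (toList v))) (cong (4ℚ *_) (penalty-prod v))
    where
    eq : ∀ p g → (¼ + (4ℚ - ¼) * 1ℚ) * p * g ≡ 4ℚ * (p * g)
    eq = solve-∀ ℚ-ring

  0≤penalty : ∀ x → 0ℚ ≤ penalty x
  0≤penalty x = 0≤+ (ℚ.nonNegative⁻¹ ¼) (0≤* (ℚ.nonNegative⁻¹ (4ℚ - ¼)) (0≤[] (not (good x))))

  0≤prodV : ∀ {N} {g : ℚ → ℚ} → (∀ x → 0ℚ ≤ g x) → (v : Vec ℚ N) → 0ℚ ≤ prodV g v
  0≤prodV nn []      = 0≤1
  0≤prodV nn (x ∷ v) = 0≤* (nn x) (0≤prodV nn v)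

  0<4^ : ∀ k → 0ℚ < 4ℚ ^ k
  0<4^ zero    = ℚ.positive⁻¹ 1ℚ
  0<4^ (suc k) = ℚ.positive⁻¹ _ {{ℚ.pos*pos⇒pos 4ℚ (4ℚ ^ k) {{positive (0<4^ k)}}}}

  4^-mono : ∀ {j k} → j ≤ℕ k → 4ℚ ^ j ≤ 4ℚ ^ k
  4^-mono {k = zero}  z≤n = ≤-refl
  4^-mono {k = suc k} z≤n = *-mono-≤ {1ℚ} {4ℚ} 0≤1 (ℚ.≤ᵇ⇒≤ _) 0≤1 (4^-mono {k = k} z≤n)
  4^-mono (s≤s le) = *-monoˡ 4ℚ (ℚ.nonNegative⁻¹ 4ℚ) (4^-mono le)

  median-bad≤penalty : ∀ {N} (v : Vec ℚ N) → [ not (good (median (toList v))) ] ≤ prodV penalty v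
  median-bad≤penalty v with cnt (not ∘ good) (toList v) ℕ.<? cnt good (toList v)
  ... | yes maj = subst (λ t → [ not t ] ≤ prodV penalty v) (sym (⌊⌋-true (in? _) (median-good (toList v) maj)))
      (0≤prodV 0≤penalty v)
  ... | no ¬maj = ≤-trans ([]≤1 _) (*-cancelʳ (4ℚ ^ cnt good (toList v)) (0<4^ (cnt good (toList v)))
    (subst (1ℚ * 4ℚ ^ cnt good (toList v) ≤_) (sym (penalty-prod v))
      (subst (_≤ 4ℚ ^ cnt (not ∘ good) (toList v)) (sym (*-identityˡ _)) (4^-mono (ℕ.≮⇒≥ ¬maj)))))

  -- Independence turns the mean of the product of penalties into a power of a single mean. A
  -- failure probability of 1/16 makes that mean at most 1/4 + 15/4 · 1/16 = 31/64, just below 1/2.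
  amplification : ∀ {d n} (O : Oracle d n) (p : Prog d n ℚ) N →
    E O p (λ x → [ not (good x) ]) ≤ pos 1 / 16 →
    E O (iid N p >>= λ v → ret (median (toList v))) (λ x → [ not (good x) ]) ≤ ½ ^ N
  amplification O p N le = begin
    E O (iid N p >>= λ v → ret (median (toList v))) (λ x → [ not (good x) ])  ≡⟨ E->>= O (iid N p) _ _ ⟩
    E O (iid N p) (λ v → [ not (good (median (toList v))) ])                  ≤⟨ E-mono O (iid N p)
        median-bad≤penalty ⟩
    E O (iid N p) (prodV penalty)                                             ≡⟨ E-iid-prod O p N penalty ⟩
    E O p penalty ^ N                                                         ≤⟨ ^-mono N (E-0≤ O p 0≤penalty) E≤½ ⟩
    ½ ^ N                                                                     ∎
    where
    open ℚ.≤-Reasoning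
    E≤½ : E O p penalty ≤ ½
    E≤½ = begin
      E O p penalty                                      ≡⟨ E-+ O p (λ _ → ¼) (λ x → (4ℚ - ¼) * [ not (good x) ]) ⟩
      E O p (λ _ → ¼) + E O p (λ x → (4ℚ - ¼) * [ not (good x) ])
        ≡⟨ cong₂ _+_ (E-const O p ¼) (E-* O p (4ℚ - ¼) (λ x → [ not (good x) ])) ⟩
      ¼ + (4ℚ - ¼) * E O p (λ x → [ not (good x) ])      ≤⟨ +-monoʳ-≤ ¼
          (*-monoˡ (4ℚ - ¼) (ℚ.nonNegative⁻¹ (4ℚ - ¼)) le) ⟩
      ¼ + (4ℚ - ¼) * (pos 1 / 16)                        ≤⟨ ℚ.≤ᵇ⇒≤ _ ⟩
      ½                                                  ∎

-- Chebyshev's inequality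

square≤0⇒≡0 : ∀ x → x * x ≤ 0ℚ → x ≡ 0ℚ
square≤0⇒≡0 x x²≤0 with ℚ.<-cmp x 0ℚ
... | tri≈ _ x≡0 _ = x≡0
... | tri< x<0 _ _ = ⊥-elim (ℚ.<-irrefl refl (ℚ.<-≤-trans
    (ℚ.positive⁻¹ (x * x) {{ℚ.neg*neg⇒pos x {{negative x<0}} x {{negative x<0}}}}) x²≤0))
... | tri> _ _ 0<x = ⊥-elim (ℚ.<-irrefl refl (ℚ.<-≤-trans
    (ℚ.positive⁻¹ (x * x) {{ℚ.pos*pos⇒pos x {{positive 0<x}} x {{positive 0<x}}}}) x²≤0))

square-mono : ∀ {a b} → 0ℚ ≤ a → a ≤ b → a * a ≤ b * b
square-mono 0≤a a≤b = *-mono-≤ 0≤a a≤b 0≤a a≤b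

module _ {ε : ℚ} (0<ε : 0ℚ < ε) where

  0≤ε : 0ℚ ≤ ε
  0≤ε = ℚ.<⇒≤ 0<ε

  bad : ℕ → ℚ → ℚ
  bad M x = [ not ⌊ approximates? ε M x ⌋ ]

  -- Markov's inequality before expectations are taken: a bad `x` is at distance at least `ε * ι M`
  -- from the target, on one side or the other, and for a good `x` the left side is 0.
  bad-deviation : ∀ M x → ε * ι M * (ε * ι M) * bad M x ≤ (x - ι M) * (x - ι M)
  bad-deviation M x = subst (λ μ → ε * ι M * (ε * ι M) * [ not ⌊ approximates? ε M x ⌋ ] ≤ (x - μ) * (x - μ))
      (sym (ι-def M)) main
    where
    μ = ℕ→ℚ M
    0≤εμ : 0ℚ ≤ ε * μ
    0≤εμ = 0≤* 0≤ε (subst (0ℚ ≤_) (ι-def M) (0≤ι M))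
    far : ∀ y → y * y ≡ (x - μ) * (x - μ) → ε * μ ≤ y → ε * ι M * (ε * ι M) * 1ℚ ≤ (x - μ) * (x - μ)
    far y eq le = subst₂ _≤_ (trans (cong (λ z → ε * z * (ε * z)) (sym (ι-def M))) (sym (*-identityʳ _))) eq
        (square-mono 0≤εμ le)
    lo : ∀ ε μ x → μ - x ≡ ε * μ + ((1ℚ - ε) * μ - x)
    lo = solve-∀ ℚ-ring
    hi : ∀ ε μ x → x - μ ≡ ε * μ + (x - (1ℚ + ε) * μ)
    hi = solve-∀ ℚ-ring
    flip² : ∀ μ x → (μ - x) * (μ - x) ≡ (x - μ) * (x - μ)
    flip² = solve-∀ ℚ-ring
    near : ε * ι M * (ε * ι M) * 0ℚ ≤ (x - μ) * (x - μ)
    near = subst (_≤ (x - μ) * (x - μ)) (sym (*-zeroʳ (ε * ι M * (ε * ι M)))) (0≤square (x - μ))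
    main : ε * ι M * (ε * ι M) * [ not ⌊ approximates? ε M x ⌋ ] ≤ (x - μ) * (x - μ)
    main with approximates? ε M x
    ... | yes _ = near
    ... | no far-off with (1ℚ - ε) * μ ℚ.≤? x
    ...   | no lo≰x = far (μ - x) (flip² μ x) (≤-slack _ (0≤-diff (ℚ.<⇒≤ (ℚ.≰⇒> lo≰x))) (lo ε μ x))
    ...   | yes lo≤x = far (x - μ) refl (≤-slack _ (0≤-diff (ℚ.<⇒≤ (ℚ.≰⇒> λ x≤hi → far-off (lo≤x , x≤hi))))
        (hi ε μ x))

  -- The variance is at most ε² M² / 16, and a bad output deviates by at least ε M. For M = 0 the
  -- second moment is 0, so every outcome returns exactly 0, which is good.
  chebyshev : ∀ {d n} (O : Oracle d n) (p : Prog d n ℚ) M →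
    E O p id ≡ ι M → E O p (λ x → x * x) ≤ (1ℚ + ε * ε * (pos 1 / 16)) * (ι M * ι M) →
    E O p (bad M) ≤ pos 1 / 16
  chebyshev O p zero mean moment = ≤-trans
    (E-vanish O p 0≤square vanish (≤-trans moment (≤-reflexive
        (trans (cong (λ z → (1ℚ + ε * ε * (pos 1 / 16)) * (z * ι 0)) ι-zero)
        (eq (1ℚ + ε * ε * (pos 1 / 16)) (ι 0))))))
    (ℚ.nonNegative⁻¹ (pos 1 / 16))
    where
    eq : ∀ a b → a * (0ℚ * b) ≡ 0ℚ
    eq = solve-∀ ℚ-ring
    vanish : ∀ x → x * x ≤ 0ℚ → bad 0 x ≤ 0ℚ
    vanish x x²≤0 = ≤-reflexive (cong (λ b → [ not b ]) (⌊⌋-true (approximates? ε 0 x)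
      ( subst (_≤ x) (sym (*-zeroʳ (1ℚ - ε))) (≤-reflexive (sym (square≤0⇒≡0 x x²≤0)))
      , subst (x ≤_) (sym (*-zeroʳ (1ℚ + ε))) (≤-reflexive (square≤0⇒≡0 x x²≤0)))))
  chebyshev O p M@(suc _) mean moment = *-cancelʳ s 0<s (begin
    E O p (bad M) * s                                     ≡⟨ trans (*-comm _ s) (sym (E-* O p s (bad M))) ⟩
    E O p (λ x → s * bad M x)                             ≤⟨ E-mono O p (bad-deviation M) ⟩
    E O p (λ x → (x - μ) * (x - μ))                       ≡⟨ E-cong O p (λ x → flip² μ x) ⟩
    E O p (λ x → (- μ + x) * (- μ + x))                   ≡⟨ E-shift² O p (- μ) id ⟩
    - μ * - μ + (- μ + - μ) * E O p id + E O p (λ x → x * x)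
      ≡⟨ cong (λ z → - μ * - μ + (- μ + - μ) * z + E O p (λ x → x * x)) mean ⟩
    - μ * - μ + (- μ + - μ) * μ + E O p (λ x → x * x)     ≤⟨ +-monoʳ-≤ (- μ * - μ + (- μ + - μ) * μ) moment ⟩
    - μ * - μ + (- μ + - μ) * μ + (1ℚ + ε * ε * (pos 1 / 16)) * (μ * μ)  ≡⟨ eq μ ε (pos 1 / 16) ⟩
    (pos 1 / 16) * s                                      ∎)
    where
    open ℚ.≤-Reasoning
    μ = ι M
    s = ε * μ * (ε * μ)
    εμ-pos : Positive (ε * μ)
    εμ-pos = ℚ.pos*pos⇒pos ε {{positive 0<ε}} μ {{positive (0<ι-suc _)}}
    0<s : 0ℚ < s
    0<s = ℚ.positive⁻¹ s {{ℚ.pos*pos⇒pos (ε * μ) {{εμ-pos}} (ε * μ) {{εμ-pos}}}}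
    flip² : ∀ μ x → (x - μ) * (x - μ) ≡ (- μ + x) * (- μ + x)
    flip² = solve-∀ ℚ-ring
    eq : ∀ μ ε q → - μ * - μ + (- μ + - μ) * μ + (1ℚ + ε * ε * q) * (μ * μ) ≡ q * (ε * μ * (ε * μ))
    eq = solve-∀ ℚ-ring

½^T*2^T : ∀ T → ½ ^ T * ι (2 ^ℕ T) ≡ 1ℚ
½^T*2^T zero    = trans (*-identityˡ (ι 1)) ι-one
½^T*2^T (suc T) = trans (cong (½ * ½ ^ T *_) (trans (ι-* 2 (2 ^ℕ T)) (cong (_* ι (2 ^ℕ T)) (ι-def 2))))
    (trans (eq (½ ^ T) (ι (2 ^ℕ T))) (½^T*2^T T))
  where
  eq : ∀ a b → ½ * a * (ℕ→ℚ 2 * b) ≡ a * b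
  eq = solve-∀ ℚ-ring

-- For c = 1 both exponents in `HighProbability` are 1, and a failure probability of at most 2 ^ (-
-- T) times n ≤ 2 ^ T is at most 1.
highProbability : ∀ {d n} (O : Oracle d n) (p : Prog d n ℚ) {P : ℚ → Set} (P? : ∀ x → Dec (P x)) T →
  n ≤ℕ 2 ^ℕ T → E O p (λ x → [ not ⌊ P? x ⌋ ]) ≤ ½ ^ T → HighProbability 1ℚ n (Pr P? O (toAlgorithm p))
highProbability {n = n} O p P? T n≤2^T le = begin
  (1ℚ - Pr P? O (toAlgorithm p)) * 1ℚ * (ℕ→ℚ n * 1ℚ)   ≡⟨ cong₂ _*_ (*-identityʳ (1ℚ - Pr P? O (toAlgorithm p)))
      (trans (*-identityʳ (ℕ→ℚ n)) (sym (ι-def n))) ⟩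
  (1ℚ - Pr P? O (toAlgorithm p)) * ι n                  ≡⟨ cong (λ z → (1ℚ - z) * ι n) (Pr-toAlgorithm P? O p) ⟩
  (1ℚ - E O p (λ x → [ ⌊ P? x ⌋ ])) * ι n               ≡⟨ cong (_* ι n) (E-not O p (λ x → ⌊ P? x ⌋)) ⟨
  E O p (λ x → [ not ⌊ P? x ⌋ ]) * ι n                  ≤⟨ *-mono-≤ (E-0≤ O p (λ x → 0≤[] _)) le (0≤ι n)
      (ι-mono n≤2^T) ⟩
  ½ ^ T * ι (2 ^ℕ T)                                    ≡⟨ ½^T*2^T T ⟩
  1ℚ                                                    ∎
  where
  open ℚ.≤-Reasoning

-- Sequential importance sampling

sumL : ∀ {A : Set} → (A → ℚ) → List A → ℚ
sumL g []       = 0ℚ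
sumL g (a ∷ as) = g a + sumL g as

sumL-++ : ∀ {A : Set} (g : A → ℚ) as bs → sumL g (as ++ bs) ≡ sumL g as + sumL g bs
sumL-++ g []       bs = sym (+-identityˡ (sumL g bs))
sumL-++ g (a ∷ as) bs = trans (cong (g a +_) (sumL-++ g as bs)) (sym (+-assoc (g a) (sumL g as) (sumL g bs)))

sumL-replicate : ∀ {A : Set} (g : A → ℚ) k a → sumL g (replicate k a) ≡ ι k * g a
sumL-replicate g zero    a = sym (trans (cong (_* g a) ι-zero) (*-zeroˡ (g a)))
sumL-replicate g (suc k) a = trans (cong (g a +_) (sumL-replicate g k a))
  (trans (eq (g a) (ι k)) (cong (_* g a) (sym (ι-suc k))))
  where
  eq : ∀ x k → x + k * x ≡ (1ℚ + k) * x
  eq = solve-∀ ℚ-ring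

sumL-lookup : ∀ {A : Set} (g : A → ℚ) as → sum (λ i → g (List.lookup as i)) ≡ sumL g as
sumL-lookup g []       = refl
sumL-lookup g (a ∷ as) = cong (g a +_) (sumL-lookup g as)

sumL-0≤ : ∀ {A : Set} {g : A → ℚ} → (∀ a → 0ℚ ≤ g a) → ∀ as → 0ℚ ≤ sumL g as
sumL-0≤ nn []       = ≤-refl
sumL-0≤ nn (a ∷ as) = 0≤+ (nn a) (sumL-0≤ nn as)

ι-inv : ∀ {k} → 0 <ℕ k → ι k * inv k ≡ 1ℚ
ι-inv {suc k} _ = inv-inverseʳ k

draw : ∀ {d n} {A : Set} → A → List A → Prog d n A
draw x xs = toss (length xs) (λ i → ret (List.lookup (x ∷ xs) i))

E-draw : ∀ {d n} {A : Set} (O : Oracle d n) (x : A) xs (f : A → ℚ) →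
  E O (draw x xs) f ≡ inv (suc (length xs)) * sumL f (x ∷ xs)
E-draw O x xs f = cong (inv (suc (length xs)) *_) (sumL-lookup f (x ∷ xs))

-- The resampling scheme is independent of what a particle is. `P ts` holds the particles that the
-- tests `ts` still have to split; `weigh` answers `nothing` for a particle without mass, and
-- `just c` stands for the estimate `suc c`, which is never 0.
module Population {d n : ℕ} {Test : Set} (P : List Test → Set)
  (kid    : ∀ {t ts} → P (t ∷ ts) → Bool → P ts)
  (weigh  : ∀ {ts} → P ts → Prog d n (Maybe ℕ))
  (decide : P [] → Prog d n Bool)
  (N-1 : ℕ) where

  N : ℕ
  N = suc N-1

  children : ∀ {t ts k} → Vec (ℕ × P (t ∷ ts)) k → List (ℕ × P ts)
  children []            = []
  children ((u , p) ∷ v) = (u , kid p false) ∷ (u , kid p true) ∷ children v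

  -- Repetition encodes probability: a uniform draw from the concatenated copies picks a particle
  -- with probability proportional to weight times estimate.
  copies : ∀ {ts} → ℕ → P ts → Maybe ℕ → List (ℕ × P ts)
  copies u p nothing  = []
  copies u p (just c) = replicate (u *ℕ suc c) (c , p)

  scan : ∀ {ts} → List (ℕ × P ts) → Prog d n (List (ℕ × P ts))
  scan []            = ret []
  scan ((u , p) ∷ l) = weigh p >>= λ r → scan l >>= λ X → ret (copies u p r ++ X)

  common : ∀ {ts k} → Vec (ℕ × P ts) k → ℕ
  common []            = 1
  common ((c , p) ∷ v) = suc c *ℕ common v

  -- A particle drawn with estimate suc c gets a weight proportional to 1 / suc c, cleared of
  -- denominators by the common multiple of the estimates.
  reweigh : ∀ {ts k} → ℕ → Vec (ℕ × P ts) k → Vec (ℕ × P ts) k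
  reweigh a []            = []
  reweigh a ((c , p) ∷ v) = (a *ℕ common v , p) ∷ reweigh (a *ℕ suc c) v

  tally : ∀ {k} → Vec (ℕ × P []) k → Prog d n ℚ
  tally []            = ret 0ℚ
  tally ((u , p) ∷ v) = decide p >>= λ b → tally v >>= λ S → ret (ι u * [ b ] + S)

  -- A population stands for the total `s` times the sum of weight times mass. All rational factors
  -- go into `s`; the weights stay natural numbers, because they become multiplicities in `copies`.
  run : ∀ ts → ℚ → Vec (ℕ × P ts) N → Prog d n ℚ
  resume : ∀ ts → ℚ → List (ℕ × P ts) → Prog d n ℚ

  run []       s v = tally v >>= λ S → ret (s * S)
  run (t ∷ ts) s v = scan (children v) >>= resume ts s

  -- No copies at all means that the weighted mass is 0, so the answer is exact.
  resume ts s []       = ret 0ℚ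
  resume ts s (x ∷ xs) = iid N (draw x xs) >>= λ v →
    -- A draw from a list of K entries has mean 1 / K times the sum over the list, hence the factor
    -- K / N for N draws; `inv (common v)` cancels the common multiple introduced by `reweigh`.
    run ts (s * ι (suc (length xs)) * inv N * inv (common v)) (reweigh 1 v)

  module Analysis (O : Oracle d n) (mass : ∀ {ts} → P ts → ℕ)
    (kid-mass : ∀ {t ts} (p : P (t ∷ ts)) → mass (kid p false) +ℕ mass (kid p true) ≡ mass p)
    (decide-mass : ∀ (p : P []) → ∃[ b ] [ b ] ≡ ι (mass p) × (∀ f → E O (decide p) f ≡ f b))
    (β₁ β₂ : ℕ) (1≤β₁ : 1 ≤ℕ β₁) (1≤β₂ : 1 ≤ℕ β₂)
    (weigh-law : ∀ {ts} (p : P ts) →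
      (mass p ≡ 0 × (∀ f → E O (weigh p) f ≡ f nothing)) ⊎
      (∃[ q ] (∀ f → E O (weigh p) f ≡ E O q (λ c → f (just c)))
        × E O q (λ c → ι (suc c)) ≤ ι β₁ * ι (mass p)
        × ι (mass p) * E O q (λ c → inv (suc c)) ≤ ι β₂)) where

    open ≡-Reasoning

    size : ∀ {ts} → List (ℕ × P ts) → ℚ
    size X = ι (length X)

    -- The importance weight of one copy: true mass divided by estimate.
    g : ∀ {ts} → ℕ × P ts → ℚ
    g (c , p) = ι (mass p) * inv (suc c)

    Σg Σg² : ∀ {ts} → List (ℕ × P ts) → ℚ
    Σg = sumL g
    Σg² = sumL (λ a → g a * g a)

    wmass : ∀ {ts} → ℕ × P ts → ℚ
    wmass (u , p) = ι u * ι (mass p)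

    0≤wmass : ∀ {ts} (a : ℕ × P ts) → 0ℚ ≤ wmass a
    0≤wmass (u , p) = 0≤* (0≤ι u) (0≤ι (mass p))

    size-++ : ∀ {ts} (X Y : List (ℕ × P ts)) → size (X ++ Y) ≡ size X + size Y
    size-++ X Y = trans (cong ι (List.length-++ X)) (ι-+ (length X) (length Y))

    size-copies : ∀ {ts} u (p : P ts) c → size (copies u p (just c)) ≡ ι u * ι (suc c)
    size-copies u p c = trans (cong ι (List.length-replicate (u *ℕ suc c))) (ι-* u (suc c))

    Σg-copies : ∀ {ts} u (p : P ts) c → Σg (copies u p (just c)) ≡ ι u * ι (mass p)
    Σg-copies u p c = begin
      Σg (copies u p (just c))                          ≡⟨ sumL-replicate g (u *ℕ suc c) (c , p) ⟩
      ι (u *ℕ suc c) * (ι (mass p) * inv (suc c))       ≡⟨ cong (_* (ι (mass p) * inv (suc c))) (ι-* u (suc c)) ⟩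
      ι u * ι (suc c) * (ι (mass p) * inv (suc c))      ≡⟨ eq (ι u) (ι (suc c)) (ι (mass p)) (inv (suc c)) ⟩
      ι u * ι (mass p) * (ι (suc c) * inv (suc c))      ≡⟨ cong (ι u * ι (mass p) *_) (inv-inverseʳ c) ⟩
      ι u * ι (mass p) * 1ℚ                             ≡⟨ *-identityʳ (ι u * ι (mass p)) ⟩
      ι u * ι (mass p)                                  ∎
      where
      eq : ∀ a b c d → a * b * (c * d) ≡ a * c * (b * d)
      eq = solve-∀ ℚ-ring

    Σg²-copies : ∀ {ts} u (p : P ts) c → Σg² (copies u p (just c)) ≡ ι u * ι (mass p) * (ι (mass p) * inv (suc c))
    Σg²-copies u p c = begin
      Σg² (copies u p (just c))                         ≡⟨ sumL-replicate (λ a → g a * g a) (u *ℕ suc c) (c , p) ⟩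
      ι (u *ℕ suc c) * (g (c , p) * g (c , p))          ≡⟨ *-assoc (ι (u *ℕ suc c)) (g (c , p)) (g (c , p)) ⟨
      ι (u *ℕ suc c) * g (c , p) * g (c , p)            ≡⟨ cong (_* g (c , p))
          (trans (sym (sumL-replicate g (u *ℕ suc c) (c , p))) (Σg-copies u p c)) ⟩
      ι u * ι (mass p) * (ι (mass p) * inv (suc c))     ∎

    empty-mass : ∀ {ts} u (p : P ts) → mass p ≡ 0 → 0ℚ ≡ ι u * ι (mass p)
    empty-mass u p m≡0 = sym (trans (cong (λ k → ι u * ι k) m≡0) (trans (cong (ι u *_) ι-zero) (*-zeroʳ (ι u))))

    -- The estimate multiplies the number of copies and divides the weight of each, so the sum of
    -- `g` over the copies does not depend on it. Being deterministic, it passes through any `φ`,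
    -- not only through the mean.
    weigh-Σg : ∀ {ts} u (p : P ts) φ → E O (weigh p) (λ r → φ (Σg (copies u p r))) ≡ φ (ι u * ι (mass p))
    weigh-Σg u p φ with weigh-law p
    ... | inj₁ (m≡0 , E≡) = trans (E≡ _) (cong φ (empty-mass u p m≡0))
    ... | inj₂ (q , E≡ , _) = trans (E≡ _) (trans (E-cong O q (λ c → cong φ (Σg-copies u p c)))
        (E-const O q (φ (ι u * ι (mass p)))))

    weigh-size : ∀ {ts} u (p : P ts) → E O (weigh p) (λ r → size (copies u p r)) ≤ ι β₁ * (ι u * ι (mass p))
    weigh-size u p with weigh-law p
    ... | inj₁ (m≡0 , E≡) = ≤-trans (≤-reflexive (trans (E≡ _) ι-zero)) (0≤* (0≤ι β₁) (0≤wmass (u , p)))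
    ... | inj₂ (q , E≡ , le , _) = ≤-trans
      (≤-reflexive (trans (E≡ _) (trans (E-cong O q (size-copies u p)) (E-* O q (ι u) (λ c → ι (suc c))))))
      (≤-trans (*-monoˡ (ι u) (0≤ι u) le) (≤-reflexive (eq (ι u) (ι β₁) (ι (mass p)))))
      where
      eq : ∀ a b c → a * (b * c) ≡ b * (a * c)
      eq = solve-∀ ℚ-ring

    weigh-Σg² : ∀ {ts} u (p : P ts) → E O (weigh p) (λ r → Σg² (copies u p r)) ≤ ι β₂ * (ι u * ι (mass p))
    weigh-Σg² u p with weigh-law p
    ... | inj₁ (m≡0 , E≡) = ≤-trans (≤-reflexive (E≡ _)) (0≤* (0≤ι β₂) (0≤wmass (u , p)))
    ... | inj₂ (q , E≡ , _ , le) = ≤-trans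
      (≤-reflexive (trans (E≡ _) (trans (E-cong O q (Σg²-copies u p))
          (trans (E-* O q (ι u * ι (mass p)) (λ c → ι (mass p) * inv (suc c)))
          (cong (ι u * ι (mass p) *_) (E-* O q (ι (mass p)) (λ c → inv (suc c))))))))
      (≤-trans (*-monoˡ (ι u * ι (mass p)) (0≤wmass (u , p)) le) (≤-reflexive (*-comm (ι u * ι (mass p)) (ι β₂))))

    -- Within one particle the estimate cancels between `size` and `Σg²`; this diagonal term
    -- therefore carries no factor β.
    weigh-both : ∀ {ts} u (p : P ts) →
      E O (weigh p) (λ r → size (copies u p r) * Σg² (copies u p r)) ≤ ι u * ι (mass p) * (ι u * ι (mass p))
    weigh-both u p with weigh-law p
    ... | inj₁ (m≡0 , E≡) = ≤-trans (≤-reflexive (trans (E≡ _) (*-zeroʳ (ι 0)))) (0≤square (ι u * ι (mass p)))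
    ... | inj₂ (q , E≡ , _) = ≤-reflexive (trans (E≡ _) (trans (E-cong O q pointwise) (E-const O q _)))
      where
      eq : ∀ a b c d → a * b * (a * c * (c * d)) ≡ a * c * (a * c) * (b * d)
      eq = solve-∀ ℚ-ring
      pointwise : ∀ c → size (copies u p (just c)) * Σg² (copies u p (just c)) ≡ ι u * ι (mass p) * (ι u * ι (mass p))
      pointwise c = begin
        size (copies u p (just c)) * Σg² (copies u p (just c))              ≡⟨ cong₂ _*_ (size-copies u p c)
            (Σg²-copies u p c) ⟩
        ι u * ι (suc c) * (ι u * ι (mass p) * (ι (mass p) * inv (suc c)))   ≡⟨ eq (ι u) (ι (suc c)) (ι (mass p))
            (inv (suc c)) ⟩
        ι u * ι (mass p) * (ι u * ι (mass p)) * (ι (suc c) * inv (suc c))   ≡⟨ cong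
            (ι u * ι (mass p) * (ι u * ι (mass p)) *_) (inv-inverseʳ c) ⟩
        ι u * ι (mass p) * (ι u * ι (mass p)) * 1ℚ                          ≡⟨ *-identityʳ _ ⟩
        ι u * ι (mass p) * (ι u * ι (mass p))                               ∎

    E-scan-∷ : ∀ {ts} u (p : P ts) l f →
      E O (scan ((u , p) ∷ l)) f ≡ E O (weigh p) (λ r → E O (scan l) (λ X → f (copies u p r ++ X)))
    E-scan-∷ u p l f = trans (E->>= O (weigh p) _ f) (E-cong O (weigh p) (λ r → E->>= O (scan l) _ f))

    scan-Σg : ∀ {ts} (l : List (ℕ × P ts)) φ → E O (scan l) (λ X → φ (Σg X)) ≡ φ (sumL wmass l)
    scan-Σg []            φ = refl
    scan-Σg ((u , p) ∷ l) φ = begin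
      E O (scan ((u , p) ∷ l)) (λ X → φ (Σg X))
        ≡⟨ E-scan-∷ u p l (λ X → φ (Σg X)) ⟩
      E O (weigh p) (λ r → E O (scan l) (λ X → φ (Σg (copies u p r ++ X))))
        ≡⟨ E-cong O (weigh p) (λ r → E-cong O (scan l) (λ X → cong φ (sumL-++ g (copies u p r) X))) ⟩
      E O (weigh p) (λ r → E O (scan l) (λ X → φ (Σg (copies u p r) + Σg X)))
        ≡⟨ E-cong O (weigh p) (λ r → scan-Σg l (λ x → φ (Σg (copies u p r) + x))) ⟩
      E O (weigh p) (λ r → φ (Σg (copies u p r) + sumL wmass l))
        ≡⟨ weigh-Σg u p (λ x → φ (x + sumL wmass l)) ⟩
      φ (ι u * ι (mass p) + sumL wmass l) ∎

    module _ {ts} (h : List (ℕ × P ts) → ℚ) (h-[] : h [] ≡ 0ℚ) (h-++ : ∀ X Y → h (X ++ Y) ≡ h X + h Y) (β : ℕ)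
      (h-weigh : ∀ u p → E O (weigh p) (λ r → h (copies u p r)) ≤ ι β * (ι u * ι (mass p))) where

      scan-additive : ∀ l → E O (scan l) h ≤ ι β * sumL wmass l
      scan-additive []            = ≤-reflexive (trans h-[] (sym (*-zeroʳ (ι β))))
      scan-additive ((u , p) ∷ l) = ≤-trans (≤-reflexive (begin
        E O (scan ((u , p) ∷ l)) h
          ≡⟨ E-scan-∷ u p l h ⟩
        E O (weigh p) (λ r → E O (scan l) (λ X → h (copies u p r ++ X)))
          ≡⟨ E-cong O (weigh p) (λ r → trans (E-cong O (scan l) (λ X → h-++ (copies u p r) X))
               (trans (E-+ O (scan l) (λ _ → h (copies u p r)) h)
                   (cong (_+ E O (scan l) h) (E-const O (scan l) (h (copies u p r)))))) ⟩
        E O (weigh p) (λ r → h (copies u p r) + E O (scan l) h)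
          ≡⟨ trans (E-+ O (weigh p) _ _) (cong (E O (weigh p) (λ r → h (copies u p r)) +_)
              (E-const O (weigh p) (E O (scan l) h))) ⟩
        E O (weigh p) (λ r → h (copies u p r)) + E O (scan l) h ∎))
        (≤-trans (+-mono-≤ (h-weigh u p) (scan-additive l))
            (≤-reflexive (sym (*-distribˡ-+ (ι β) (ι u * ι (mass p)) (sumL wmass l)))))

    scan-size : ∀ {ts} (l : List (ℕ × P ts)) → E O (scan l) size ≤ ι β₁ * sumL wmass l
    scan-size = scan-additive size ι-zero size-++ β₁ weigh-size

    scan-Σg² : ∀ {ts} (l : List (ℕ × P ts)) → E O (scan l) Σg² ≤ ι β₂ * sumL wmass l
    scan-Σg² = scan-additive Σg² refl (sumL-++ _) β₂ weigh-Σg²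

    β : ℕ
    β = β₁ *ℕ β₂

    1≤β : 1 ≤ℕ β
    1≤β = ℕ.*-mono-≤ 1≤β₁ 1≤β₂

    -- The estimates of distinct particles are independent, so the cross terms factor.
    scan-both : ∀ {ts} (l : List (ℕ × P ts)) →
      E O (scan l) (λ X → size X * Σg² X) ≤ ι β * (sumL wmass l * sumL wmass l)
    scan-both []            = ≤-reflexive (trans (*-zeroʳ (ι 0))
        (sym (trans (cong (ι β *_) (*-zeroʳ 0ℚ)) (*-zeroʳ (ι β)))))
    scan-both ((u , p) ∷ l) = ≤-trans (≤-reflexive expand) bound
      where
      z = ι u * ι (mass p)
      Z = sumL wmass l
      0≤z = 0≤wmass (u , p)
      0≤Z = sumL-0≤ 0≤wmass l
      W = weigh p
      S = scan l
      a = λ r → size (copies u p r)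
      b = λ r → Σg² (copies u p r)
      EA = E O W a
      EB = E O W b
      EA′ = E O S size
      EB′ = E O S Σg²
      EAB′ = E O S (λ X → size X * Σg² X)
      fuse : ∀ x y v w → (x + v) * (y + w) ≡ x * y + x * w + y * v + v * w
      fuse = solve-∀ ℚ-ring
      inner : ∀ r → E O S (λ X → size (copies u p r ++ X) * Σg² (copies u p r ++ X)) ≡ a r * b r + a r * EB′ + b
          r * EA′ + EAB′
      inner r = begin
        E O S (λ X → size (copies u p r ++ X) * Σg² (copies u p r ++ X))
          ≡⟨ E-cong O S (λ X → trans (cong₂ _*_ (size-++ (copies u p r) X) (sumL-++ _ (copies u p r) X))
              (fuse (a r) (b r) (size X) (Σg² X))) ⟩
        E O S (λ X → a r * b r + a r * Σg² X + b r * size X + size X * Σg² X)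
          ≡⟨ trans (E-+ O S _ _) (cong (_+ EAB′) (trans (E-+ O S _ _) (cong₂ _+_ (E-+ O S _ _) refl))) ⟩
        E O S (λ X → a r * b r) + E O S (λ X → a r * Σg² X) + E O S (λ X → b r * size X) + EAB′
          ≡⟨ cong (_+ EAB′) (cong₂ _+_ (cong₂ _+_ (E-const O S (a r * b r)) (E-* O S (a r) Σg²))
              (E-* O S (b r) size)) ⟩
        a r * b r + a r * EB′ + b r * EA′ + EAB′ ∎
      expand : E O (scan ((u , p) ∷ l)) (λ X → size X * Σg² X) ≡ E O W (λ r → a r * b r) + EA * EB′ + EB * EA′ + EAB′
      expand = begin
        E O (scan ((u , p) ∷ l)) (λ X → size X * Σg² X)
          ≡⟨ trans (E-scan-∷ u p l _) (E-cong O W inner) ⟩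
        E O W (λ r → a r * b r + a r * EB′ + b r * EA′ + EAB′)
          ≡⟨ trans (E-+ O W _ _) (cong₂ _+_ (trans (E-+ O W _ _) (cong₂ _+_ (E-+ O W _ _) refl)) refl) ⟩
        E O W (λ r → a r * b r) + E O W (λ r → a r * EB′) + E O W (λ r → b r * EA′) + E O W (λ r → EAB′)
          ≡⟨ cong₂ _+_ (cong₂ _+_ (cong (E O W (λ r → a r * b r) +_) (E-*ʳ O W EB′ a)) (E-*ʳ O W EA′ b))
              (E-const O W EAB′) ⟩
        E O W (λ r → a r * b r) + EA * EB′ + EB * EA′ + EAB′ ∎
      0≤size = λ (X : List (ℕ × P _)) → 0≤ι (length X)
      0≤Σg² = sumL-0≤ (λ a → 0≤square (g a))
      collect : ∀ β₁ β₂ z Z β-1 → (β-1 ≡ β₁ * β₂ - 1ℚ) →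
        β₁ * β₂ * ((z + Z) * (z + Z)) ≡ z * z + β₁ * z * (β₂ * Z) + β₂ * z * (β₁ * Z) + β₁ * β₂ * (Z * Z) + β-1
            * (z * z)
      collect β₁ β₂ z Z _ refl = eq β₁ β₂ z Z
        where
        eq : ∀ β₁ β₂ z Z → β₁ * β₂ * ((z + Z) * (z + Z)) ≡ z * z + β₁ * z * (β₂ * Z) + β₂ * z * (β₁ * Z) + β₁ *
            β₂ * (Z * Z) + (β₁ * β₂ - 1ℚ) * (z * z)
        eq = solve-∀ ℚ-ring
      bound : E O W (λ r → a r * b r) + EA * EB′ + EB * EA′ + EAB′ ≤ ι β * ((z + Z) * (z + Z))
      bound = ≤-trans (+-mono-≤ (+-mono-≤ (+-mono-≤ (weigh-both u p)
          (*-mono-≤ (E-0≤ O W (λ r → 0≤size (copies u p r))) (weigh-size u p) (E-0≤ O S 0≤Σg²) (scan-Σg² l)))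
          (*-mono-≤ (E-0≤ O W (λ r → 0≤Σg² (copies u p r))) (weigh-Σg² u p) (E-0≤ O S 0≤size) (scan-size l)))
          (scan-both l))
        -- The diagonal term arrives with coefficient 1 instead of β; the slack makes up the
        -- difference.
        (≤-slack ((ι β₁ * ι β₂ - 1ℚ) * (z * z))
          (0≤* (0≤-diff (subst (1ℚ ≤_) (ι-* β₁ β₂) (1≤ι 1≤β))) (0≤square z))
          (trans (cong (_* ((z + Z) * (z + Z))) (ι-* β₁ β₂)) (trans (collect (ι β₁) (ι β₂) z Z _ refl)
            (cong (λ w → z * z + ι β₁ * z * (ι β₂ * Z) + ι β₂ * z * (ι β₁ * Z) + w * (Z * Z) +
                (ι β₁ * ι β₂ - 1ℚ) * (z * z)) (sym (ι-* β₁ β₂))))))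

    children-mass : ∀ {t ts k} (v : Vec (ℕ × P (t ∷ ts)) k) → sumL wmass (children v) ≡ sumV wmass v
    children-mass []            = refl
    children-mass ((u , p) ∷ v) = begin
      ι u * ι m₀ + (ι u * ι m₁ + sumL wmass (children v))   ≡⟨ eq (ι u) (ι m₀) (ι m₁) (sumL wmass (children v)) ⟩
      ι u * (ι m₀ + ι m₁) + sumL wmass (children v)         ≡⟨ cong₂ (λ x y → ι u * x + y)
          (trans (sym (ι-+ m₀ m₁)) (cong ι (kid-mass p))) (children-mass v) ⟩
      ι u * ι (mass p) + sumV wmass v                       ∎
      where
      m₀ = mass (kid p false)
      m₁ = mass (kid p true)
      eq : ∀ u a b c → u * a + (u * b + c) ≡ u * (a + b) + c
      eq = solve-∀ ℚ-ring

    0<common : ∀ {ts k} (v : Vec (ℕ × P ts) k) → 0 <ℕ common v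
    0<common []            = s≤s z≤n
    0<common ((c , p) ∷ v) = ℕ.*-mono-≤ {1} {suc c} (s≤s z≤n) (0<common v)

    -- The accumulator `a` collects the estimates already passed, so a particle ends up with the
    -- product of all estimates but its own, times the initial `a`.
    reweigh-mass : ∀ {ts k} a (v : Vec (ℕ × P ts) k) → sumV wmass (reweigh a v) ≡ ι a * ι (common v) * sumV g v
    reweigh-mass a []            = sym (*-zeroʳ (ι a * ι 1))
    reweigh-mass a ((c , p) ∷ v) = begin
      ι (a *ℕ common v) * ι (mass p) + sumV wmass (reweigh (a *ℕ suc c) v)
        ≡⟨ cong₂ _+_ (cong (_* ι (mass p)) (ι-* a (common v)))
            (trans (reweigh-mass (a *ℕ suc c) v) (cong (λ x → x * ι (common v) * sumV g v) (ι-* a (suc c)))) ⟩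
      ι a * ι (common v) * ι (mass p) + ι a * ι (suc c) * ι (common v) * sumV g v
        ≡⟨ cong (λ x → x + ι a * ι (suc c) * ι (common v) * sumV g v)
            (trans (sym (*-identityʳ (ι a * ι (common v) * ι (mass p))))
            (cong (ι a * ι (common v) * ι (mass p) *_) (sym (inv-inverseʳ c)))) ⟩
      ι a * ι (common v) * ι (mass p) * (ι (suc c) * inv (suc c)) + ι a * ι (suc c) * ι (common v) * sumV g v
        ≡⟨ eq (ι a) (ι (common v)) (ι (mass p)) (ι (suc c)) (inv (suc c)) (sumV g v) ⟩
      ι a * (ι (suc c) * ι (common v)) * (ι (mass p) * inv (suc c) + sumV g v)
        ≡⟨ cong (λ x → ι a * x * (ι (mass p) * inv (suc c) + sumV g v)) (ι-* (suc c) (common v)) ⟨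
      ι a * ι (suc c *ℕ common v) * (ι (mass p) * inv (suc c) + sumV g v) ∎
      where
      eq : ∀ a D m c i S → a * D * m * (c * i) + a * c * D * S ≡ a * (c * D) * (m * i + S)
      eq = solve-∀ ℚ-ring

    resampled-mass : ∀ {ts k} s (v : Vec (ℕ × P ts) k) → s * inv (common v) * sumV wmass (reweigh 1 v) ≡ s * sumV g v
    resampled-mass s v = begin
      s * inv (common v) * sumV wmass (reweigh 1 v)                ≡⟨ cong (s * inv (common v) *_)
          (reweigh-mass 1 v) ⟩
      s * inv (common v) * (ι 1 * ι (common v) * sumV g v)         ≡⟨ eq s (inv (common v)) (ι 1) (ι (common v))
          (sumV g v) ⟩
      s * (ι (common v) * inv (common v)) * ι 1 * sumV g
          v         ≡⟨ cong₂ (λ x y → s * x * y * sumV g v) (ι-inv (0<common v)) ι-one ⟩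
      s * 1ℚ * 1ℚ * sumV g v                                       ≡⟨ cong (_* sumV g v)
          (trans (*-identityʳ (s * 1ℚ)) (*-identityʳ s)) ⟩
      s * sumV g v                                                 ∎
      where
      eq : ∀ s i o D S → s * i * (o * D * S) ≡ s * (D * i) * o * S
      eq = solve-∀ ℚ-ring

    tally-mass : ∀ {k} (v : Vec (ℕ × P []) k) f → E O (tally v) f ≡ f (sumV wmass v)
    tally-mass []            f = refl
    tally-mass ((u , p) ∷ v) f with decide-mass p
    ... | b , b≡ , E≡ = begin
      E O (tally ((u , p) ∷ v)) f
        ≡⟨ trans (E->>= O (decide p) _ f) (E≡ _) ⟩
      E O (tally v >>= λ S → ret (ι u * [ b ] + S)) f
        ≡⟨ trans (E->>= O (tally v) _ f) (tally-mass v (λ S → f (ι u * [ b ] + S))) ⟩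
      f (ι u * [ b ] + sumV wmass v)
        ≡⟨ cong (λ x → f (ι u * x + sumV wmass v)) b≡ ⟩
      f (ι u * ι (mass p) + sumV wmass v) ∎

    -- Redrawing is unbiased whatever values the estimates take, since importance weights undo the
    -- bias of the draw; the quality of `weigh` enters only through the second moment.
    run-mean : ∀ ts s (v : Vec (ℕ × P ts) N) → E O (run ts s v) id ≡ s * sumV wmass v
    resume-mean : ∀ ts s (X : List (ℕ × P ts)) → E O (resume ts s X) id ≡ s * Σg X

    run-mean []       s v = trans (E->>= O (tally v) _ id) (tally-mass v (s *_))
    run-mean (t ∷ ts) s v = begin
      E O (run (t ∷ ts) s v) id                                     ≡⟨ trans (E->>= O (scan (children v)) _ id)
          (E-cong O (scan (children v)) (resume-mean ts s)) ⟩
      E O (scan (children v)) (λ X → s * Σg X)                      ≡⟨ scan-Σg (children v) (s *_) ⟩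
      s * sumL wmass (children v)                                   ≡⟨ cong (s *_) (children-mass v) ⟩
      s * sumV wmass v                                              ∎

    resume-mean ts s []       = sym (*-zeroʳ s)
    resume-mean ts s (x ∷ xs) = begin
      E O (resume ts s (x ∷ xs)) id
        ≡⟨ trans (E->>= O (iid N (draw x xs)) _ id)
            (E-cong O (iid N (draw x xs)) (λ v → trans (run-mean ts _ (reweigh 1 v)) (resampled-mass r v))) ⟩
      E O (iid N (draw x xs)) (λ v → r * sumV g v)
        ≡⟨ trans (E-* O (iid N (draw x xs)) r (sumV g))
            (cong (r *_) (trans (E-iid-sum O (draw x xs) N g) (cong (ι N *_) (E-draw O x xs g)))) ⟩
      s * ι K * inv N * (ι N * (inv K * Σg (x ∷ xs)))
        ≡⟨ eq s (ι K) (inv N) (ι N) (inv K) (Σg (x ∷ xs)) ⟩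
      s * (ι K * inv K) * (ι N * inv N) * Σg (x ∷ xs)
        ≡⟨ cong₂ (λ a b → s * a * b * Σg (x ∷ xs)) (inv-inverseʳ (length xs)) (inv-inverseʳ N-1) ⟩
      s * 1ℚ * 1ℚ * Σg (x ∷ xs)
        ≡⟨ cong (_* Σg (x ∷ xs)) (trans (*-identityʳ (s * 1ℚ)) (*-identityʳ s)) ⟩
      s * Σg (x ∷ xs) ∎
      where
      K = suc (length xs)
      r = s * ι K * inv N
      eq : ∀ s k i N j S → s * k * i * (N * (j * S)) ≡ s * (k * j) * (N * i) * S
      eq = solve-∀ ℚ-ring

    ρ : ℚ
    ρ = 1ℚ + ι β * inv N

    0≤ρ^ : ∀ k → 0ℚ ≤ ρ ^ k
    0≤ρ^ zero    = 0≤1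
    0≤ρ^ (suc k) = 0≤* (0≤+ 0≤1 (0≤* (0≤ι β) (0≤inv N))) (0≤ρ^ k)

    -- For a fixed list `X` of copies, the N draws have the second moment bounded in
    -- `resume-square`: a variance term, `size X * Σg² X` over N, and the squared mean. Averaged
    -- over the estimates, `scan-both` bounds the former by β / N times the latter, so each step
    -- costs a factor `ρ`.
    run-square : ∀ ts s (v : Vec (ℕ × P ts) N) →
      E O (run ts s v) (λ x → x * x) ≤ ρ ^ length ts * (s * sumV wmass v * (s * sumV wmass v))
    resume-square : ∀ ts s (X : List (ℕ × P ts)) →
      E O (resume ts s X) (λ x → x * x) ≤ ρ ^ length ts * (s * s * inv N * (size X * Σg² X) + s * Σg X * (s * Σg X))

    run-square []       s v = ≤-reflexive (trans (E->>= O (tally v) _ _)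
        (trans (tally-mass v (λ S → s * S * (s * S))) (sym (*-identityˡ _))))
    run-square (t ∷ ts) s v = ≤-trans (≤-reflexive (E->>= O (scan (children v)) _ _)) (≤-trans
      (E-mono O (scan (children v)) (resume-square ts s))
      (≤-trans (≤-reflexive (begin
        E O Sc (λ X → R * (s * s * inv N * (size X * Σg² X) + s * Σg X * (s * Σg X)))
          ≡⟨ E-* O Sc R _ ⟩
        R * E O Sc (λ X → s * s * inv N * (size X * Σg² X) + s * Σg X * (s * Σg X))
          ≡⟨ cong (R *_) (trans (E-+ O Sc _ _) (cong₂ _+_ (E-* O Sc (s * s * inv N) (λ X → size X * Σg² X))
              (scan-Σg (children v) (λ x → s * x * (s * x))))) ⟩
        R * (s * s * inv N * E O Sc (λ X → size X * Σg² X) + s * Zl * (s * Zl)) ∎))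
      (≤-trans (*-monoˡ R (0≤ρ^ (length ts)) (+-monoˡ-≤ (s * Zl * (s * Zl))
          (*-monoˡ (s * s * inv N) (0≤* (0≤square s) (0≤inv N)) (scan-both (children v)))))
      (≤-reflexive (trans (eq R s (inv N) (ι β) Zl) (cong (λ z → ρ * R * (s * z * (s * z))) (children-mass v)))))))
      where
      R = ρ ^ length ts
      Sc = scan (children v)
      Zl = sumL wmass (children v)
      eq : ∀ R s i β Z → R * (s * s * i * (β * (Z * Z)) + s * Z * (s * Z)) ≡ (1ℚ + β * i) * R * (s * Z * (s * Z))
      eq = solve-∀ ℚ-ring

    resume-square ts s []       = 0≤* (0≤ρ^ (length ts))
        (0≤+ (0≤* (0≤* (0≤square s) (0≤inv N)) (0≤* (0≤ι 0) ≤-refl)) (0≤square (s * 0ℚ)))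
    resume-square ts s (x ∷ xs) = ≤-trans (≤-reflexive (E->>= O D _ _)) (≤-trans
      (E-mono O D (λ v → ≤-trans (run-square ts _ (reweigh 1 v))
          (≤-reflexive (cong (λ z → R * (z * z)) (resampled-mass r v)))))
      (≤-trans (≤-reflexive (trans (E-* O D R _) (cong (R *_)
          (trans (E-cong O D (λ v → square-* r (sumV g v))) (E-* O D (r * r) (λ v → sumV g v * sumV g v))))))
      (*-monoˡ R (0≤ρ^ (length ts)) (≤-trans (*-monoˡ (r * r) (0≤square r) (E-iid-square O (draw x xs) N g))
          (≤-reflexive (begin
        r * r * (ι N * E O (draw x xs) (λ a → g a * g a) + ι N * ι N * (E O (draw x xs) g * E O (draw x xs) g))
          ≡⟨ cong₂ (λ a b → r * r * (ι N * a + ι N * ι N * (b * b))) (E-draw O x xs (λ a → g a * g a))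
              (E-draw O x xs g) ⟩
        s * ι K * inv N * (s * ι K * inv N) * (ι N * (inv K * G²) + ι N * ι N * (inv K * G * (inv K * G)))
          ≡⟨ eq s (ι K) (inv N) (ι N) (inv K) G² G ⟩
        (ι K * inv K) * (ι N * inv N) * (s * s * inv N * (ι K * G²)) + (ι K * inv K) * (ι K * inv K) *
            ((ι N * inv N) * (ι N * inv N)) * (s * G * (s * G))
          ≡⟨ cong₂ (λ a b → a * b * (s * s * inv N * (ι K * G²)) + a * a * (b * b) * (s * G * (s * G)))
              (inv-inverseʳ (length xs)) (inv-inverseʳ N-1) ⟩
        1ℚ * 1ℚ * (s * s * inv N * (ι K * G²)) + 1ℚ * 1ℚ * (1ℚ * 1ℚ) * (s * G * (s * G))
          ≡⟨ ones (s * s * inv N * (ι K * G²)) (s * G * (s * G)) ⟩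
        s * s * inv N * (ι K * G²) + s * G * (s * G) ∎))))))
      where
      K = suc (length xs)
      r = s * ι K * inv N
      R = ρ ^ length ts
      D = iid N (draw x xs)
      G = Σg (x ∷ xs)
      G² = Σg² (x ∷ xs)
      square-* : ∀ a b → a * b * (a * b) ≡ a * a * (b * b)
      square-* = solve-∀ ℚ-ring
      ones : ∀ a b → 1ℚ * 1ℚ * a + 1ℚ * 1ℚ * (1ℚ * 1ℚ) * b ≡ a + b
      ones = solve-∀ ℚ-ring
      eq : ∀ s k i N j G² G → s * k * i * (s * k * i) * (N * (j * G²) + N * N * (j * G * (j * G)))
        ≡ (k * j) * (N * i) * (s * s * i * (k * G²)) + (k * j) * (k * j) * ((N * i) * (N * i)) * (s * G * (s * G))
      eq = solve-∀ ℚ-ring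

module PopulationCost {d n : ℕ} {Test : Set} (P : List Test → Set)
  (kid    : ∀ {t ts} → P (t ∷ ts) → Bool → P ts)
  (weigh  : ∀ {ts} → P ts → Prog d n (Maybe ℕ))
  (decide : P [] → Prog d n Bool)
  (N-1 : ℕ) (O : Oracle d n) (w : ℕ)
  (cost-weigh  : ∀ {ts} (p : P ts) → cost O (weigh p) ≤ℕ w)
  (cost-decide : ∀ (p : P []) → cost O (decide p) ≤ℕ 1) where

  open Population P kid weigh decide N-1

  length-children : ∀ {t ts k} (v : Vec (ℕ × P (t ∷ ts)) k) → length (children v) ≡ k +ℕ k
  length-children []      = refl
  length-children {k = suc k} (a ∷ v) = cong suc (trans (cong suc (length-children v)) (sym (ℕ.+-suc k k)))

  cost-scan : ∀ {ts} (l : List (ℕ × P ts)) → cost O (scan l) ≤ℕ length l *ℕ w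
  cost-scan []            = z≤n
  cost-scan ((u , p) ∷ l) = ℕ.≤-trans
    (cost->>= O (weigh p) _ (λ r → ℕ.≤-trans (cost->>= O (scan l) _ (λ X → z≤n))
        (ℕ.≤-trans (ℕ.≤-reflexive (ℕ.+-identityʳ _)) (cost-scan l))))
    (ℕ.+-monoˡ-≤ (length l *ℕ w) (cost-weigh p))

  cost-tally : ∀ {k} (v : Vec (ℕ × P []) k) → cost O (tally v) ≤ℕ k
  cost-tally []            = z≤n
  cost-tally {suc k} ((u , p) ∷ v) = ℕ.≤-trans
    (cost->>= O (decide p) _ (λ b → ℕ.≤-trans (cost->>= O (tally v) _ (λ S → z≤n))
        (ℕ.≤-trans (ℕ.≤-reflexive (ℕ.+-identityʳ _)) (cost-tally v))))
    (ℕ.+-monoˡ-≤ k (cost-decide p))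

  cost-draws : ∀ {ts} k (x : ℕ × P ts) xs → cost O (iid k (draw x xs)) ≤ℕ 0
  cost-draws k x xs = ℕ.≤-trans (cost-iid O (draw x xs) k (⨆-≤ {suc (length xs)} {0} {λ _ → 0} (λ i → z≤n)))
      (ℕ.≤-reflexive (ℕ.*-zeroʳ k))

  cost-run : ∀ ts s (v : Vec (ℕ × P ts) N) → cost O (run ts s v) ≤ℕ length ts *ℕ ((N +ℕ N) *ℕ w) +ℕ N
  cost-resume : ∀ ts s (X : List (ℕ × P ts)) → cost O (resume ts s X) ≤ℕ length ts *ℕ ((N +ℕ N) *ℕ w) +ℕ N

  cost-run []       s v = ℕ.≤-trans (cost->>= O (tally v) _ (λ S → z≤n))
      (ℕ.≤-trans (ℕ.≤-reflexive (ℕ.+-identityʳ _)) (cost-tally v))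
  cost-run (t ∷ ts) s v = ℕ.≤-trans (cost->>= O (scan (children v)) _ (cost-resume ts s))
    (ℕ.≤-trans (ℕ.+-monoˡ-≤ _ (ℕ.≤-trans (cost-scan (children v)) (ℕ.≤-reflexive (cong (_*ℕ w) (length-children v)))))
      (ℕ.≤-reflexive (sym (ℕ.+-assoc ((N +ℕ N) *ℕ w) (length ts *ℕ ((N +ℕ N) *ℕ w)) N))))

  cost-resume ts s []       = z≤n
  cost-resume ts s (x ∷ xs) = ℕ.≤-trans
    (cost->>= O (iid N (draw x xs)) _ (λ v → cost-run ts _ (reweigh 1 v)))
    (ℕ.+-monoˡ-≤ _ (cost-draws N x xs))

-- Relations and random vertex subsets

ℕ-interchange : ∀ a b c e → a +ℕ b +ℕ (c +ℕ e) ≡ a +ℕ c +ℕ (b +ℕ e)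
ℕ-interchange = ℕ-solve-∀

sumℕ : ∀ {k} → (Fin k → ℕ) → ℕ
sumℕ = foldr _+ℕ_ 0

sumℕ-cong : ∀ {k} {f g : Fin k → ℕ} → (∀ i → f i ≡ g i) → sumℕ f ≡ sumℕ g
sumℕ-cong {zero}  eq = refl
sumℕ-cong {suc k} eq = cong₂ _+ℕ_ (eq zero) (sumℕ-cong (eq ∘ suc))

sumℕ-mono : ∀ {k} {f g : Fin k → ℕ} → (∀ i → f i ≤ℕ g i) → sumℕ f ≤ℕ sumℕ g
sumℕ-mono {zero}  le = z≤n
sumℕ-mono {suc k} le = ℕ.+-mono-≤ (le zero) (sumℕ-mono (le ∘ suc))

sumℕ-+ : ∀ {k} (f g : Fin k → ℕ) → sumℕ (λ i → f i +ℕ g i) ≡ sumℕ f +ℕ sumℕ g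
sumℕ-+ {zero}  f g = refl
sumℕ-+ {suc k} f g = trans (cong (f zero +ℕ g zero +ℕ_) (sumℕ-+ (f ∘ suc) (g ∘ suc)))
    (ℕ-interchange (f zero) (g zero) _ _)

sumℕ-const : ∀ k c → sumℕ {k} (λ _ → c) ≡ k *ℕ c
sumℕ-const zero    c = refl
sumℕ-const (suc k) c = cong (c +ℕ_) (sumℕ-const k c)

sumℕ-* : ∀ {k} c (f : Fin k → ℕ) → sumℕ (λ i → c *ℕ f i) ≡ c *ℕ sumℕ f
sumℕ-* {zero}  c f = sym (ℕ.*-zeroʳ c)
sumℕ-* {suc k} c f = trans (cong (c *ℕ f zero +ℕ_) (sumℕ-* c (f ∘ suc))) (sym (ℕ.*-distribˡ-+ c (f zero) _))

sumℕ-swap : ∀ {j k} (f : Fin j → Fin k → ℕ) → sumℕ (λ a → sumℕ (f a)) ≡ sumℕ (λ b → sumℕ (λ a → f a b))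
sumℕ-swap {zero}  {k} f = sym (trans (sumℕ-const k 0) (ℕ.*-zeroʳ k))
sumℕ-swap {suc j} {k} f = trans (cong (sumℕ (f zero) +ℕ_) (sumℕ-swap (f ∘ suc)))
    (sym (sumℕ-+ (f zero) (λ b → sumℕ (λ a → f (suc a) b))))

term≤sumℕ : ∀ {k} (f : Fin k → ℕ) i → f i ≤ℕ sumℕ f
term≤sumℕ {suc k} f zero    = ℕ.m≤m+n (f zero) _
term≤sumℕ {suc k} f (suc i) = ℕ.≤-trans (term≤sumℕ (f ∘ suc) i) (ℕ.m≤n+m _ (f zero))

ι-sumℕ : ∀ {k} (f : Fin k → ℕ) → ι (sumℕ f) ≡ sum (λ i → ι (f i))
ι-sumℕ {zero}  f = ι-zero
ι-sumℕ {suc k} f = trans (ι-+ (f zero) (sumℕ (f ∘ suc))) (cong (ι (f zero) +_) (ι-sumℕ (f ∘ suc)))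

E-sum : ∀ {d n k} {A : Set} (O : Oracle d n) (p : Prog d n A) (f : Fin k → A → ℚ) →
  E O p (λ a → sum (λ i → f i a)) ≡ sum (λ i → E O p (f i))
E-sum {k = zero}  O p f = E-const O p 0ℚ
E-sum {k = suc k} O p f = trans (E-+ O p (f zero) (λ a → sum (λ i → f (suc i) a)))
    (cong (E O p (f zero) +_) (E-sum O p (f ∘ suc)))

bit : Bool → ℕ
bit b = if b then 1 else 0

ι-bit : ∀ b → ι (bit b) ≡ [ b ]
ι-bit true  = ι-one
ι-bit false = ι-zero

bit-∧ : ∀ a b → bit (a ∧ b) ≡ bit a *ℕ bit b
bit-∧ true  b = sym (ℕ.*-identityˡ (bit b))
bit-∧ false b = refl

bit≤1 : ∀ b → bit b ≤ℕ 1
bit≤1 true  = s≤s z≤n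
bit≤1 false = z≤n

anyF : ∀ {k} → (Fin k → Bool) → Bool
anyF = foldr _∨_ false

anyF-true : ∀ {k} (f : Fin k → Bool) i → f i ≡ true → anyF f ≡ true
anyF-true f zero    eq = cong (_∨ anyF (f ∘ suc)) eq
anyF-true f (suc i) eq with f zero
... | true  = refl
... | false = anyF-true (f ∘ suc) i eq

anyF-true⁻ : ∀ {k} (f : Fin k → Bool) → anyF f ≡ true → ∃[ i ] f i ≡ true
anyF-true⁻ {suc k} f eq with f zero in f0
... | true  = zero , f0
... | false with anyF-true⁻ (f ∘ suc) eq
...   | i , fi = suc i , fi

∧-true⁻ : ∀ {a b} → a ∧ b ≡ true → a ≡ true × b ≡ true
∧-true⁻ {true} eq = refl , eq

bit-anyF : ∀ {k} (f : Fin k → Bool) → bit (anyF f) ≤ℕ sumℕ (bit ∘ f)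
bit-anyF {zero}  f = z≤n
bit-anyF {suc k} f with f zero
... | true  = s≤s z≤n
... | false = bit-anyF (f ∘ suc)

Relation : ℕ → ℕ → Set
Relation n d = Vec (Fin n) d → Bool

total : ∀ {n d} → Relation n d → ℕ
total {d = zero}  h = bit (h [])
total {d = suc d} h = sumℕ (λ v → total (λ t → h (v ∷ t)))

total-mono : ∀ {n d} {h h′ : Relation n d} → (∀ t → h t ≡ true → h′ t ≡ true) → total h ≤ℕ total h′
total-mono {d = zero} {h} {h′} imp with h [] | h′ [] | imp []
... | false | _     | _ = z≤n
... | true  | true  | _ = s≤s z≤n
... | true  | false | i with i refl
...   | ()
total-mono {d = suc d} imp = sumℕ-mono (λ v → total-mono (λ t → imp (v ∷ t)))

total≤n^d : ∀ {n d} (h : Relation n d) → total h ≤ℕ n ^ℕ d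
total≤n^d {d = zero} h with h []
... | true  = s≤s z≤n
... | false = z≤n
total≤n^d {n} {suc d} h = ℕ.≤-trans (sumℕ-mono (λ v → total≤n^d (λ t → h (v ∷ t))))
    (ℕ.≤-reflexive (sumℕ-const n (n ^ℕ d)))

total-any : ∀ {n d k} (b : Fin k → Bool) (h : Fin k → Relation n d) →
  total (λ t → anyF (λ v → b v ∧ h v t)) ≤ℕ sumℕ (λ v → bit (b v) *ℕ total (h v))
total-any {d = zero} b h = ℕ.≤-trans (bit-anyF (λ v → b v ∧ h v []))
    (ℕ.≤-reflexive (sumℕ-cong (λ v → bit-∧ (b v) (h v []))))
total-any {d = suc d} b h = ℕ.≤-trans (sumℕ-mono (λ u → total-any b (λ v t → h v (u ∷ t))))
  (ℕ.≤-reflexive (trans (sumℕ-swap (λ u v → bit (b v) *ℕ total (λ t → h v (u ∷ t))))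
      (sumℕ-cong (λ v → sumℕ-* (bit (b v)) (λ u → total (λ t → h v (u ∷ t)))))))

-- Projection along the first coordinate: the tails that some vertex of `T` extends to a tuple of
-- `h`. Iterated, it decides in `hit` whether the product of the sets meets `h`, and it lets trials
-- be analysed one coordinate at a time.
link : ∀ {n d} → Vec Bool n → Relation n (suc d) → Relation n d
link T h t = anyF (λ v → lookup T v ∧ h (v ∷ t))

hit : ∀ {n d} → Relation n d → Vec (Vec Bool n) d → Bool
hit h []       = h []
hit h (T ∷ Ts) = hit (link T h) Ts

-- Each vertex is kept independently with probability 1 / (r + 1); this is why `samples` passes the
-- predecessor of a power of two.
keep : ∀ {d n} → ℕ → (k : ℕ) → Prog d n (Vec Bool k)
keep r zero    = ret []
keep r (suc k) = toss r λ i → keep r k >>= λ T → ret (does (i Fin.≟ zero) ∷ T)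

module _ {d n : ℕ} (O : Oracle d n) (r : ℕ) where

  E-keep-suc : ∀ k (f : Vec Bool (suc k) → ℚ) → E O (keep r (suc k)) f
    ≡ inv (suc r) * (E O (keep r k) (λ T → f (true ∷ T)) + ι r * E O (keep r k) (λ T → f (false ∷ T)))
  E-keep-suc k f = cong (inv (suc r) *_) (cong₂ _+_ (E->>= O (keep r k) _ f)
    (trans (sum-cong {r} (λ i → E->>= O (keep r k) _ f)) (sum-const r _)))

  average : ∀ x → inv (suc r) * (x + ι r * x) ≡ x
  average x = begin
    inv (suc r) * (x + ι r * x)        ≡⟨ eq (inv (suc r)) x (ι r) ⟩
    (1ℚ + ι r) * inv (suc r) * x       ≡⟨ cong (λ y → y * inv (suc r) * x) (ι-suc r) ⟨
    ι (suc r) * inv (suc r) * x        ≡⟨ cong (_* x) (inv-inverseʳ r) ⟩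
    1ℚ * x                             ≡⟨ *-identityˡ x ⟩
    x                                  ∎
    where
    open ≡-Reasoning
    eq : ∀ i x r → i * (x + r * x) ≡ (1ℚ + r) * i * x
    eq = solve-∀ ℚ-ring

  E-keep-∈ : ∀ k (v : Fin k) → E O (keep r k) (λ T → [ lookup T v ]) ≡ inv (suc r)
  E-keep-∈ (suc k) zero = trans (E-keep-suc k _)
    (trans (cong₂ (λ x y → inv (suc r) * (x + ι r * y)) (E-const O (keep r k) 1ℚ) (E-const O (keep r k) 0ℚ))
        (eq (inv (suc r)) (ι r)))
    where
    eq : ∀ i r → i * (1ℚ + r * 0ℚ) ≡ i
    eq = solve-∀ ℚ-ring
  E-keep-∈ (suc k) (suc v) = trans (E-keep-suc k _)
    (trans (cong (λ x → inv (suc r) * (x + ι r * x)) (E-keep-∈ k v)) (average (inv (suc r))))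

  hits : ∀ {k} → (Fin k → Bool) → Vec Bool k → Bool
  hits S T = anyF (λ v → lookup T v ∧ S v)

  0≤miss : ∀ {k} S → 0ℚ ≤ E O (keep r k) (λ T → [ not (hits S T) ])
  0≤miss S = E-0≤ O (keep r _) (λ T → 0≤[] (not (hits S T)))

  -- Bernoulli's inequality in the form (1 - x) ^ s * (1 + s x) ≤ 1, folded into the sampling recursion.
  E-keep-miss : ∀ k (S : Fin k → Bool) →
    E O (keep r k) (λ T → [ not (hits S T) ]) * (1ℚ + ι (sumℕ (bit ∘ S)) * inv (suc r)) ≤ 1ℚ
  E-keep-miss zero    S = ≤-reflexive (trans (*-identityˡ _)
      (trans (cong (1ℚ +_) (trans (cong (_* inv (suc r)) ι-zero) (*-zeroˡ (inv (suc r))))) (+-identityʳ 1ℚ)))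
  E-keep-miss (suc k) S with S zero
  ... | false = subst (λ q → q * (1ℚ + ι (sumℕ (bit ∘ S ∘ suc)) * inv (suc r)) ≤ 1ℚ)
    (sym (trans (E-keep-suc k _) (average (E O (keep r k) (λ T → [ not (hits (S ∘ suc) T) ])))))
        (E-keep-miss k (S ∘ suc))
  ... | true  = subst (_≤ 1ℚ) (sym expand) (≤-trans
      (≤-slack (q * ((1ℚ + ι s) * (x * x))) (0≤* (0≤miss (S ∘ suc)) (0≤* (0≤+ 0≤1 (0≤ι s)) (0≤square x)))
      (eq q (ι s) x)) (E-keep-miss k (S ∘ suc)))
    where
    open ≡-Reasoning
    q = E O (keep r k) (λ T → [ not (hits (S ∘ suc) T) ])
    s = sumℕ (bit ∘ S ∘ suc)
    x = inv (suc r)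
    eq : ∀ q s x → q * (1ℚ + s * x) ≡ (1ℚ - x) * q * (1ℚ + (1ℚ + s) * x) + q * ((1ℚ + s) * (x * x))
    eq = solve-∀ ℚ-ring
    split : ∀ x r q → x * (0ℚ + r * q) ≡ ((1ℚ + r) * x - x) * q
    split = solve-∀ ℚ-ring
    expand : E O (keep r (suc k)) (λ T → [ not (lookup T zero ∧ true ∨ anyF
        (λ v → lookup T (suc v) ∧ S (suc v))) ]) * (1ℚ + ι (suc s) * x)
      ≡ (1ℚ - x) * q * (1ℚ + (1ℚ + ι s) * x)
    expand = cong₂ (λ a b → a * (1ℚ + b * x)) (begin
      E O (keep r (suc k)) _           ≡⟨ E-keep-suc k _ ⟩
      x * (E O (keep r k) (λ _ → 0ℚ) + ι r * q)  ≡⟨ cong (λ z → x * (z + ι r * q)) (E-const O (keep r k) 0ℚ) ⟩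
      x * (0ℚ + ι r * q)               ≡⟨ split x (ι r) q ⟩
      ((1ℚ + ι r) * x - x) * q         ≡⟨ cong (λ z → (z * x - x) * q) (ι-suc r) ⟨
      (ι (suc r) * x - x) * q          ≡⟨ cong (λ z → (z - x) * q) (inv-inverseʳ r) ⟩
      (1ℚ - x) * q                     ∎) (ι-suc s)

  -- With at least `suc r` targets the second factor in `E-keep-miss` is at least 2.
  E-keep-hit : ∀ k (S : Fin k → Bool) → suc r ≤ℕ sumℕ (bit ∘ S) → ½ ≤ E O (keep r k) (λ T → [ hits S T ])
  E-keep-hit k S r<S = ≤-diff (subst (0ℚ ≤_) rearrange (0≤-diff half))
    where
    q = E O (keep r k) (λ T → [ not (hits S T) ])
    two : (1ℚ + 1ℚ) ≤ 1ℚ + ι (sumℕ (bit ∘ S)) * inv (suc r)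
    two = +-monoʳ-≤ 1ℚ (subst (_≤ ι (sumℕ (bit ∘ S)) * inv (suc r)) (inv-inverseʳ r)
        (*-monoʳ (inv (suc r)) (0≤inv (suc r)) (ι-mono r<S)))
    half : q ≤ ½
    half = *-cancelʳ (1ℚ + 1ℚ) (ℚ.positive⁻¹ (1ℚ + 1ℚ)) (≤-trans (*-monoˡ q (0≤miss S) two) (E-keep-miss k S))
    eq : ∀ h → ½ - (1ℚ - h) ≡ h - ½
    eq = solve-∀ ℚ-ring
    rearrange : ½ - q ≡ E O (keep r k) (λ T → [ hits S T ]) - ½
    rearrange = trans (cong (λ z → ½ - z) (E-not O (keep r k) (hits S))) (eq (E O (keep r k) (λ T → [ hits S T ])))

-- Trials

samples : ∀ {d n} (L r : ℕ) → Prog d n (ℕ × Vec (Vec Bool n) r)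
samples L zero    = ret (1 , [])
samples L (suc r) = toss L λ j → keep (ℕ.pred (2 ^ℕ toℕ j)) _ >>= λ T → samples L r >>= λ (w , Ts) → ret
    (2 ^ℕ toℕ j *ℕ w , T ∷ Ts)

value : ∀ {n r} → Relation n r → ℕ × Vec (Vec Bool n) r → ℕ
value h (w , Ts) = bit (hit h Ts) *ℕ w

rate : ∀ j → suc (ℕ.pred (2 ^ℕ j)) ≡ 2 ^ℕ j
rate j = ℕ.suc-pred (2 ^ℕ j) {{ℕ.m^n≢0 2 j}}

-- The binary length of a degree: a vertex has at most n ^ r ≤ 2 ^ (L r) tails, and the successor
-- makes the bound by 2 ^ `levels L r` strict.
levels : ℕ → ℕ → ℕ
levels L r = suc (L *ℕ r)

-- The factor lost by a trial: at each coordinate, the number of degree classes, and 2 for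
-- rounding the size of the heaviest class down to a power of two.
loss : ℕ → ℕ → ℕ
loss L zero    = 1
loss L (suc r) = loss L r *ℕ (levels L r *ℕ 2)

odds : ℕ → ℕ → ℕ
odds L r = (2 *ℕ suc L) ^ℕ r

-- The success probability guaranteed for a trial, with `odds` as its reciprocal: at each coordinate
-- 1 / (L + 1) for drawing a suitable exponent, and 1/2 for keeping a vertex of the heaviest class.
γ : ℕ → ℕ → ℚ
γ L zero    = 1ℚ
γ L (suc r) = inv (suc L) * (½ * γ L r)

0≤γ : ∀ L r → 0ℚ ≤ γ L r
0≤γ L zero    = 0≤1
0≤γ L (suc r) = 0≤* (0≤inv (suc L)) (0≤* (ℚ.nonNegative⁻¹ ½) (0≤γ L r))

odds*γ : ∀ L r → ι (odds L r) * γ L r ≡ 1ℚ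
odds*γ L zero    = trans (*-identityʳ (ι 1)) ι-one
odds*γ L (suc r) = begin
  ι (2 *ℕ suc L *ℕ odds L r) * (inv (suc L) * (½ * γ L r))
    ≡⟨ cong (_* (inv (suc L) * (½ * γ L r))) (trans (ι-* (2 *ℕ suc L) (odds L r))
        (cong (_* ι (odds L r)) (trans (ι-* 2 (suc L)) (cong (_* ι (suc L)) (ι-def 2))))) ⟩
  ℕ→ℚ 2 * ι (suc L) * ι (odds L r) * (inv (suc L) * (½ * γ L r))
    ≡⟨ eq (ι (suc L)) (ι (odds L r)) (inv (suc L)) (γ L r) ⟩
  (ι (suc L) * inv (suc L)) * (ι (odds L r) * γ L r)
    ≡⟨ cong₂ _*_ (inv-inverseʳ L) (odds*γ L r) ⟩
  1ℚ * 1ℚ ≡⟨⟩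
  1ℚ ∎
  where
  open ≡-Reasoning
  eq : ∀ l o i g → ℕ→ℚ 2 * l * o * (i * (½ * g)) ≡ (l * i) * (o * g)
  eq = solve-∀ ℚ-ring

log-floor : ∀ L s → 1 ≤ℕ s → s ≤ℕ 2 ^ℕ L → ∃[ j ] j ≤ℕ L × 2 ^ℕ j ≤ℕ s × s ≤ℕ 2 ^ℕ j *ℕ 2
log-floor zero    s 1≤s s≤ = 0 , z≤n , 1≤s , ℕ.≤-trans s≤ (s≤s z≤n)
log-floor (suc L) s 1≤s s≤ with ℕ.≤-total (2 ^ℕ L) s
... | inj₁ le = L , ℕ.n≤1+n L , le , ℕ.≤-trans s≤ (ℕ.≤-reflexive (ℕ.*-comm 2 (2 ^ℕ L)))
... | inj₂ ge with log-floor L s 1≤s ge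
...   | j , j≤L , lo , hi = j , ℕ.m≤n⇒m≤1+n j≤L , lo , hi

heavy : ℕ → ℕ → Bool
heavy k x = ⌊ 2 ^ℕ k ℕ.≤? x ⌋

-- The sum of the powers 2 ^ k at most `x` with k < D. For 2 ^ j ≤ x < 2 ^ (j + 1) ≤ 2 ^ D it is the
-- geometric sum 2 ^ (j + 1) - 1, which is at least `x`.
dyadic : ℕ → ℕ → ℕ
dyadic zero    x = 0
dyadic (suc D) x = 2 ^ℕ D *ℕ bit (heavy D x) +ℕ dyadic D x

dyadic-full : ∀ D x → 2 ^ℕ D ≤ℕ x *ℕ 2 → 2 ^ℕ D ≤ℕ suc (dyadic D x)
dyadic-full zero    x le = s≤s z≤n
dyadic-full (suc D) x le = ℕ.≤-trans (ℕ.≤-reflexive (cong (2 ^ℕ D +ℕ_) (ℕ.+-identityʳ (2 ^ℕ D))))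
  (ℕ.≤-trans (ℕ.+-monoʳ-≤ (2 ^ℕ D) (dyadic-full D x (ℕ.≤-trans 2^D≤x (ℕ.m≤m*n x 2))))
    (ℕ.≤-reflexive (trans (ℕ.+-suc (2 ^ℕ D) (dyadic D x))
        (cong (λ z → suc (z +ℕ dyadic D x)) (sym (trans
        (cong (λ b → 2 ^ℕ D *ℕ bit b) (⌊⌋-true (2 ^ℕ D ℕ.≤? x) 2^D≤x)) (ℕ.*-identityʳ (2 ^ℕ D))))))))
  where
  2^D≤x : 2 ^ℕ D ≤ℕ x
  2^D≤x = ℕ.*-cancelʳ-≤ (2 ^ℕ D) x 2 (subst (_≤ℕ x *ℕ 2) (ℕ.*-comm 2 (2 ^ℕ D)) le)

≤dyadic : ∀ D x → x <ℕ 2 ^ℕ D → x ≤ℕ dyadic D x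
≤dyadic zero    x lt = ℕ.≤-pred lt
≤dyadic (suc D) x lt with ℕ.≤-total (2 ^ℕ D) x
... | inj₁ le = ℕ.≤-pred (ℕ.≤-trans lt (dyadic-full (suc D) x
    (ℕ.≤-trans (ℕ.≤-reflexive (ℕ.*-comm 2 (2 ^ℕ D))) (ℕ.*-monoˡ-≤ 2 le))))
... | inj₂ ge with ℕ.m≤n⇒m<n∨m≡n ge
...   | inj₁ lt′ = ℕ.≤-trans (≤dyadic D x lt′) (ℕ.m≤n+m (dyadic D x) _)
...   | inj₂ eq  = ℕ.≤-pred (ℕ.≤-trans lt (dyadic-full (suc D) x
    (ℕ.≤-trans (ℕ.≤-reflexive (ℕ.*-comm 2 (2 ^ℕ D))) (ℕ.*-monoˡ-≤ 2 (ℕ.≤-reflexive (sym eq))))))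

-- Replacing each `x v` by its dyadic sum and exchanging the sums leaves D terms, one per threshold
-- 2 ^ k; the largest of them is at least the average.
heavy-class : ∀ {n} D (x : Fin n → ℕ) → (∀ v → x v <ℕ 2 ^ℕ D) → 1 ≤ℕ sumℕ x →
  ∃[ k ] sumℕ x ≤ℕ D *ℕ (2 ^ℕ k *ℕ sumℕ (λ v → bit (heavy k (x v))))
heavy-class {n} D x x< 1≤ = go D (ℕ.≤-trans (sumℕ-mono (λ v → ≤dyadic D (x v) (x< v))) (ℕ.≤-reflexive (expand D)))
  where
  mass : ℕ → ℕ
  mass k = 2 ^ℕ k *ℕ sumℕ (λ v → bit (heavy k (x v)))
  masses : ℕ → ℕ
  masses zero    = 0
  masses (suc D) = mass D +ℕ masses D
  expand : ∀ D → sumℕ (λ v → dyadic D (x v)) ≡ masses D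
  expand zero    = trans (sumℕ-const n 0) (ℕ.*-zeroʳ n)
  expand (suc D) = trans (sumℕ-+ (λ v → 2 ^ℕ D *ℕ bit (heavy D (x v))) (λ v → dyadic D (x v)))
      (cong₂ _+ℕ_ (sumℕ-* (2 ^ℕ D) (λ v → bit (heavy D (x v)))) (expand D))
  largest : ∀ D → 1 ≤ℕ D → ∃[ k ] masses D ≤ℕ D *ℕ mass k
  largest (suc zero)    _ = 0 , ℕ.≤-refl
  largest (suc (suc D)) _ with largest (suc D) (s≤s z≤n)
  ... | k , le with ℕ.≤-total (mass k) (mass (suc D))
  ...   | inj₁ k≤ = suc D , ℕ.+-monoʳ-≤ (mass (suc D)) (ℕ.≤-trans le (ℕ.*-monoʳ-≤ (suc D) k≤))
  ...   | inj₂ ≤k = k , ℕ.+-mono-≤ ≤k le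
  go : ∀ D → sumℕ x ≤ℕ masses D → ∃[ k ] sumℕ x ≤ℕ D *ℕ mass k
  go zero    le = ⊥-elim (ℕ.<-irrefl refl (ℕ.≤-trans 1≤ le))
  go (suc D) le with largest (suc D) (s≤s z≤n)
  ... | k , le′ = k , ℕ.≤-trans le le′

[]*-≤ : ∀ b {x y} → 0ℚ ≤ y → (b ≡ true → x ≤ y) → [ b ] * x ≤ y
[]*-≤ true  {x} 0≤y x≤y = ≤-trans (≤-reflexive (*-identityˡ x)) (x≤y refl)
[]*-≤ false {x} 0≤y x≤y = ≤-trans (≤-reflexive (*-zeroˡ x)) 0≤y

[⌊⌋]-mono : ∀ {P Q : Set} (P? : Dec P) (Q? : Dec Q) → (P → Q) → [ ⌊ P? ⌋ ] ≤ [ ⌊ Q? ⌋ ]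
[⌊⌋]-mono (no _)  Q?      imp = 0≤[] ⌊ Q? ⌋
[⌊⌋]-mono (yes p) (yes _) imp = ≤-refl
[⌊⌋]-mono (yes p) (no ¬q) imp = ⊥-elim (¬q (imp p))

module _ {d n : ℕ} (O : Oracle d n) (L : ℕ) where

  E-samples-suc : ∀ r (f : ℕ × Vec (Vec Bool n) (suc r) → ℚ) → E O (samples L (suc r)) f
    ≡ inv (suc L) * sum {suc L} (λ j → E O (keep (ℕ.pred (2 ^ℕ toℕ j)) n)
        (λ T → E O (samples L r) (λ (w , Ts) → f (2 ^ℕ toℕ j *ℕ w , T ∷ Ts))))
  E-samples-suc r f = cong (inv (suc L) *_) (sum-cong {suc L}
      {λ j → E O (keep (ℕ.pred (2 ^ℕ toℕ j)) n >>= λ T → samples L r >>= λ (w , Ts) → ret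
      (2 ^ℕ toℕ j *ℕ w , T ∷ Ts)) f} (λ j → trans (E->>= O (keep (ℕ.pred (2 ^ℕ toℕ j)) n) _ f)
    (E-cong O (keep (ℕ.pred (2 ^ℕ toℕ j)) n) (λ T → E->>= O (samples L r) _ f))))

  value-suc : ∀ {r} (h : Relation n (suc r)) a w T Ts → value h (a *ℕ w , T ∷ Ts) ≡ a *ℕ value (link T h) (w , Ts)
  value-suc h a w T Ts = eq (bit (hit (link T h) Ts)) a w
    where
    eq : ∀ b a w → b *ℕ (a *ℕ w) ≡ a *ℕ (b *ℕ w)
    eq = ℕ-solve-∀

  -- A union bound: a tail with several extensions in `T` is counted once on the left and once per
  -- extension on the right. Each vertex survives with probability 2 ^ (- j), which the factor 2 ^ j
  -- cancels.
  E-total-link : ∀ {r} j (h : Relation n (suc r)) →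
    ι (2 ^ℕ j) * E O (keep (ℕ.pred (2 ^ℕ j)) n) (λ T → ι (total (link T h))) ≤ ι (total h)
  E-total-link j h = ≤-trans (*-monoˡ (ι (2 ^ℕ j)) (0≤ι (2 ^ℕ j))
      (E-mono O K (λ T → ι-mono (total-any (lookup T) (λ v t → h (v ∷ t))))))
    (≤-reflexive (begin
      ι (2 ^ℕ j) * E O K (λ T → ι (sumℕ (λ v → bit (lookup T v) *ℕ x v)))
        ≡⟨ cong (ι (2 ^ℕ j) *_) (E-cong O K (λ T → trans (ι-sumℕ (λ v → bit (lookup T v) *ℕ x v))
            (sum-cong (λ v → trans (ι-* (bit (lookup T v)) (x v)) (cong (_* ι (x v)) (ι-bit (lookup T v))))))) ⟩
      ι (2 ^ℕ j) * E O K (λ T → sum (λ v → [ lookup T v ] * ι (x v)))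
        ≡⟨ cong (ι (2 ^ℕ j) *_) (trans (E-sum O K (λ v T → [ lookup T v ] * ι (x v)))
            (sum-cong (λ v → trans (E-*ʳ O K (ι (x v)) (λ T → [ lookup T v ]))
            (cong (_* ι (x v)) (trans (E-keep-∈ O _ n v) (cong inv (rate j))))))) ⟩
      ι (2 ^ℕ j) * sum (λ v → inv (2 ^ℕ j) * ι (x v))
        ≡⟨ cong (ι (2 ^ℕ j) *_) (trans (sum-* (inv (2 ^ℕ j)) (λ v → ι (x v)))
            (cong (inv (2 ^ℕ j) *_) (sym (ι-sumℕ x)))) ⟩
      ι (2 ^ℕ j) * (inv (2 ^ℕ j) * ι (sumℕ x))
        ≡⟨ *-assoc (ι (2 ^ℕ j)) (inv (2 ^ℕ j)) (ι (sumℕ x)) ⟨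
      ι (2 ^ℕ j) * inv (2 ^ℕ j) * ι (sumℕ x)
        ≡⟨ cong (_* ι (sumℕ x)) (ι-inv (ℕ.m^n>0 2 j)) ⟩
      1ℚ * ι (sumℕ x)
        ≡⟨ *-identityˡ (ι (sumℕ x)) ⟩
      ι (sumℕ x) ∎))
    where
    open ≡-Reasoning
    K = keep (ℕ.pred (2 ^ℕ j)) n
    x = λ v → total (λ t → h (v ∷ t))

  E-value≤total : ∀ r (h : Relation n r) → E O (samples L r) (λ x → ι (value h x)) ≤ ι (total h)
  E-value≤total zero    h = ι-mono (ℕ.≤-reflexive (ℕ.*-identityʳ (bit (h []))))
  E-value≤total (suc r) h = begin
    E O (samples L (suc r)) (λ x → ι (value h x))
      ≡⟨ E-samples-suc r _ ⟩
    inv (suc L) * sum {suc L} (λ j → E O (K j) (λ T → E O (samples L r)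
        (λ (w , Ts) → ι (value h (2 ^ℕ toℕ j *ℕ w , T ∷ Ts)))))
      ≡⟨ cong (inv (suc L) *_) (sum-cong (λ j → trans
          (E-cong O (K j) (λ T → trans (E-cong O (samples L r)
          (λ (w , Ts) → trans (cong ι (value-suc h (2 ^ℕ toℕ j) w T Ts)) (ι-* (2 ^ℕ toℕ j) _)))
          (E-* O (samples L r) (ι (2 ^ℕ toℕ j)) _))) (E-* O (K j) (ι (2 ^ℕ toℕ j)) _))) ⟩
    inv (suc L) * sum {suc L} (λ j → ι (2 ^ℕ toℕ j) * E O (K j)
        (λ T → E O (samples L r) (λ x → ι (value (link T h) x))))
      ≤⟨ *-monoˡ (inv (suc L)) (0≤inv (suc L)) (sum-mono
          (λ j → ≤-trans (*-monoˡ (ι (2 ^ℕ toℕ j)) (0≤ι (2 ^ℕ toℕ j))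
          (E-mono O (K j) (λ T → E-value≤total r (link T h)))) (E-total-link (toℕ j) h))) ⟩
    inv (suc L) * sum {suc L} (λ j → ι (total h))
      ≡⟨ cong (inv (suc L) *_) (sum-const (suc L) (ι (total h))) ⟩
    inv (suc L) * (ι (suc L) * ι (total h))
      ≡⟨ trans (sym (*-assoc (inv (suc L)) (ι (suc L)) (ι (total h))))
          (trans (cong (_* ι (total h)) (inv-inverseˡ L)) (*-identityˡ (ι (total h)))) ⟩
    ι (total h) ∎
    where
    open ℚ.≤-Reasoning
    K : Fin (suc L) → Prog d n (Vec Bool n)
    K j = keep (ℕ.pred (2 ^ℕ toℕ j)) n

  enough : ∀ {r} → Relation n r → ℕ × Vec (Vec Bool n) r → Bool
  enough {r} h x = ⌊ total h ℕ.≤? loss L r *ℕ value h x ⌋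

  -- Let S be the vertices of degree at least 2 ^ k in the heaviest class, and 2 ^ j ≤ |S| ≤ 2 · 2 ^
  -- j. With exponent j, some vertex of S is kept with probability at least 1/2, and then `link T h`
  -- has at least 2 ^ k tuples. Since `total h` is at most `levels L r` · 2 ^ k · |S|, passing to
  -- `link T h` and scaling by 2 ^ j loses at most `levels L r *ℕ 2`.
  value-enough : n ≤ℕ 2 ^ℕ L → ∀ r (h : Relation n r) → 1 ≤ℕ total h → γ L r ≤ E O (samples L r)
      (λ x → [ enough h x ])
  value-enough n≤ zero h 1≤ = ≤-reflexive (sym (cong [_]
      (⌊⌋-true (total h ℕ.≤? 1 *ℕ (bit (h []) *ℕ 1))
      (ℕ.≤-reflexive (sym (trans (ℕ.*-identityˡ _) (ℕ.*-identityʳ (bit (h [])))))))))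
  value-enough n≤ (suc r) h 1≤ = begin
    inv (suc L) * (½ * γ L r)
      ≤⟨ *-monoˡ (inv (suc L)) (0≤inv (suc L)) (≤-trans
          (≤-trans (*-monoʳ (γ L r) (0≤γ L r) (E-keep-hit O _ n S rate≤))
          (≤-trans (≤-reflexive (sym (E-*ʳ O K (γ L r) (λ T → [ hits O (ℕ.pred (2 ^ℕ toℕ j)) S T ]))))
          (E-mono O K given)))
           -- Of all L + 1 exponents only the suitable `j` is counted.
           (term≤sum {f = F} 0≤F j)) ⟩
    inv (suc L) * sum F
      ≡⟨ E-samples-suc r (λ x → [ enough h x ]) ⟨
    E O (samples L (suc r)) (λ x → [ enough h x ]) ∎
    where
    open ℚ.≤-Reasoning
    x = λ v → total (λ t → h (v ∷ t))
    F : Fin (suc L) → ℚ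
    F j = E O (keep (ℕ.pred (2 ^ℕ toℕ j)) n) (λ T → E O (samples L r)
        (λ (w , Ts) → [ enough h (2 ^ℕ toℕ j *ℕ w , T ∷ Ts) ]))
    0≤F : ∀ j → 0ℚ ≤ F j
    0≤F j = E-0≤ O (keep (ℕ.pred (2 ^ℕ toℕ j)) n) (λ T → E-0≤ O (samples L r)
        (λ (w , Ts) → 0≤[] (enough h (2 ^ℕ toℕ j *ℕ w , T ∷ Ts))))
    x< : ∀ v → x v <ℕ 2 ^ℕ levels L r
    x< v = ℕ.≤-<-trans (total≤n^d (λ t → h (v ∷ t)))
        (ℕ.≤-<-trans (ℕ.≤-trans (ℕ.^-monoˡ-≤ r n≤) (ℕ.≤-reflexive (ℕ.^-*-assoc 2 L r)))
        (ℕ.^-monoʳ-< 2 (s≤s (s≤s z≤n)) (ℕ.n<1+n (L *ℕ r))))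
    class = heavy-class (levels L r) x x< 1≤
    k = proj₁ class
    S : Fin n → Bool
    S v = heavy k (x v)
    s = sumℕ (bit ∘ S)
    1≤s : 1 ≤ℕ s
    1≤s with s in eq
    ... | suc _ = s≤s z≤n
    ... | zero = ⊥-elim (ℕ.<-irrefl refl (ℕ.≤-trans 1≤
        (ℕ.≤-trans (proj₂ class) (ℕ.≤-reflexive (trans (cong (λ z → levels L r *ℕ (2 ^ℕ k *ℕ z)) eq)
        (trans (cong (levels L r *ℕ_) (ℕ.*-zeroʳ (2 ^ℕ k))) (ℕ.*-zeroʳ (levels L r))))))))
    s≤2^L : s ≤ℕ 2 ^ℕ L
    s≤2^L = ℕ.≤-trans (sumℕ-mono (bit≤1 ∘ S)) (ℕ.≤-trans
        (ℕ.≤-reflexive (trans (sumℕ-const n 1) (ℕ.*-identityʳ n))) n≤)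
    log = log-floor L s 1≤s s≤2^L
    j : Fin (suc L)
    j = Fin.fromℕ< (s≤s (proj₁ (proj₂ log)))
    toℕj : toℕ j ≡ proj₁ log
    toℕj = Fin.toℕ-fromℕ< (s≤s (proj₁ (proj₂ log)))
    2^j≤s : 2 ^ℕ toℕ j ≤ℕ s
    2^j≤s = subst (λ i → 2 ^ℕ i ≤ℕ s) (sym toℕj) (proj₁ (proj₂ (proj₂ log)))
    s≤2^j*2 : s ≤ℕ 2 ^ℕ toℕ j *ℕ 2
    s≤2^j*2 = subst (λ i → s ≤ℕ 2 ^ℕ i *ℕ 2) (sym toℕj) (proj₂ (proj₂ (proj₂ log)))
    rate≤ : suc (ℕ.pred (2 ^ℕ toℕ j)) ≤ℕ s
    rate≤ = ℕ.≤-trans (ℕ.≤-reflexive (rate (toℕ j))) 2^j≤s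
    K = keep (ℕ.pred (2 ^ℕ toℕ j)) n
    given : ∀ T → [ hits O (ℕ.pred (2 ^ℕ toℕ j)) S T ] * γ L r ≤ E O (samples L r)
        (λ (w , Ts) → [ enough h (2 ^ℕ toℕ j *ℕ w , T ∷ Ts) ])
    given T = []*-≤ (hits O (ℕ.pred (2 ^ℕ toℕ j)) S T)
      (E-0≤ O (samples L r) (λ (w , Ts) → 0≤[] (enough h (2 ^ℕ toℕ j *ℕ w , T ∷ Ts))))
      (λ hit≡ → let v , Tv∧Sv = anyF-true⁻ (λ v → lookup T v ∧ S v) hit≡ in reached T v Tv∧Sv)
      where
      reached : ∀ T v → lookup T v ∧ S v ≡ true → γ L r ≤ E O (samples L r)
          (λ (w , Ts) → [ enough h (2 ^ℕ toℕ j *ℕ w , T ∷ Ts) ])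
      reached T v Tv∧Sv = ≤-trans (value-enough n≤ r (link T h) (ℕ.≤-trans (ℕ.m^n>0 2 k) 2^k≤))
        (E-mono O (samples L r) (λ (w , Ts) → [⌊⌋]-mono (total (link T h) ℕ.≤? loss L r *ℕ value (link T h) (w , Ts))
          (total h ℕ.≤? loss L (suc r) *ℕ value h (2 ^ℕ toℕ j *ℕ w , T ∷ Ts)) (transfer w Ts)))
        where
        Tv = proj₁ (∧-true⁻ Tv∧Sv)
        2^k≤ : 2 ^ℕ k ≤ℕ total (link T h)
        2^k≤ = ℕ.≤-trans (⌊⌋-true⁻ (2 ^ℕ k ℕ.≤? x v) (proj₂ (∧-true⁻ Tv∧Sv)))
          (total-mono (λ t hvt → anyF-true (λ u → lookup T u ∧ h (u ∷ t)) v (cong₂ _∧_ Tv hvt)))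
        transfer : ∀ w Ts → total (link T h) ≤ℕ loss L r *ℕ value (link T h) (w , Ts) →
          total h ≤ℕ loss L (suc r) *ℕ value h (2 ^ℕ toℕ j *ℕ w , T ∷ Ts)
        transfer w Ts le = ℕ.≤-trans (proj₂ class) (ℕ.≤-trans
            (ℕ.*-monoʳ-≤ (levels L r) (ℕ.*-mono-≤ (ℕ.≤-trans 2^k≤ le) s≤2^j*2))
          (ℕ.≤-reflexive (trans (reorder (levels L r) (loss L r) (value (link T h) (w , Ts)) (2 ^ℕ toℕ j))
              (cong (loss L (suc r) *ℕ_) (sym (value-suc h (2 ^ℕ toℕ j) w T Ts))))))
          where
          reorder : ∀ D l y p → D *ℕ (l *ℕ y *ℕ (p *ℕ 2)) ≡ l *ℕ (D *ℕ 2) *ℕ (p *ℕ y)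
          reorder = ℕ-solve-∀

-- Coarse estimates

sumVℕ : ∀ {k} → Vec ℕ k → ℕ
sumVℕ []      = 0
sumVℕ (x ∷ v) = x +ℕ sumVℕ v

ι-sumVℕ : ∀ {k} (v : Vec ℕ k) → ι (sumVℕ v) ≡ sumV ι v
ι-sumVℕ []      = ι-zero
ι-sumVℕ (x ∷ v) = trans (ι-+ x (sumVℕ v)) (cong (ι x +_) (ι-sumVℕ v))

bernoulli : ∀ {x y} k → 0ℚ ≤ x → 0ℚ ≤ y → x ≤ 1ℚ - y → x ^ k * (1ℚ + ι k * y) ≤ 1ℚ
bernoulli {x} {y} zero 0≤x 0≤y x≤ = ≤-reflexive (trans (*-identityˡ (1ℚ + ι 0 * y))
    (cong (1ℚ +_) (trans (cong (_* y) ι-zero) (*-zeroˡ y))))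
bernoulli {x} {y} (suc k) 0≤x 0≤y x≤ = begin
  x * p * (1ℚ + ι (suc k) * y)                     ≡⟨ cong (λ z → x * p * (1ℚ + z * y)) (ι-suc k) ⟩
  x * p * (1ℚ + (1ℚ + ι k) * y)                    ≤⟨ *-monoʳ (1ℚ + (1ℚ + ι k) * y)
      (0≤+ 0≤1 (0≤* (0≤+ 0≤1 (0≤ι k)) 0≤y)) (*-monoʳ p (0≤^ k 0≤x) x≤) ⟩
  (1ℚ - y) * p * (1ℚ + (1ℚ + ι k) * y)             ≤⟨ ≤-slack (p * ((1ℚ + ι k) * (y * y)))
      (0≤* (0≤^ k 0≤x) (0≤* (0≤+ 0≤1 (0≤ι k)) (0≤square y))) (eq p (ι k) y) ⟩
  p * (1ℚ + ι k * y)                               ≤⟨ bernoulli k 0≤x 0≤y x≤ ⟩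
  1ℚ                                               ∎
  where
  open ℚ.≤-Reasoning
  p = x ^ k
  eq : ∀ p k y → p * (1ℚ + k * y) ≡ (1ℚ - y) * p * (1ℚ + (1ℚ + k) * y) + p * ((1ℚ + k) * (y * y))
  eq = solve-∀ ℚ-ring

-- With G y = 1, Bernoulli's inequality gives x ^ G · 2 ≤ 1, so every block of G factors halves the
-- power.
power-halves : ∀ {x y} G K → 0ℚ ≤ x → 0ℚ ≤ y → x ≤ 1ℚ - y → ι G * y ≡ 1ℚ → x ^ (K *ℕ G) ≤ ½ ^ K
power-halves {x} {y} G zero    0≤x 0≤y x≤ Gy≡1 = ≤-refl
power-halves {x} {y} G (suc K) 0≤x 0≤y x≤ Gy≡1 = ≤-trans (≤-reflexive (^-+ x G (K *ℕ G)))
  (*-mono-≤ (0≤^ G 0≤x) half (0≤^ (K *ℕ G) 0≤x) (power-halves G K 0≤x 0≤y x≤ Gy≡1))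
  where
  half : x ^ G ≤ ½
  half = *-cancelʳ (1ℚ + 1ℚ) (ℚ.positive⁻¹ (1ℚ + 1ℚ))
      (subst (λ z → x ^ G * (1ℚ + z) ≤ 1ℚ) Gy≡1 (bernoulli G 0≤x 0≤y x≤))

coarse : ∀ {d n} → ℕ → Prog d n ℕ → Prog d n ℕ
coarse R t = iid R t >>= λ v → ret (sumVℕ v)

module _ {d n : ℕ} (O : Oracle d n) (t : Prog d n ℕ) (M : ℕ) (1≤M : 1 ≤ℕ M) where

  -- The 1 added to the estimate is absorbed by 1 ≤ M, as if there were one more trial.
  coarse-upper : ∀ R → E O t ι ≤ ι M → E O (coarse R t) (λ c → ι (suc c)) ≤ ι (suc R) * ι M
  coarse-upper R le = begin
    E O (coarse R t) (λ c → ι (suc c))                       ≡⟨ E->>= O (iid R t) _ _ ⟩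
    E O (iid R t) (λ v → ι (suc (sumVℕ v)))                  ≡⟨ E-cong O (iid R t)
        (λ v → trans (ι-suc (sumVℕ v)) (cong (1ℚ +_) (ι-sumVℕ v))) ⟩
    E O (iid R t) (λ v → 1ℚ + sumV ι v)                      ≡⟨ trans (E-+ O (iid R t) (λ _ → 1ℚ) (sumV ι))
        (cong₂ _+_ (E-const O (iid R t) 1ℚ) (E-iid-sum O t R ι)) ⟩
    1ℚ + ι R * E O t ι                                       ≤⟨ +-mono-≤ (1≤ι 1≤M) (*-monoˡ (ι R) (0≤ι R) le) ⟩
    ι M + ι R * ι M                                          ≡⟨ eq (ι M) (ι R) ⟩
    (1ℚ + ι R) * ι M                                         ≡⟨ cong (_* ι M) (ι-suc R) ⟨
    ι (suc R) * ι M                                          ∎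
    where
    open ℚ.≤-Reasoning
    eq : ∀ M R → M + R * M ≡ (1ℚ + R) * M
    eq = solve-∀ ℚ-ring

  module _ (δ : ℕ) where

    ok : ℕ → Bool
    ok x = ⌊ M ℕ.≤? δ *ℕ x ⌋

    some-ok : ∀ {k} (v : Vec ℕ k) → prodV (λ x → [ not (ok x) ]) v ≡ 1ℚ ⊎ M ≤ℕ δ *ℕ sumVℕ v
    some-ok []      = inj₁ refl
    some-ok (x ∷ v) with M ℕ.≤? δ *ℕ x
    ... | yes le = inj₂ (ℕ.≤-trans le (ℕ.*-monoʳ-≤ δ (ℕ.m≤m+n x (sumVℕ v))))
    ... | no _ with some-ok v
    ...   | inj₁ eq = inj₁ (trans (cong (1ℚ *_) eq) (*-identityˡ 1ℚ))
    ...   | inj₂ le = inj₂ (ℕ.≤-trans le (ℕ.*-monoʳ-≤ δ (ℕ.m≤n+m (sumVℕ v) x)))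

    0≤prod : ∀ {k} (v : Vec ℕ k) → 0ℚ ≤ prodV (λ x → [ not (ok x) ]) v
    0≤prod []      = 0≤1
    0≤prod (x ∷ v) = 0≤* (0≤[] (not (ok x))) (0≤prod v)

    -- One trial of value at least M / δ already makes the sum large enough for M / c ≤ δ. If there
    -- is none, the product of indicators is 1 and pays for the trivial bound 1 / c ≤ 1.
    inverse-bound : ∀ {k} (v : Vec ℕ k) → ι M * inv (suc (sumVℕ v)) ≤ ι δ + ι M * prodV (λ x → [ not (ok x) ]) v
    inverse-bound v with some-ok v
    ... | inj₁ eq = ≤-trans (*-monoˡ (ι M) (0≤ι M) (inv≤1 (suc (sumVℕ v))))
        (≤-slack (ι δ) (0≤ι δ) (trans (cong (λ z → ι δ + ι M * z) eq) (+-comm (ι δ) (ι M * 1ℚ))))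
    ... | inj₂ le = ≤-trans (*-monoʳ (inv (suc c)) (0≤inv (suc c))
        (ι-mono (ℕ.≤-trans le (ℕ.*-monoʳ-≤ δ (ℕ.n≤1+n c)))))
      (≤-trans (≤-reflexive (trans (cong (_* inv (suc c)) (ι-* δ (suc c)))
          (trans (*-assoc (ι δ) (ι (suc c)) (inv (suc c)))
          (trans (cong (ι δ *_) (inv-inverseʳ c)) (*-identityʳ (ι δ))))))
        (≤-slack (ι M * prodV (λ x → [ not (ok x) ]) v) (0≤* (0≤ι M) (0≤prod v)) refl))
      where c = sumVℕ v

    -- All K G trials fail with probability at most 2 ^ (- K), and 2 ^ K ≥ M, so the costly second
    -- term of `inverse-bound` has mean at most 1: hence `suc δ`.
    coarse-lower : ∀ y G K → 0ℚ ≤ y → y ≤ E O t (λ x → [ ok x ]) → ι G * y ≡ 1ℚ → M ≤ℕ 2 ^ℕ K →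
      ι M * E O (coarse (K *ℕ G) t) (λ c → inv (suc c)) ≤ ι (suc δ)
    coarse-lower y G K 0≤y y≤ Gy≡1 M≤ = begin
      ι M * E O (coarse R t) (λ c → inv (suc c))                  ≡⟨ cong (ι M *_) (E->>= O (iid R t) _ _) ⟩
      ι M * E O (iid R t) (λ v → inv (suc (sumVℕ v)))             ≡⟨ E-* O (iid R t) (ι M) _ ⟨
      E O (iid R t) (λ v → ι M * inv (suc (sumVℕ v)))             ≤⟨ E-mono O (iid R t) inverse-bound ⟩
      E O (iid R t) (λ v → ι δ + ι M * prodV notok v)             ≡⟨ trans
          (E-+ O (iid R t) (λ _ → ι δ) (λ v → ι M * prodV notok v))
          (cong₂ _+_ (E-const O (iid R t) (ι δ)) (trans (E-* O (iid R t) (ι M) (prodV notok))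
          (cong (ι M *_) (E-iid-prod O t R notok)))) ⟩
      ι δ + ι M * E O t notok ^ R                                 ≤⟨ +-monoʳ-≤ (ι δ)
          (*-mono-≤ (0≤ι M) (ι-mono M≤) (0≤^ R 0≤x) (power-halves G K 0≤x 0≤y x≤ Gy≡1)) ⟩
      ι δ + ι (2 ^ℕ K) * ½ ^ K                                    ≡⟨ cong (ι δ +_)
          (trans (*-comm (ι (2 ^ℕ K)) (½ ^ K)) (½^T*2^T K)) ⟩
      ι δ + 1ℚ                                                    ≡⟨ trans (+-comm (ι δ) 1ℚ) (sym (ι-suc δ)) ⟩
      ι (suc δ)                                                   ∎
      where
      open ℚ.≤-Reasoning
      R = K *ℕ G
      notok : ℕ → ℚ
      notok x = [ not (ok x) ]
      0≤x : 0ℚ ≤ E O t notok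
      0≤x = E-0≤ O t (λ x → 0≤[] (not (ok x)))
      eq : ∀ y q → 1ℚ - y ≡ 1ℚ - q + (q - y)
      eq = solve-∀ ℚ-ring
      q = E O t (λ x → [ ok x ])
      x≤ : E O t notok ≤ 1ℚ - y
      x≤ = ≤-slack (q - y) (0≤-diff y≤) (trans (eq y q) (cong (_+ (q - y)) (sym (E-not O t ok))))

-- Boxes and the oracle

-- A partial colouring rather than d sets: the parts of a query are then disjoint by construction,
-- and splitting or sampling amounts to erasing colours.
Box : ℕ → ℕ → Set
Box d n = Fin n → Maybe (Fin d)

is : ∀ {d} → Fin d → Maybe (Fin d) → Bool
is i (just j) = does (i Fin.≟ j)
is i nothing  = false

is-true⁻ : ∀ {d} (i : Fin d) x → is i x ≡ true → x ≡ just i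
is-true⁻ i (just j) eq with i Fin.≟ j
... | yes refl = refl

is-true : ∀ {d} (i : Fin d) → is i (just i) ≡ true
is-true i with i Fin.≟ i
... | yes _  = refl
... | no i≢i = ⊥-elim (i≢i refl)

part-of : ∀ {d n} → Box d n → Fin d → Subset n
part-of f i = Vec.tabulate (λ v → is i (f v))

∈-tabulate⁺ : ∀ {n} {g : Fin n → Bool} {v} → g v ≡ true → v ∈ˢ Vec.tabulate g
∈-tabulate⁺ {g = g} {v} eq = Vec.lookup⇒[]= v (Vec.tabulate g) (trans (Vec.lookup∘tabulate g v) eq)

∈-tabulate⁻ : ∀ {n} {g : Fin n → Bool} {v} → v ∈ˢ Vec.tabulate g → g v ≡ true
∈-tabulate⁻ {g = g} {v} v∈ = trans (sym (Vec.lookup∘tabulate g v)) (Vec.[]=⇒lookup v∈)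

∈-part⁺ : ∀ {d n} (f : Box d n) {i v} → f v ≡ just i → v ∈ˢ part-of f i
∈-part⁺ f {i} {v} eq = ∈-tabulate⁺ (trans (cong (is i) eq) (is-true i))

∈-part⁻ : ∀ {d n} (f : Box d n) {i v} → v ∈ˢ part-of f i → f v ≡ just i
∈-part⁻ f {i} {v} v∈ = is-true⁻ i (f v) (∈-tabulate⁻ v∈)

just-injective : ∀ {A : Set} {x y : A} → just x ≡ just y → x ≡ y
just-injective refl = refl

toQuery : ∀ {d n} (f : Box d n) → (∀ i → Nonempty (part-of f i)) → Query d n
toQuery f ne = record
  { part     = part-of f
  ; nonempty = ne
  ; disjoint = λ i j i≢j (v , v∈) → let v∈i , v∈j = x∈p∩q⁻ (part-of f i) (part-of f j) v∈ in
      i≢j (just-injective (trans (sym (∈-part⁻ f v∈i)) (∈-part⁻ f v∈j)))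
  }

-- A query requires nonempty parts. If a colour is missing no edge can cross, so `false` is correct
-- without a query.
askBox : ∀ {d n} → Box d n → Prog d n Bool
askBox f with Fin.all? (λ i → nonempty? (part-of f i))
... | yes ne = ask (toQuery f ne) ret
... | no _   = ret false

cost-askBox : ∀ {d n} (O : Oracle d n) (f : Box d n) → cost O (askBox f) ≤ℕ 1
cost-askBox O f with Fin.all? (λ i → nonempty? (part-of f i))
... | yes ne = s≤s z≤n
... | no _   = z≤n

∣∷∣ : ∀ {n} b (p : Subset n) → ∣ b ∷ p ∣ ≡ bit b +ℕ ∣ p ∣
∣∷∣ true  p = refl
∣∷∣ false p = refl

∈⇒1≤∣∣ : ∀ {n} {p : Subset n} {v} → v ∈ˢ p → 1 ≤ℕ ∣ p ∣
∈⇒1≤∣∣ Vec.here = s≤s z≤n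
∈⇒1≤∣∣ {p = b ∷ p} (Vec.there v∈) = ℕ.≤-trans (∈⇒1≤∣∣ v∈)
    (ℕ.≤-trans (ℕ.m≤n+m ∣ p ∣ (bit b)) (ℕ.≤-reflexive (sym (∣∷∣ b p))))

1≤∣∣⇒∃ : ∀ {n} (p : Subset n) → 1 ≤ℕ ∣ p ∣ → ∃[ v ] v ∈ˢ p
1≤∣∣⇒∃ (true  ∷ p) _  = zero , Vec.here
1≤∣∣⇒∃ (false ∷ p) le with 1≤∣∣⇒∃ p le
... | v , v∈ = suc v , Vec.there v∈

∣∣≡1⇒≡ : ∀ {n} {p : Subset n} {v w} → ∣ p ∣ ≡ 1 → v ∈ˢ p → w ∈ˢ p → v ≡ w
∣∣≡1⇒≡ eq Vec.here Vec.here = refl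
∣∣≡1⇒≡ eq Vec.here (Vec.there w∈) = ⊥-elim (ℕ.<-irrefl refl (ℕ.≤-trans (s≤s (∈⇒1≤∣∣ w∈)) (ℕ.≤-reflexive eq)))
∣∣≡1⇒≡ eq (Vec.there v∈) Vec.here = ⊥-elim (ℕ.<-irrefl refl (ℕ.≤-trans (s≤s (∈⇒1≤∣∣ v∈)) (ℕ.≤-reflexive eq)))
∣∣≡1⇒≡ {p = true  ∷ p} eq (Vec.there v∈) (Vec.there w∈) = ⊥-elim
    (ℕ.<-irrefl refl (ℕ.≤-trans (s≤s (∈⇒1≤∣∣ v∈)) (ℕ.≤-reflexive eq)))
∣∣≡1⇒≡ {p = false ∷ p} eq (Vec.there v∈) (Vec.there w∈) = cong suc (∣∣≡1⇒≡ eq v∈ w∈)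

uncoloured : ∀ {d n} → Box d n → Subset n
uncoloured f = Vec.tabulate (λ v → is-nothing (f v))

sum-diagonal : ∀ {d} (j : Fin d) → sumℕ (λ i → bit (does (i Fin.≟ j))) ≡ 1
sum-diagonal {suc d} zero    = cong suc (trans (sumℕ-const d 0) (ℕ.*-zeroʳ d))
sum-diagonal {suc d} (suc j) = sum-diagonal j

sum-is : ∀ {d} (x : Maybe (Fin d)) → sumℕ (λ i → bit (is i x)) +ℕ bit (is-nothing x) ≡ 1
sum-is     (just j) = trans (ℕ.+-identityʳ _) (sum-diagonal j)
sum-is {d} nothing  = cong (_+ℕ 1) (trans (sumℕ-const d 0) (ℕ.*-zeroʳ d))

partition-size : ∀ {d n} (f : Box d n) (e : Subset n) →
  sumℕ (λ i → ∣ e ∩ part-of f i ∣) +ℕ ∣ e ∩ uncoloured f ∣ ≡ ∣ e ∣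
partition-size {d} f []      = trans (ℕ.+-identityʳ _) (trans (sumℕ-const d 0) (ℕ.*-zeroʳ d))
partition-size {d} f (b ∷ e) = begin
  sumℕ (λ i → ∣ (b ∧ is i x) ∷ q i ∣) +ℕ ∣ (b ∧ is-nothing x) ∷ q₀ ∣
    ≡⟨ cong₂ _+ℕ_ (trans (sumℕ-cong (λ i → trans (∣∷∣ (b ∧ is i x) (q i))
        (cong (_+ℕ ∣ q i ∣) (bit-∧ b (is i x))))) (sumℕ-+ (λ i → bit b *ℕ bit (is i x)) (λ i → ∣ q i ∣)))
        (trans (∣∷∣ (b ∧ is-nothing x) q₀) (cong (_+ℕ ∣ q₀ ∣) (bit-∧ b (is-nothing x)))) ⟩
  sumℕ (λ i → bit b *ℕ bit (is i x)) +ℕ sumℕ (λ i → ∣ q i ∣) +ℕ (bit b *ℕ bit (is-nothing x) +ℕ ∣ q₀ ∣)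
    ≡⟨ cong (λ z → z +ℕ sumℕ (λ i → ∣ q i ∣) +ℕ (bit b *ℕ bit (is-nothing x) +ℕ ∣ q₀ ∣))
        (sumℕ-* (bit b) (λ i → bit (is i x))) ⟩
  bit b *ℕ sumℕ (λ i → bit (is i x)) +ℕ sumℕ (λ i → ∣ q i ∣) +ℕ (bit b *ℕ bit (is-nothing x) +ℕ ∣ q₀ ∣)
    ≡⟨ eq (bit b) (sumℕ (λ i → bit (is i x))) (sumℕ (λ i → ∣ q i ∣)) (bit (is-nothing x)) ∣ q₀ ∣ ⟩
  bit b *ℕ (sumℕ (λ i → bit (is i x)) +ℕ bit (is-nothing x)) +ℕ (sumℕ (λ i → ∣ q i ∣) +ℕ ∣ q₀ ∣)
    ≡⟨ cong₂ (λ y z → bit b *ℕ y +ℕ z) (sum-is x) (partition-size (f ∘ suc) e) ⟩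
  bit b *ℕ 1 +ℕ ∣ e ∣
    ≡⟨ cong (_+ℕ ∣ e ∣) (ℕ.*-identityʳ (bit b)) ⟩
  bit b +ℕ ∣ e ∣
    ≡⟨ ∣∷∣ b e ⟨
  ∣ b ∷ e ∣ ∎
  where
  open ≡-Reasoning
  x = f zero
  q = λ i → e ∩ part-of (f ∘ suc) i
  q₀ = e ∩ uncoloured (f ∘ suc)
  eq : ∀ b s t u w → b *ℕ s +ℕ t +ℕ (b *ℕ u +ℕ w) ≡ b *ℕ (s +ℕ u) +ℕ (t +ℕ w)
  eq = ℕ-solve-∀

-- After subtracting 1 from each of the d terms nothing is left. Applied to an edge of size d, it
-- turns "meets every colour" into "meets every colour exactly once and has no uncoloured vertex".
tight : ∀ {d} (x : Fin d → ℕ) u → (∀ i → 1 ≤ℕ x i) → sumℕ x +ℕ u ≡ d → (∀ i → x i ≡ 1) × u ≡ 0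
tight {d} x u 1≤x eq = (λ i → ℕ.≤-antisym (x≤1 i) (1≤x i)) , ℕ.m+n≡0⇒n≡0 (sumℕ y) y+u≡0
  where
  y : Fin d → ℕ
  y i = ℕ.pred (x i)
  x≡ : ∀ i → x i ≡ 1 +ℕ y i
  x≡ i = sym (ℕ.suc-pred (x i) {{ℕ.>-nonZero (1≤x i)}})
  y+u≡0 : sumℕ y +ℕ u ≡ 0
  y+u≡0 = ℕ.+-cancelˡ-≡ d _ _ (trans (sym (trans (cong (_+ℕ u)
      (trans (sumℕ-cong x≡) (trans (sumℕ-+ (λ _ → 1) y)
      (cong (_+ℕ sumℕ y) (trans (sumℕ-const d 1) (ℕ.*-identityʳ d)))))) (ℕ.+-assoc d (sumℕ y) u)))
      (trans eq (sym (ℕ.+-identityʳ d))))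
  x≤1 : ∀ i → x i ≤ℕ 1
  x≤1 i = ℕ.≤-trans (ℕ.≤-reflexive (x≡ i)) (s≤s (ℕ.≤-trans (term≤sumℕ y i)
      (ℕ.≤-reflexive (ℕ.m+n≡0⇒m≡0 (sumℕ y) y+u≡0))))

module _ {d n : ℕ} (f : Box d n) (e : Subset n) (∣e∣≡d : ∣ e ∣ ≡ d) (t : Vec (Fin n) d)
  (coloured : ∀ i → f (lookup t i) ≡ just i) (t⊆e : ∀ i → lookup t i ∈ˢ e) where

  t∈ : ∀ i → lookup t i ∈ˢ e ∩ part-of f i
  t∈ i = x∈p∩q⁺ (t⊆e i , ∈-part⁺ f (coloured i))

  transversal-tight : (∀ i → ∣ e ∩ part-of f i ∣ ≡ 1) × ∣ e ∩ uncoloured f ∣ ≡ 0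
  transversal-tight = tight (λ i → ∣ e ∩ part-of f i ∣) _ (λ i → ∈⇒1≤∣∣ (t∈ i)) (trans (partition-size f e) ∣e∣≡d)

  -- Each vertex of `e` is coloured and is the only one of its colour in `e`, so it is an entry of
  -- `t`. Thus a transversal determines its edge.
  transversal-⊆ : ∀ e′ → (∀ i → lookup t i ∈ˢ e′) → e ⊆ e′
  transversal-⊆ e′ t⊆e′ {v} v∈e with f v in fv
  ... | just i  = subst (_∈ˢ e′) (∣∣≡1⇒≡ (proj₁ transversal-tight i) (t∈ i) (x∈p∩q⁺ (v∈e , ∈-part⁺ f fv))) (t⊆e′ i)
  ... | nothing = ⊥-elim (ℕ.<-irrefl refl (ℕ.≤-trans (∈⇒1≤∣∣ (x∈p∩q⁺ (v∈e , ∈-tabulate⁺ (cong is-nothing fv))))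
      (ℕ.≤-reflexive (proj₂ transversal-tight))))

allB : ∀ {n k} → (Fin k → Fin n → Bool) → Vec (Fin n) k → Bool
allB g []      = true
allB g (v ∷ t) = g zero v ∧ allB (g ∘ suc) t

allB-true⁻ : ∀ {n k} (g : Fin k → Fin n → Bool) t → allB g t ≡ true → ∀ i → g i (lookup t i) ≡ true
allB-true⁻ g (v ∷ t) eq zero    = proj₁ (∧-true⁻ eq)
allB-true⁻ g (v ∷ t) eq (suc i) = allB-true⁻ (g ∘ suc) t (proj₂ (∧-true⁻ {g zero v} eq)) i

allB-true : ∀ {n k} (g : Fin k → Fin n → Bool) t → (∀ i → g i (lookup t i) ≡ true) → allB g t ≡ true
allB-true g []      all = refl
allB-true g (v ∷ t) all = cong₂ _∧_ (all zero) (allB-true (g ∘ suc) t (all ∘ suc))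

anyL : ∀ {A : Set} → (A → Bool) → List A → Bool
anyL p []       = false
anyL p (a ∷ as) = p a ∨ anyL p as

anyL-true : ∀ {A : Set} (p : A → Bool) {a as} → a ∈ as → p a ≡ true → anyL p as ≡ true
anyL-true p {as = _ ∷ as} (here refl) pa = cong (_∨ anyL p as) pa
anyL-true p {as = b ∷ _}  (there a∈)  pa with p b
... | true  = refl
... | false = anyL-true p a∈ pa

anyL-true⁻ : ∀ {A : Set} (p : A → Bool) as → anyL p as ≡ true → ∃[ a ] a ∈ as × p a ≡ true
anyL-true⁻ p (a ∷ as) eq with p a in pa
... | true  = a , here refl , pa
... | false with anyL-true⁻ p as eq
...   | b , b∈ , pb = b , there b∈ , pb

covers : ∀ {n k} → Vec (Fin n) k → Subset n → Bool
covers t e = allB (λ _ v → lookup e v) t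

colours : ∀ {d n} → Box d n → Vec (Fin n) d → Bool
colours f t = allB (λ i v → is i (f v)) t

-- A crossing edge is represented by its vertices listed in the order of their colours; counting
-- edges becomes counting tuples, which can be done coordinatewise.
crossing : ∀ {d n} → Hypergraph n → Box d n → Relation n d
crossing H f t = colours f t ∧ anyL (covers t) (hyperedges H)

colours⁻ : ∀ {d n} (f : Box d n) t → colours f t ≡ true → ∀ i → f (lookup t i) ≡ just i
colours⁻ f t eq i = is-true⁻ i _ (allB-true⁻ (λ i v → is i (f v)) t eq i)

colours⁺ : ∀ {d n} (f : Box d n) t → (∀ i → f (lookup t i) ≡ just i) → colours f t ≡ true
colours⁺ f t all = allB-true (λ i v → is i (f v)) t (λ i → trans (cong (is i) (all i)) (is-true i))

covers⁻ : ∀ {n k} (t : Vec (Fin n) k) e → covers t e ≡ true → ∀ i → lookup t i ∈ˢ e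
covers⁻ t e eq i = Vec.lookup⇒[]= (lookup t i) e (allB-true⁻ (λ _ v → lookup e v) t eq i)

covers⁺ : ∀ {n k} (t : Vec (Fin n) k) e → (∀ i → lookup t i ∈ˢ e) → covers t e ≡ true
covers⁺ t e all = allB-true (λ _ v → lookup e v) t (λ i → Vec.[]=⇒lookup (all i))

bool-ext : ∀ {a b} → (a ≡ true → b ≡ true) → (b ≡ true → a ≡ true) → a ≡ b
bool-ext {true}  {true}  _ _ = refl
bool-ext {true}  {false} i _ = sym (i refl)
bool-ext {false} {true}  _ j = j refl
bool-ext {false} {false} _ _ = refl

module _ {d n : ℕ} (H : Hypergraph n) (uniform : Uniform d H) where

  -- The oracle demands exactly one vertex per part, `crossing` only one vertex per colour; for
  -- edges of size d the two agree by `transversal-tight`.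
  askBox-law : ∀ (f : Box d n) → ∃[ b ] (∀ {φ} → E (gpis H) (askBox f) φ ≡ φ b)
    × (b ≡ true → ∃[ t ] crossing H f t ≡ true) × (∀ t → crossing H f t ≡ true → b ≡ true)
  askBox-law f with Fin.all? (λ i → nonempty? (part-of f i))
  ... | no ¬ne = false , refl , (λ ()) , λ t ct → ⊥-elim
      (¬ne (λ i → lookup t i , ∈-part⁺ f (colours⁻ f t (proj₁ (∧-true⁻ ct)) i)))
  ... | yes ne = gpis H (toQuery f ne) , refl , from , to
    where
    from : gpis H (toQuery f ne) ≡ true → ∃[ t ] crossing H f t ≡ true
    from eq with find (⌊⌋-true⁻ (any? (crosses? (toQuery f ne)) (hyperedges H)) eq)
    ... | e , e∈ , cr = t , cong₂ _∧_
        (colours⁺ f t (λ i → subst (λ v → f v ≡ just i) (sym (Vec.lookup∘tabulate vertex i))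
            (∈-part⁻ f (proj₂ (x∈p∩q⁻ e (part-of f i) (vertex∈ i))))))
        (anyL-true (covers t) e∈ (covers⁺ t e (λ i → subst (_∈ˢ e) (sym (Vec.lookup∘tabulate vertex i))
            (proj₁ (x∈p∩q⁻ e (part-of f i) (vertex∈ i))))))
      where
      witness : ∀ i → ∃[ v ] v ∈ˢ e ∩ part-of f i
      witness i = 1≤∣∣⇒∃ _ (ℕ.≤-reflexive (sym (cr i)))
      vertex : Fin d → Fin n
      vertex i = proj₁ (witness i)
      vertex∈ : ∀ i → vertex i ∈ˢ e ∩ part-of f i
      vertex∈ i = proj₂ (witness i)
      t : Vec (Fin n) d
      t = Vec.tabulate vertex
    to : ∀ t → crossing H f t ≡ true → gpis H (toQuery f ne) ≡ true
    to t ct with anyL-true⁻ (covers t) (hyperedges H) (proj₂ (∧-true⁻ {colours f t} ct))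
    ... | e , e∈ , te = ⌊⌋-true (any? (crosses? (toQuery f ne)) (hyperedges H))
      (lose e∈ (proj₁ (transversal-tight f e (All.lookup uniform e∈) t (colours⁻ f t (proj₁ (∧-true⁻ ct)))
          (covers⁻ t e te))))

-- Counting crossing edges

tsum : ∀ {n k} → (Vec (Fin n) k → ℕ) → ℕ
tsum {k = zero}  F = F []
tsum {k = suc k} F = sumℕ (λ v → tsum (λ t → F (v ∷ t)))

total≡tsum : ∀ {n k} (h : Relation n k) → total h ≡ tsum (bit ∘ h)
total≡tsum {k = zero}  h = refl
total≡tsum {k = suc k} h = sumℕ-cong (λ v → total≡tsum (λ t → h (v ∷ t)))

tsum-cong : ∀ {n k} {F G : Vec (Fin n) k → ℕ} → (∀ t → F t ≡ G t) → tsum F ≡ tsum G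
tsum-cong {k = zero}  eq = eq []
tsum-cong {k = suc k} eq = sumℕ-cong (λ v → tsum-cong (λ t → eq (v ∷ t)))

tsum-+ : ∀ {n k} (F G : Vec (Fin n) k → ℕ) → tsum (λ t → F t +ℕ G t) ≡ tsum F +ℕ tsum G
tsum-+ {k = zero}  F G = refl
tsum-+ {k = suc k} F G = trans (sumℕ-cong (λ v → tsum-+ (λ t → F (v ∷ t)) (λ t → G (v ∷ t))))
  (sumℕ-+ (λ v → tsum (λ t → F (v ∷ t))) (λ v → tsum (λ t → G (v ∷ t))))

tsum-* : ∀ {n k} c (F : Vec (Fin n) k → ℕ) → tsum (λ t → c *ℕ F t) ≡ c *ℕ tsum F
tsum-* {k = zero}  c F = refl
tsum-* {k = suc k} c F = trans (sumℕ-cong (λ v → tsum-* c (λ t → F (v ∷ t))))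
    (sumℕ-* c (λ v → tsum (λ t → F (v ∷ t))))

tsum-zero : ∀ n k → tsum {n} {k} (λ _ → 0) ≡ 0
tsum-zero n k = tsum-* {n} {k} 0 (λ _ → 0)

sumLℕ : ∀ {A : Set} → (A → ℕ) → List A → ℕ
sumLℕ f []       = 0
sumLℕ f (a ∷ as) = f a +ℕ sumLℕ f as

sumLℕ-cong : ∀ {A : Set} {f g : A → ℕ} as → (∀ {a} → a ∈ as → f a ≡ g a) → sumLℕ f as ≡ sumLℕ g as
sumLℕ-cong []       eq = refl
sumLℕ-cong (a ∷ as) eq = cong₂ _+ℕ_ (eq (here refl)) (sumLℕ-cong as (eq ∘ there))

sumLℕ-zero : ∀ {A : Set} (as : List A) → sumLℕ (λ _ → 0) as ≡ 0
sumLℕ-zero []       = refl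
sumLℕ-zero (a ∷ as) = sumLℕ-zero as

tsum-list : ∀ {A : Set} {n k} (F : A → Vec (Fin n) k → ℕ) as → tsum (λ t → sumLℕ (λ a → F a t) as) ≡ sumLℕ
    (λ a → tsum (F a)) as
tsum-list {n = n} {k} F [] = tsum-zero n k
tsum-list F (a ∷ as) = trans (tsum-+ (F a) (λ t → sumLℕ (λ b → F b t) as)) (cong (tsum (F a) +ℕ_) (tsum-list F as))

prodℕ : ∀ {k} → (Fin k → ℕ) → ℕ
prodℕ = foldr _*ℕ_ 1

prodℕ-cong : ∀ {k} {f g : Fin k → ℕ} → (∀ i → f i ≡ g i) → prodℕ f ≡ prodℕ g
prodℕ-cong {zero}  eq = refl
prodℕ-cong {suc k} eq = cong₂ _*ℕ_ (eq zero) (prodℕ-cong (eq ∘ suc))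

prodℕ-ones : ∀ {k} (f : Fin k → ℕ) → (∀ i → f i ≡ 1) → prodℕ f ≡ 1
prodℕ-ones {zero}  f ones = refl
prodℕ-ones {suc k} f ones = cong₂ _*ℕ_ (ones zero) (prodℕ-ones (f ∘ suc) (ones ∘ suc))

1≤prodℕ⁻ : ∀ {k} (f : Fin k → ℕ) → 1 ≤ℕ prodℕ f → ∀ i → 1 ≤ℕ f i
1≤prodℕ⁻ {suc k} f le i with f zero in eq
1≤prodℕ⁻ {suc k} f le zero    | suc _ = subst (1 ≤ℕ_) (sym eq) (s≤s z≤n)
1≤prodℕ⁻ {suc k} f le (suc i) | suc a = 1≤prodℕ⁻ (f ∘ suc) (positive-factor (prodℕ (f ∘ suc)) le) i
  where
  positive-factor : ∀ b → 1 ≤ℕ suc a *ℕ b → 1 ≤ℕ b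
  positive-factor zero    le = subst (1 ≤ℕ_) (ℕ.*-zeroʳ (suc a)) le
  positive-factor (suc b) le = s≤s z≤n

tsum-allB : ∀ {n k} (g : Fin k → Fin n → Bool) → tsum (λ t → bit (allB g t)) ≡ prodℕ (λ i → sumℕ (λ v → bit (g i v)))
tsum-allB {k = zero}  g = refl
tsum-allB {n} {suc k} g = begin
  sumℕ (λ v → tsum (λ t → bit (g zero v ∧ allB (g ∘ suc) t)))          ≡⟨ sumℕ-cong
      (λ v → trans (tsum-cong (λ t → bit-∧ (g zero v) (allB (g ∘ suc) t)))
      (tsum-* (bit (g zero v)) (λ t → bit (allB (g ∘ suc) t)))) ⟩
  sumℕ (λ v → bit (g zero v) *ℕ X)                                     ≡⟨ trans
      (sumℕ-cong (λ v → ℕ.*-comm (bit (g zero v)) X)) (sumℕ-* X (λ v → bit (g zero v))) ⟩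
  X *ℕ sumℕ (λ v → bit (g zero v))                                     ≡⟨ ℕ.*-comm X _ ⟩
  sumℕ (λ v → bit (g zero v)) *ℕ X                                     ≡⟨ cong (sumℕ (λ v → bit (g zero v)) *ℕ_)
      (tsum-allB (g ∘ suc)) ⟩
  prodℕ (λ i → sumℕ (λ v → bit (g i v)))                               ∎
  where
  open ≡-Reasoning
  X = tsum (λ t → bit (allB (g ∘ suc) t))

allB-∧ : ∀ {n k} (g g′ : Fin k → Fin n → Bool) t → allB g t ∧ allB g′ t ≡ allB (λ i v → g i v ∧ g′ i v) t
allB-∧ g g′ []      = refl
allB-∧ g g′ (v ∷ t) = trans (∧-interchange (g zero v) (g′ zero v) _ _)
    (cong ((g zero v ∧ g′ zero v) ∧_) (allB-∧ (g ∘ suc) (g′ ∘ suc) t))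
  where
  ∧-interchange : ∀ a a′ b b′ → (a ∧ b) ∧ (a′ ∧ b′) ≡ (a ∧ a′) ∧ (b ∧ b′)
  ∧-interchange true  true  b b′ = refl
  ∧-interchange true  false true  b′ = refl
  ∧-interchange true  false false b′ = refl
  ∧-interchange false a′ b b′ = refl

∣∩tabulate∣ : ∀ {n} (e : Subset n) (g : Fin n → Bool) → sumℕ (λ v → bit (g v ∧ lookup e v)) ≡ ∣ e ∩ Vec.tabulate g ∣
∣∩tabulate∣ []      g = refl
∣∩tabulate∣ (b ∷ e) g = trans (cong₂ _+ℕ_ (cong bit (Bool.∧-comm (g zero) b)) (∣∩tabulate∣ e (g ∘ suc)))
    (sym (∣∷∣ (b ∧ g zero) (e ∩ Vec.tabulate (g ∘ suc))))

bit-anyL : ∀ {A : Set} (p : A → Bool) as → Unique as →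
  (∀ {a b} → a ∈ as → b ∈ as → p a ≡ true → p b ≡ true → a ≡ b) → bit (anyL p as) ≡ sumLℕ (bit ∘ p) as
bit-anyL p []       uniq inj = refl
bit-anyL p (a ∷ as) (a∉as ∷ uniq) inj with p a in pa
... | false = bit-anyL p as uniq (λ x y → inj (there x) (there y))
... | true  = cong suc (sym (trans (sumLℕ-cong as none) (sumLℕ-zero as)))
  where
  none : ∀ {b} → b ∈ as → bit (p b) ≡ 0
  none {b} b∈ with p b in pb
  ... | false = refl
  ... | true  = ⊥-elim (All.lookup a∉as b∈ (inj (here refl) (there b∈) pa pb))

crossesB : ∀ {d n} → Box d n → Subset n → Bool
crossesB f e = ⌊ Fin.all? (λ i → ∣ e ∩ part-of f i ∣ ℕ.≟ 1) ⌋

module _ {d n : ℕ} (f : Box d n) where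

  -- The transversals inside `e` form a product, so their number is the product of the intersection
  -- sizes. A nonzero product has all factors at least 1, and then `tight` makes each of them 1.
  edge-transversals : ∀ e → ∣ e ∣ ≡ d → tsum (λ t → bit (colours f t ∧ covers t e)) ≡ bit (crossesB f e)
  edge-transversals e ∣e∣≡d = trans
    (trans (tsum-cong (λ t → cong bit (allB-∧ (λ i v → is i (f v)) (λ _ v → lookup e v) t)))
      (trans (tsum-allB (λ i v → is i (f v) ∧ lookup e v)) (prodℕ-cong (λ i → ∣∩tabulate∣ e (λ v → is i (f v))))))
    product
    where
    x : Fin d → ℕ
    x i = ∣ e ∩ part-of f i ∣
    product : prodℕ x ≡ bit (crossesB f e)
    product with Fin.all? (λ i → x i ℕ.≟ 1)
    ... | yes ones = prodℕ-ones x ones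
    ... | no ¬ones with prodℕ x in eq
    ...   | zero  = refl
    ...   | suc _ = ⊥-elim (¬ones (proj₁ (tight x _ (1≤prodℕ⁻ x (subst (1 ≤ℕ_) (sym eq) (s≤s z≤n)))
        (trans (partition-size f e) ∣e∣≡d))))

  -- A tuple lies in at most one crossing edge by `transversal-⊆`, so the disjunction over the edges
  -- can be replaced by a sum and the two sums exchanged.
  crossing-total : (H : Hypergraph n) → Uniform d H → total (crossing H f) ≡ sumLℕ (λ e → bit (crossesB f e))
      (hyperedges H)
  crossing-total H uniform = trans (total≡tsum (crossing H f)) (trans (tsum-cong per-tuple)
    (trans (tsum-list (λ e t → bit (colours f t ∧ covers t e)) (hyperedges H))
      (sumLℕ-cong (hyperedges H) (λ {e} e∈ → edge-transversals e (All.lookup uniform e∈)))))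
    where
    per-tuple : ∀ t → bit (crossing H f t) ≡ sumLℕ (λ e → bit (colours f t ∧ covers t e)) (hyperedges H)
    per-tuple t with colours f t in ct
    ... | false = sym (sumLℕ-zero (hyperedges H))
    ... | true  = bit-anyL (covers t) (hyperedges H) (distinct H) (λ {e} {e′} e∈ e′∈ te te′ → ⊆-antisym
      (transversal-⊆ f e (All.lookup uniform e∈) t (colours⁻ f t ct) (covers⁻ t e te) e′ (covers⁻ t e′ te′))
      (transversal-⊆ f e′ (All.lookup uniform e′∈) t (colours⁻ f t ct) (covers⁻ t e′ te′) e (covers⁻ t e te)))

positive-term : ∀ {k} (x : Fin k → ℕ) → 1 ≤ℕ sumℕ x → ∃[ i ] 1 ≤ℕ x i
positive-term {suc k} x le with x zero in eq
... | suc _ = zero , subst (1 ≤ℕ_) (sym eq) (s≤s z≤n)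
... | zero with positive-term (x ∘ suc) le
...   | i , 1≤ = suc i , 1≤

total>0⇒∃ : ∀ {n k} (h : Relation n k) → 1 ≤ℕ total h → ∃[ t ] h t ≡ true
total>0⇒∃ {k = zero} h le with h [] in eq
... | true = [] , eq
total>0⇒∃ {n} {suc k} h le with positive-term (λ v → total (λ t → h (v ∷ t))) le
... | v , 1≤ with total>0⇒∃ (λ t → h (v ∷ t)) 1≤
...   | t , ht = v ∷ t , ht

∃⇒total>0 : ∀ {n k} (h : Relation n k) t → h t ≡ true → 1 ≤ℕ total h
∃⇒total>0 h []      ht = ℕ.≤-reflexive (sym (cong bit ht))
∃⇒total>0 h (v ∷ t) ht = ℕ.≤-trans (∃⇒total>0 (λ u → h (v ∷ u)) t ht) (term≤sumℕ (λ w → total (λ u → h (w ∷ u))) v)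

total-unique : ∀ {n k} (h : Relation n k) → (∀ t t′ → h t ≡ true → h t′ ≡ true → t ≡ t′) → total h ≤ℕ 1
total-unique {n} {k} h uniq with total h in eq
... | zero  = z≤n
... | suc x with total>0⇒∃ h (subst (1 ≤ℕ_) (sym eq) (s≤s z≤n))
...   | t , ht = ℕ.≤-trans (ℕ.≤-reflexive (sym eq)) (ℕ.≤-trans (total-mono point)
  (ℕ.≤-reflexive (trans (total≡tsum (allB same)) (trans (tsum-allB same)
      (prodℕ-ones _ (λ i → sum-diagonal (lookup t i)))))))
  where
  same : Fin k → Fin n → Bool
  same i v = does (v Fin.≟ lookup t i)
  same-refl : ∀ v → does (v Fin.≟ v) ≡ true
  same-refl v with v Fin.≟ v
  ... | yes _  = refl
  ... | no v≢v = ⊥-elim (v≢v refl)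
  point : ∀ t′ → h t′ ≡ true → allB same t′ ≡ true
  point t′ ht′ with uniq t′ t ht′ ht
  ... | refl = allB-true same t (λ i → same-refl (lookup t i))

hit-true⁻ : ∀ {n k} (h : Relation n k) Ts → hit h Ts ≡ true → ∃[ t ]
    (∀ i → lookup (lookup Ts i) (lookup t i) ≡ true) × h t ≡ true
hit-true⁻ h []       eq = [] , (λ ()) , eq
hit-true⁻ h (T ∷ Ts) eq with hit-true⁻ (link T h) Ts eq
... | t , t∈ , lt with anyF-true⁻ (λ v → lookup T v ∧ h (v ∷ t)) lt
...   | v , vt = v ∷ t , (λ { zero → proj₁ (∧-true⁻ vt) ; (suc i) → t∈ i }) , proj₂ (∧-true⁻ {lookup T v} vt)

hit-true : ∀ {n k} (h : Relation n k) Ts t → (∀ i → lookup (lookup Ts i) (lookup t i) ≡ true) → h t ≡ true → hit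
    h Ts ≡ true
hit-true h []       []      t∈ ht = ht
hit-true h (T ∷ Ts) (v ∷ t) t∈ ht = hit-true (link T h) Ts t (t∈ ∘ suc)
  (anyF-true (λ w → lookup T w ∧ h (w ∷ t)) v (cong₂ _∧_ (t∈ zero) ht))

restrict : ∀ {d n} → Box d n → Vec (Vec Bool n) d → Box d n
restrict f Ts v with f v
... | nothing = nothing
... | just i  = if lookup (lookup Ts i) v then just i else nothing

restrict-just⁻ : ∀ {d n} (f : Box d n) Ts v {i} → restrict f Ts v ≡ just i → f v ≡ just i × lookup (lookup Ts i)
    v ≡ true
restrict-just⁻ f Ts v eq with f v
restrict-just⁻ f Ts v eq | just j with lookup (lookup Ts j) v in Tv
restrict-just⁻ f Ts v refl | just j | true = refl , Tv

restrict-just : ∀ {d n} (f : Box d n) Ts v {i} → f v ≡ just i → lookup (lookup Ts i) v ≡ true → restrict f Ts v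
    ≡ just i
restrict-just f Ts v fv Tv with f v
restrict-just f Ts v refl Tv | just i rewrite Tv = refl

module _ {d n : ℕ} (H : Hypergraph n) (uniform : Uniform d H) where

  askBox-positive : ∀ (f : Box d n) → (total (crossing H f) ≡ 0 × (∀ φ → E (gpis H) (askBox f) φ ≡ φ false))
    ⊎ (1 ≤ℕ total (crossing H f) × (∀ φ → E (gpis H) (askBox f) φ ≡ φ true))
  askBox-positive f with askBox-law H uniform f
  ... | true  , E≡ , from , _ = inj₂ (∃⇒total>0 (crossing H f) (proj₁ (from refl)) (proj₂ (from refl)) , λ φ → E≡)
  ... | false , E≡ , _ , to = inj₁ (ℕ.n<1⇒n≡0 (ℕ.≰⇒> λ 1≤ → case to (proj₁ (total>0⇒∃ (crossing H f) 1≤))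
      (proj₂ (total>0⇒∃ (crossing H f) 1≤)) of λ ()) , λ φ → E≡)

  -- Erasing the colours of the dropped vertices turns a sample into a box, so a trial costs a
  -- single query.
  askBox-restrict : ∀ (f : Box d n) Ts φ → E (gpis H) (askBox (restrict f Ts)) φ ≡ φ (hit (crossing H f) Ts)
  askBox-restrict f Ts φ with askBox-law H uniform (restrict f Ts)
  ... | b , E≡ , from , to = trans E≡ (cong φ (bool-ext forward backward))
    where
    forward : b ≡ true → hit (crossing H f) Ts ≡ true
    forward bt with from bt
    ... | t , ct = hit-true (crossing H f) Ts t
      (λ i → proj₂ (restrict-just⁻ f Ts (lookup t i) (colours⁻ (restrict f Ts) t (proj₁ (∧-true⁻ ct)) i)))
      (cong₂ _∧_ (colours⁺ f t (λ i → proj₁ (restrict-just⁻ f Ts (lookup t i)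
          (colours⁻ (restrict f Ts) t (proj₁ (∧-true⁻ ct)) i)))) (proj₂ (∧-true⁻ {colours (restrict f Ts) t} ct)))
    backward : hit (crossing H f) Ts ≡ true → b ≡ true
    backward ht with hit-true⁻ (crossing H f) Ts ht
    ... | t , t∈ , ct = to t (cong₂ _∧_ (colours⁺ (restrict f Ts) t
        (λ i → restrict-just f Ts (lookup t i) (colours⁻ f t (proj₁ (∧-true⁻ ct)) i) (t∈ i)))
        (proj₂ (∧-true⁻ {colours f t} ct)))

-- Splitting boxes

module Particles {d n : ℕ} (L : ℕ) (digit : Fin L → Fin n → Bool) where

  Test : Set
  Test = Fin d × Fin L

  Agree : Box d n → Test → Set
  Agree f (i , l) = ∀ v w → f v ≡ just i → f w ≡ just i → digit l v ≡ digit l w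

  -- ts lists the pairs of a colour and a digit on which the box has not been split yet.
  Particle : List Test → Set
  Particle ts = Σ[ f ∈ Box d n ] (∀ i l → (i , l) ∈ ts ⊎ Agree f (i , l))

  -- Only vertices of colour `i` whose digit `l` differs from `b` lose their colour; the other
  -- colours stay whole.
  half : Box d n → Test → Bool → Box d n
  half f (i , l) b v = if is i (f v) ∧ (digit l v xor b) then nothing else f v

  half-just⁻ : ∀ f i l b v {j} → half f (i , l) b v ≡ just j → f v ≡ just j × (j ≡ i → digit l v ≡ b)
  half-just⁻ f i l b v eq with is i (f v) in iv | digit l v in dv | b
  ... | true  | true  | true  = eq , λ _ → refl
  ... | true  | false | false = eq , λ _ → refl
  ... | false | a | c = eq , λ { refl → case trans (sym iv) (trans (cong (is i) eq) (is-true i)) of λ () }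

  half-just : ∀ f i l b v {j} → f v ≡ just j → (j ≡ i → digit l v ≡ b) → half f (i , l) b v ≡ just j
  half-just f i l b v eq dig with is i (f v) in iv
  ... | false = eq
  ... | true with digit l v xor b in dx
  ...   | false = eq
  ...   | true = case trans (sym dx) (trans (cong (_xor b)
      (dig (just-injective (trans (sym eq) (is-true⁻ i (f v) iv))))) (Bool.xor-same b)) of λ ()

  kid : ∀ {t ts} → Particle (t ∷ ts) → Bool → Particle ts
  kid {i , l} (f , split) b = half f (i , l) b , split′
    where
    split′ : ∀ j k → (j , k) ∈ _ ⊎ Agree (half f (i , l) b) (j , k)
    split′ j k with split j k
    ... | inj₁ (here refl) = inj₂ (λ v w fv fw → trans (proj₂ (half-just⁻ f i l b v fv) refl)
        (sym (proj₂ (half-just⁻ f i l b w fw) refl)))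
    ... | inj₁ (there t∈)  = inj₁ t∈
    ... | inj₂ agree       = inj₂ (λ v w fv fw → agree v w (proj₁ (half-just⁻ f i l b v fv))
        (proj₁ (half-just⁻ f i l b w fw)))

  trial : Box d n → Prog d n ℕ
  trial f = samples L d >>= λ (w , Ts) → askBox (restrict f Ts) >>= λ b → ret (bit b *ℕ w)

  -- A box has at most 2 ^ (L d) crossing edges, and `odds L d` trials halve the probability that
  -- all fail; `L *ℕ d` such blocks are what `coarse-lower` asks for.
  rounds : ℕ
  rounds = (L *ℕ d) *ℕ odds L d

  -- The preliminary query both discards empty boxes and secures mass at least 1, which the bounds
  -- on the coarse estimate assume.
  weigh : ∀ {ts} → Particle ts → Prog d n (Maybe ℕ)
  weigh (f , _) = askBox f >>= λ b → if b then (coarse rounds (trial f) >>= λ c → ret (just c)) else ret nothing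

  decide : Particle [] → Prog d n Bool
  decide (f , _) = askBox f

  cost-keep : ∀ (O : Oracle d n) r k → cost O (keep r k) ≤ℕ 0
  cost-keep O r zero    = z≤n
  cost-keep O r (suc k) = ⨆-≤ {suc r} {0} {λ i → cost O (keep r k >>= λ T → ret (does (i Fin.≟ zero) ∷ T))}
      (λ i → ℕ.≤-trans (cost->>= O (keep r k) _ (λ T → z≤n))
      (ℕ.≤-trans (ℕ.≤-reflexive (ℕ.+-identityʳ _)) (cost-keep O r k)))

  cost-samples : ∀ (O : Oracle d n) r → cost O (samples L r) ≤ℕ 0
  cost-samples O zero    = z≤n
  cost-samples O (suc r) = ⨆-≤ {suc L} {0} {λ j → cost O
      (keep (ℕ.pred (2 ^ℕ toℕ j)) n >>= λ T → samples L r >>= λ (w , Ts) → ret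
      {A = ℕ × Vec (Vec Bool n) (suc r)} (2 ^ℕ toℕ j *ℕ w , T ∷ Ts))}
    (λ j → ℕ.≤-trans (cost->>= O (keep (ℕ.pred (2 ^ℕ toℕ j)) n) _
        (λ T → ℕ.≤-trans (cost->>= O (samples L r) _ (λ _ → z≤n))
        (ℕ.≤-trans (ℕ.≤-reflexive (ℕ.+-identityʳ _)) (cost-samples O r))))
      (ℕ.≤-trans (ℕ.≤-reflexive (ℕ.+-identityʳ _)) (cost-keep O (ℕ.pred (2 ^ℕ toℕ j)) n)))

  cost-trial : ∀ (O : Oracle d n) f → cost O (trial f) ≤ℕ 1
  cost-trial O f = ℕ.≤-trans (cost->>= O (samples L d) _
      (λ (w , Ts) → ℕ.≤-trans (cost->>= O (askBox (restrict f Ts)) _ (λ b → z≤n))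
      (ℕ.≤-trans (ℕ.≤-reflexive (ℕ.+-identityʳ _)) (cost-askBox O (restrict f Ts)))))
    (ℕ.+-monoˡ-≤ 1 (cost-samples O d))

  cost-weigh : ∀ (O : Oracle d n) {ts} (p : Particle ts) → cost O (weigh p) ≤ℕ suc rounds
  cost-weigh O (f , _) = ℕ.≤-trans (cost->>= O (askBox f) _ after) (ℕ.+-monoˡ-≤ rounds (cost-askBox O f))
    where
    after : ∀ b → cost O (if b then (coarse rounds (trial f) >>= λ c → ret (just c)) else ret nothing) ≤ℕ rounds
    after false = z≤n
    after true  = ℕ.≤-trans (cost->>= O (coarse rounds (trial f)) _ (λ c → z≤n))
        (ℕ.≤-trans (ℕ.≤-reflexive (ℕ.+-identityʳ _))
      (ℕ.≤-trans (cost->>= O (iid rounds (trial f)) _ (λ v → z≤n)) (ℕ.≤-trans (ℕ.≤-reflexive (ℕ.+-identityʳ _))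
        (ℕ.≤-trans (cost-iid O (trial f) rounds (cost-trial O f)) (ℕ.≤-reflexive (ℕ.*-identityʳ rounds))))))

  module Masses (H : Hypergraph n) (uniform : Uniform d H) (n≤2^L : n ≤ℕ 2 ^ℕ L)
    (separating : ∀ v w → (∀ l → digit l v ≡ digit l w) → v ≡ w) where

    mass : ∀ {ts} → Particle ts → ℕ
    mass (f , _) = total (crossing H f)

    -- A crossing tuple has exactly one vertex of colour `i`, and the digit of that vertex decides
    -- which half it falls into.
    half-mass : ∀ f i l → total (crossing H (half f (i , l) false)) +ℕ total (crossing H (half f (i , l) true))
        ≡ total (crossing H f)
    half-mass f i l = trans (cong₂ _+ℕ_ (total≡tsum (crossing H (half f (i , l) false)))
        (total≡tsum (crossing H (half f (i , l) true))))
      (trans (sym (tsum-+ (bit ∘ crossing H (half f (i , l) false)) (bit ∘ crossing H (half f (i , l) true))))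
          (trans (tsum-cong pointwise) (sym (total≡tsum (crossing H f)))))
      where
      colours-half : ∀ b t → colours (half f (i , l) b) t ≡ colours f t ∧ not (digit l (lookup t i) xor b)
      colours-half b t = bool-ext
        (λ c → cong₂ _∧_ (colours⁺ f t (λ j → proj₁
            (half-just⁻ f i l b (lookup t j) (colours⁻ (half f (i , l) b) t c j))))
          (trans (cong (λ a → not (a xor b)) (proj₂
              (half-just⁻ f i l b (lookup t i) (colours⁻ (half f (i , l) b) t c i)) refl))
              (cong not (Bool.xor-same b))))
        (λ c → colours⁺ (half f (i , l) b) t (λ j → half-just f i l b (lookup t j)
            (colours⁻ f t (proj₁ (∧-true⁻ c)) j)
          (λ { refl → same (digit l (lookup t j)) b (proj₂ (∧-true⁻ {colours f t} c)) })))
        where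
        same : ∀ a b → not (a xor b) ≡ true → a ≡ b
        same true  true  _ = refl
        same false false _ = refl
      split-bit : ∀ c a k → bit ((c ∧ not (a xor false)) ∧ k) +ℕ bit ((c ∧ not (a xor true)) ∧ k) ≡ bit (c ∧ k)
      split-bit true  true  k = refl
      split-bit true  false k = ℕ.+-identityʳ (bit k)
      split-bit false a     k = refl
      pointwise : ∀ t → bit (crossing H (half f (i , l) false) t) +ℕ bit (crossing H (half f (i , l) true) t) ≡
          bit (crossing H f t)
      pointwise t = trans (cong₂ (λ x y → bit (x ∧ k) +ℕ bit (y ∧ k)) (colours-half false t)
          (colours-half true t)) (split-bit (colours f t) (digit l (lookup t i)) k)
        where k = anyL (covers t) (hyperedges H)

    kid-mass : ∀ {t ts} (p : Particle (t ∷ ts)) → mass (kid p false) +ℕ mass (kid p true) ≡ mass p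
    kid-mass {i , l} (f , _) = half-mass f i l

    -- Once every test is done, vertices of equal colour agree in all digits and so coincide: each
    -- colour class has at most one vertex.
    mass≤1 : ∀ (p : Particle []) → mass p ≤ℕ 1
    mass≤1 (f , split) = total-unique (crossing H f) same
      where
      same : ∀ t t′ → crossing H f t ≡ true → crossing H f t′ ≡ true → t ≡ t′
      same t t′ ct ct′ = trans (sym (Vec.tabulate∘lookup t))
          (trans (Vec.tabulate-cong (λ i → separating _ _ (λ l → agree i l))) (Vec.tabulate∘lookup t′))
        where
        agree : ∀ i l → digit l (lookup t i) ≡ digit l (lookup t′ i)
        agree i l with split i l
        ... | inj₂ agrees = agrees _ _ (colours⁻ f t (proj₁ (∧-true⁻ ct)) i) (colours⁻ f t′ (proj₁ (∧-true⁻ ct′)) i)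

    decide-mass : ∀ (p : Particle []) → ∃[ b ] [ b ] ≡ ι (mass p) × (∀ φ → E (gpis H) (decide p) φ ≡ φ b)
    decide-mass p@(f , _) with askBox-positive H uniform f
    ... | inj₁ (m≡0 , E≡) = false , sym (trans (cong ι m≡0) ι-zero) , E≡
    ... | inj₂ (1≤m , E≡) = true , sym (trans (cong ι (ℕ.≤-antisym (mass≤1 p) 1≤m)) ι-one) , E≡

    E-trial : ∀ f φ → E (gpis H) (trial f) φ ≡ E (gpis H) (samples L d) (λ x → φ (value (crossing H f) x))
    E-trial f φ = trans (E->>= (gpis H) (samples L d) _ φ) (E-cong (gpis H) (samples L d) (λ (w , Ts) →
      trans (E->>= (gpis H) (askBox (restrict f Ts)) _ φ) (askBox-restrict H uniform f Ts (λ b → φ (bit b *ℕ w)))))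

    weigh-law : ∀ {ts} (p : Particle ts) →
      (mass p ≡ 0 × (∀ φ → E (gpis H) (weigh p) φ ≡ φ nothing)) ⊎
      (∃[ q ] (∀ φ → E (gpis H) (weigh p) φ ≡ E (gpis H) q (λ c → φ (just c)))
        × E (gpis H) q (λ c → ι (suc c)) ≤ ι (suc rounds) * ι (mass p)
        × ι (mass p) * E (gpis H) q (λ c → inv (suc c)) ≤ ι (suc (loss L d)))
    weigh-law (f , _) with askBox-positive H uniform f
    ... | inj₁ (m≡0 , E≡) = inj₁ (m≡0 , λ φ → trans (E->>= (gpis H) (askBox f) _ φ) (E≡ _))
    ... | inj₂ (1≤m , E≡) = inj₂ (coarse rounds (trial f)
      , (λ φ → trans (E->>= (gpis H) (askBox f) _ φ) (trans (E≡ _) (E->>= (gpis H) (coarse rounds (trial f)) _ φ)))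
      , coarse-upper (gpis H) (trial f) _ 1≤m rounds
          (≤-trans (≤-reflexive (E-trial f ι)) (E-value≤total (gpis H) L d (crossing H f)))
      , coarse-lower (gpis H) (trial f) _ 1≤m (loss L d) (γ L d) (odds L d) (L *ℕ d) (0≤γ L d)
          (≤-trans (value-enough (gpis H) L n≤2^L d (crossing H f) 1≤m) (≤-reflexive (sym (E-trial f _))))
          (odds*γ L d)
          (ℕ.≤-trans (total≤n^d (crossing H f)) (ℕ.≤-trans (ℕ.^-monoˡ-≤ d n≤2^L)
              (ℕ.≤-reflexive (ℕ.^-*-assoc 2 L d)))))

-- Random colourings

module Colouring (d-1 : ℕ) where

  d : ℕ
  d = suc d-1

  colouring : ∀ {d′ n′} k → Prog d′ n′ (Vec (Fin d) k)
  colouring zero    = ret []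
  colouring (suc k) = toss d-1 λ i → colouring k >>= λ c → ret (i ∷ c)

  cost-colouring : ∀ {d′ n′} (O : Oracle d′ n′) k → cost O (colouring k) ≤ℕ 0
  cost-colouring O zero    = z≤n
  cost-colouring O (suc k) = ⨆-≤ {d} {0} {λ i → cost O (colouring k >>= λ c → ret (i ∷ c))}
      (λ i → ℕ.≤-trans (cost->>= O (colouring k) _ (λ c → z≤n))
    (ℕ.≤-trans (ℕ.≤-reflexive (ℕ.+-identityʳ _)) (cost-colouring O k)))

  boxOf : ∀ {n} → Vec (Fin d) n → Box d n
  boxOf c v = just (lookup c v)

  matches? : ∀ {n} (e : Subset n) (c : Vec (Fin d) n) (k : Fin d → ℕ) → Dec (∀ i → ∣ e ∩ part-of (boxOf c) i ∣ ≡ k i)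
  matches? e c k = Fin.all? (λ i → ∣ e ∩ part-of (boxOf c) i ∣ ℕ.≟ k i)

  matches : ∀ {n} → Subset n → Vec (Fin d) n → (Fin d → ℕ) → Bool
  matches e c k = ⌊ matches? e c k ⌋

  lower : (Fin d → ℕ) → Fin d → Fin d → ℕ
  lower k x i = k i ℕ.∸ bit (does (i Fin.≟ x))

  -- The probability that a random colouring of s vertices uses each colour i exactly k i times:
  -- it depends on an edge only through its size, so one factor corrects the bias for all edges.
  κ : ℕ → (Fin d → ℕ) → ℚ
  κ zero    k = [ ⌊ Fin.all? (λ i → 0 ℕ.≟ k i) ⌋ ]
  κ (suc s) k = inv d * sum (λ x → if ⌊ k x ℕ.≟ 0 ⌋ then 0ℚ else κ s (lower k x))

  matches-true∷ : ∀ {n} (e : Subset n) x c k → matches (true ∷ e) (x ∷ c) k ≡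
      (if ⌊ k x ℕ.≟ 0 ⌋ then false else matches e c (lower k x))
  matches-true∷ e x c k with k x ℕ.≟ 0
  ... | yes kx≡0 = ⌊⌋-false (matches? (true ∷ e) (x ∷ c) k)
      (λ all → case trans (sym (trans (∣∷∣ (does (x Fin.≟ x)) q) (cong (λ b → bit b +ℕ ∣ q ∣) (is-true x))))
      (trans (all x) kx≡0) of λ ())
    where q = e ∩ part-of (boxOf c) x
  ... | no kx≢0 = bool-ext
    (λ eq → ⌊⌋-true (matches? e c (lower k x)) (λ i → trans (sym (ℕ.m+n∸m≡n (bit (does (i Fin.≟ x))) ∣ q i ∣))
        (cong (ℕ._∸ bit (does (i Fin.≟ x))) (trans (sym (∣∷∣ (does (i Fin.≟ x)) (q i)))
        (⌊⌋-true⁻ (matches? (true ∷ e) (x ∷ c) k) eq i)))))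
    (λ eq → ⌊⌋-true (matches? (true ∷ e) (x ∷ c) k)
        (λ i → trans (∣∷∣ (does (i Fin.≟ x)) (q i))
        (trans (cong (bit (does (i Fin.≟ x)) +ℕ_) (⌊⌋-true⁻ (matches? e c (lower k x)) eq i))
        (ℕ.m+[n∸m]≡n (bit≤ i)))))
    where
    q = λ i → e ∩ part-of (boxOf c) i
    bit≤ : ∀ i → bit (does (i Fin.≟ x)) ≤ℕ k i
    bit≤ i with i Fin.≟ x
    ... | no _     = z≤n
    ... | yes refl = ℕ.n≢0⇒n>0 kx≢0

  -- Arbitrary counts `k` are needed for the induction, since colouring a vertex of `e` lowers one
  -- of them. The colour of a vertex outside `e` averages out.
  E-matches : ∀ {d′ n′ n} (O : Oracle d′ n′) (e : Subset n) k → E O (colouring n) (λ c → [ matches e c k ]) ≡ κ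
      ∣ e ∣ k
  E-matches O []          k = refl
  E-matches {n = suc n} O (false ∷ e) k = begin
    inv d * sum {d} (λ x → E O (colouring n >>= λ c → ret (x ∷ c)) (λ c → [ matches (false ∷ e) c k ]))
      ≡⟨ cong (inv d *_) (trans (sum-cong {d} {λ x → E O (colouring n >>= λ c → ret (x ∷ c))
          (λ c → [ matches (false ∷ e) c k ])} (λ x → trans (E->>= O (colouring n) _ _) (E-matches O e k)))
          (sum-const d (κ s k))) ⟩
    inv d * (ι d * κ s k)
      ≡⟨ *-assoc (inv d) (ι d) (κ s k) ⟨
    inv d * ι d * κ s k
      ≡⟨ trans (cong (_* κ s k) (inv-inverseˡ d-1)) (*-identityˡ (κ s k)) ⟩
    κ s k ∎
    where
    open ≡-Reasoning
    s = ∣ e ∣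
  E-matches {n = suc n} O (true ∷ e) k = cong (inv d *_)
      (sum-cong {d} {λ x → E O (colouring n >>= λ c → ret (x ∷ c)) (λ c → [ matches (true ∷ e) c k ])}
    (λ x → trans (E->>= O (colouring n) _ _) (trans
        (E-cong O (colouring n) (λ c → cong [_] (matches-true∷ e x c k))) (branch x))))
    where
    branch : ∀ x → E O (colouring n) (λ c → [ if ⌊ k x ℕ.≟ 0 ⌋ then false else matches e c (lower k x) ]) ≡
        (if ⌊ k x ℕ.≟ 0 ⌋ then 0ℚ else κ ∣ e ∣ (lower k x))
    branch x with ⌊ k x ℕ.≟ 0 ⌋
    ... | true  = E-const O (colouring n) 0ℚ
    ... | false = E-matches O e (lower k x)

  0≤κ : ∀ s k → 0ℚ ≤ κ s k
  0≤κ zero    k = 0≤[] _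
  0≤κ (suc s) k = 0≤* (0≤inv d) (sum-0≤ {d} {λ x → if ⌊ k x ℕ.≟ 0 ⌋ then 0ℚ else κ s (lower k x)} nonneg)
    where
    nonneg : ∀ x → 0ℚ ≤ (if ⌊ k x ℕ.≟ 0 ⌋ then 0ℚ else κ s (lower k x))
    nonneg x with ⌊ k x ℕ.≟ 0 ⌋
    ... | true  = ≤-refl
    ... | false = 0≤κ s (lower k x)

  -- While vertices remain, some colour is still required; the next vertex receives it with
  -- probability 1 / d, and the remaining counts again sum to the number of remaining vertices.
  0<κ : ∀ s k → sumℕ k ≡ s → 0ℚ < κ s k
  0<κ zero    k Σk≡ = subst (0ℚ <_) (sym (cong [_] (⌊⌋-true (Fin.all? (λ i → 0 ℕ.≟ k i))
      (λ i → sym (ℕ.n≤0⇒n≡0 (ℕ.≤-trans (term≤sumℕ k i) (ℕ.≤-reflexive Σk≡))))))) (ℚ.positive⁻¹ 1ℚ)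
  0<κ (suc s) k Σk≡ with positive-term k (ℕ.≤-trans (s≤s z≤n) (ℕ.≤-reflexive (sym Σk≡)))
  ... | x , 1≤kx = ℚ.<-≤-trans (ℚ.positive⁻¹ (inv d * κ s (lower k x))
      {{ℚ.pos*pos⇒pos (inv d) {{positive 0<inv}} (κ s (lower k x)) {{positive (0<κ s (lower k x) Σlower)}}}})
      (*-monoˡ (inv d) (0≤inv d) (≤-trans (≤-reflexive (sym term))
          (term≤sum {d} {λ y → if ⌊ k y ℕ.≟ 0 ⌋ then 0ℚ else κ s (lower k y)} nonneg x)))
    where
    nonneg : ∀ y → 0ℚ ≤ (if ⌊ k y ℕ.≟ 0 ⌋ then 0ℚ else κ s (lower k y))
    nonneg y with ⌊ k y ℕ.≟ 0 ⌋
    ... | true  = ≤-refl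
    ... | false = 0≤κ s (lower k y)
    term : (if ⌊ k x ℕ.≟ 0 ⌋ then 0ℚ else κ s (lower k x)) ≡ κ s (lower k x)
    term = cong (λ b → if b then 0ℚ else κ s (lower k x)) (⌊⌋-false (k x ℕ.≟ 0) (λ kx≡0 → ℕ.<-irrefl (sym kx≡0) 1≤kx))
    0<inv : 0ℚ < inv d
    0<inv = ℚ.*-cancelʳ-<-nonNeg (ι d) {{nonNegative (0≤ι d)}}
        (subst₂ _<_ (sym (*-zeroˡ (ι d))) (sym (inv-inverseˡ d-1)) (ℚ.positive⁻¹ 1ℚ))
    bit≤ : ∀ i → bit (does (i Fin.≟ x)) ≤ℕ k i
    bit≤ i with i Fin.≟ x
    ... | no _     = z≤n
    ... | yes refl = 1≤kx
    Σlower : sumℕ (lower k x) ≡ s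
    Σlower = ℕ.+-cancelʳ-≡ 1 (sumℕ (lower k x)) s (trans (cong (sumℕ (lower k x) +ℕ_) (sym (sum-diagonal x)))
      (trans (sym (sumℕ-+ (lower k x) (λ i → bit (does (i Fin.≟ x)))))
          (trans (sumℕ-cong (λ i → ℕ.m∸n+n≡m (bit≤ i))) (trans Σk≡ (ℕ.+-comm 1 s)))))

  rainbow : ℚ
  rainbow = κ d (λ _ → 1)

  0<rainbow : 0ℚ < rainbow
  0<rainbow = 0<κ d (λ _ → 1) (trans (sumℕ-const d 1) (ℕ.*-identityʳ d))

  module _ {n : ℕ} (H : Hypergraph n) (uniform : Uniform d H) where

    colouredMass : Vec (Fin d) n → ℕ
    colouredMass c = total (crossing H (boxOf c))

    colouredMass≤m : ∀ c → colouredMass c ≤ℕ m H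
    colouredMass≤m c = ℕ.≤-trans (ℕ.≤-reflexive (crossing-total (boxOf c) H uniform)) (bounded (hyperedges H))
      where
      bounded : ∀ es → sumLℕ (λ e → bit (crossesB (boxOf c) e)) es ≤ℕ length es
      bounded []       = z≤n
      bounded (e ∷ es) = ℕ.+-mono-≤ (bit≤1 (crossesB (boxOf c) e)) (bounded es)

    E-colouredMass : ∀ {d′ n′} (O : Oracle d′ n′) → E O (colouring n) (λ c → ι (colouredMass c)) ≡ rainbow * ι (m H)
    E-colouredMass O = trans (E-cong O (colouring n) (λ c → cong ι (crossing-total (boxOf c) H uniform)))
        (edges (hyperedges H) uniform)
      where
      open ≡-Reasoning
      edges : ∀ es → All (λ e → ∣ e ∣ ≡ d) es → E O (colouring n)
          (λ c → ι (sumLℕ (λ e → bit (crossesB (boxOf c) e)) es)) ≡ rainbow * ι (length es)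
      edges []       []             = trans (E-const O (colouring n) (ι 0))
          (trans ι-zero (sym (trans (cong (rainbow *_) ι-zero) (*-zeroʳ rainbow))))
      edges (e ∷ es) (∣e∣≡d ∷ all) = begin
        E O (colouring n) (λ c → ι (bit (crossesB (boxOf c) e) +ℕ rest c))
          ≡⟨ E-cong O (colouring n) (λ c → trans (ι-+ (bit (crossesB (boxOf c) e)) (rest c))
              (cong (_+ ι (rest c)) (ι-bit (crossesB (boxOf c) e)))) ⟩
        E O (colouring n) (λ c → [ crossesB (boxOf c) e ] + ι (rest c))
          ≡⟨ E-+ O (colouring n) (λ c → [ crossesB (boxOf c) e ]) (λ c → ι (rest c)) ⟩
        E O (colouring n) (λ c → [ crossesB (boxOf c) e ]) + E O (colouring n) (λ c → ι (rest c))
          ≡⟨ cong₂ _+_ (trans (E-matches O e (λ _ → 1)) (cong (λ s → κ s (λ _ → 1)) ∣e∣≡d)) (edges es all) ⟩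
        rainbow + rainbow * ι (length es)
          ≡⟨ eq rainbow (ι (length es)) ⟩
        rainbow * (1ℚ + ι (length es))
          ≡⟨ cong (rainbow *_) (ι-suc (length es)) ⟨
        rainbow * ι (suc (length es)) ∎
        where
        rest : Vec (Fin d) n → ℕ
        rest c = sumLℕ (λ e → bit (crossesB (boxOf c) e)) es
        eq : ∀ r k → r + r * k ≡ r * (1ℚ + k)
        eq = solve-∀ ℚ-ring

    -- The number of crossing edges never exceeds `m H`, so its square is at most `m H` times
    -- itself. No correlation between edges has to be computed, at the price of a factor depending
    -- on d only.
    E-colouredMass² : ∀ {d′ n′} (O : Oracle d′ n′) → E O (colouring n)
        (λ c → ι (colouredMass c) * ι (colouredMass c)) ≤ rainbow * (ι (m H) * ι (m H))
    E-colouredMass² O = ≤-trans (E-mono O (colouring n)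
        (λ c → *-monoʳ (ι (colouredMass c)) (0≤ι (colouredMass c)) (ι-mono (colouredMass≤m c))))
      (≤-reflexive (trans (E-* O (colouring n) (ι (m H)) (λ c → ι (colouredMass c)))
          (trans (cong (ι (m H) *_) (E-colouredMass O)) (eq (ι (m H)) rainbow))))
      where
      eq : ∀ m r → m * (r * m) ≡ r * (m * m)
      eq = solve-∀ ℚ-ring

-- Binary digits, rounding and polynomial bounds

n≤2^⌈log₂n⌉ : ∀ n → n ≤ℕ 2 ^ℕ ⌈log₂ n ⌉
n≤2^⌈log₂n⌉ = <-rec (λ n → n ≤ℕ 2 ^ℕ ⌈log₂ n ⌉) go
  where
  go : ∀ n → (∀ {k} → k <ℕ n → k ≤ℕ 2 ^ℕ ⌈log₂ k ⌉) → n ≤ℕ 2 ^ℕ ⌈log₂ n ⌉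
  go zero          rec = z≤n
  go (suc zero)    rec = s≤s z≤n
  go n@(suc (suc k)) rec = begin
    n                                ≡⟨ ℕ.⌊n/2⌋+⌈n/2⌉≡n n ⟨
    ℕ.⌊ n /2⌋ +ℕ ℕ.⌈ n /2⌉           ≤⟨ ℕ.+-mono-≤ (ℕ.≤-trans (ℕ.⌊n/2⌋≤⌈n/2⌉ n) bound) bound ⟩
    2 ^ℕ l +ℕ 2 ^ℕ l                 ≡⟨ cong (2 ^ℕ l +ℕ_) (ℕ.+-identityʳ (2 ^ℕ l)) ⟨
    2 ^ℕ suc l                       ≡⟨ cong (2 ^ℕ_) (ℕ.m+[n∸m]≡n (⌈log₂⌉-mono-≤ {2} {n} (s≤s (s≤s z≤n)))) ⟩
    2 ^ℕ ⌈log₂ n ⌉                   ∎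
    where
    open ℕ.≤-Reasoning
    l = ⌈log₂ n ⌉ ℕ.∸ 1
    bound : ℕ.⌈ n /2⌉ ≤ℕ 2 ^ℕ l
    bound = subst (λ e → ℕ.⌈ n /2⌉ ≤ℕ 2 ^ℕ e) (⌈log₂⌈n/2⌉⌉≡⌈log₂n⌉∸1 n) (rec (ℕ.⌈n/2⌉<n k))

funToFin-cong : ∀ {j k} {f g : Fin j → Fin k} → (∀ i → f i ≡ g i) → Fin.funToFin f ≡ Fin.funToFin g
funToFin-cong {zero}  eq = refl
funToFin-cong {suc j} eq = cong₂ Fin.combine (eq zero) (funToFin-cong (eq ∘ suc))

module _ {n L : ℕ} (n≤2^L : n ≤ℕ 2 ^ℕ L) where

  expansion : Fin n → Fin L → Fin 2
  expansion v = Fin.finToFun {2} {L} (Fin.inject≤ v n≤2^L)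

  binaryDigit : Fin L → Fin n → Bool
  binaryDigit l v = does (expansion v l Fin.≟ zero)

  digits-separate : ∀ v w → (∀ l → binaryDigit l v ≡ binaryDigit l w) → v ≡ w
  digits-separate v w eq = Fin.inject≤-injective n≤2^L n≤2^L v w
      (trans (sym (Fin.funToFin-finToFin {L} {2} (Fin.inject≤ v n≤2^L)))
    (trans (funToFin-cong (λ l → same (expansion v l) (expansion w l) (eq l)))
        (Fin.funToFin-finToFin {L} {2} (Fin.inject≤ w n≤2^L))))
    where
    same : ∀ (a b : Fin 2) → does (a Fin.≟ zero) ≡ does (b Fin.≟ zero) → a ≡ b
    same zero       zero       _ = refl
    same (suc zero) (suc zero) _ = refl

-- ⌊1 / ε⌋ + 1 for positive ε: a natural number within a factor 2 above 1 / ε when ε < 1. The last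
-- clause is a default for the other signs.
reciprocal : ℚ → ℕ
reciprocal (ℚ.mkℚ (pos (suc p)) q-1 _) = suc (suc q-1 ℕ./ suc p)
reciprocal _                           = 1

ι*-bounds : ∀ k {ε} p q-1 → ℚ.toℚᵘ ε ℚᵘ.≃ ℚᵘ.mkℚᵘ (pos p) q-1 →
  (suc q-1 ≤ℕ k *ℕ p → 1ℚ ≤ ι k * ε) × (k *ℕ p ≤ℕ 2 *ℕ suc q-1 → ι k * ε ≤ 1ℚ + 1ℚ)
ι*-bounds k {ε} p q-1 ε≃ = (λ le → ℚ.toℚᵘ-cancel-≤ (ℚᵘ.≤-respʳ-≃ (ℚᵘ.≃-sym product) (ℚᵘ.*≤* (lower le))))
                         , (λ le → ℚ.toℚᵘ-cancel-≤ (ℚᵘ.≤-respˡ-≃ (ℚᵘ.≃-sym product) (ℚᵘ.*≤* (upper le))))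
  where
  product : ℚ.toℚᵘ (ι k * ε) ℚᵘ.≃ ℚᵘ.mkℚᵘ (pos (k *ℕ p)) q-1
  product = ℚᵘ.≃-trans (ℚ.toℚᵘ-homo-* (ι k) ε) (ℚᵘ.≃-trans (ℚᵘ.*-cong (ι-toℚᵘ k) ε≃)
    (ℚᵘ.*≡* (cong₂ ℤ._*_ (sym (ℤ.pos-* k p)) (cong pos (sym (ℕ.*-identityˡ (suc q-1)))))))
  lower : suc q-1 ≤ℕ k *ℕ p → pos 1 ℤ.* pos (suc q-1) ℤ.≤ pos (k *ℕ p) ℤ.* pos 1
  lower le = subst₂ ℤ._≤_ (sym (ℤ.*-identityˡ (pos (suc q-1)))) (sym (ℤ.*-identityʳ (pos (k *ℕ p)))) (ℤ.+≤+ le)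
  upper : k *ℕ p ≤ℕ 2 *ℕ suc q-1 → pos (k *ℕ p) ℤ.* pos 1 ℤ.≤ pos 2 ℤ.* pos (suc q-1)
  upper le = subst₂ ℤ._≤_ (sym (ℤ.*-identityʳ (pos (k *ℕ p)))) (ℤ.pos-* 2 (suc q-1)) (ℤ.+≤+ le)

reciprocal-bounds : ∀ ε → 0ℚ < ε → ε < 1ℚ → 1ℚ ≤ ι (reciprocal ε) * ε × ι (reciprocal ε) * ε ≤ 1ℚ + 1ℚ
reciprocal-bounds ε@(ℚ.mkℚ (pos (suc p)) q-1 _) 0<ε (ℚ.*<* ε<1) =
  proj₁ (ι*-bounds k (suc p) q-1 ℚᵘ.≃-refl) above , proj₂ (ι*-bounds k (suc p) q-1 ℚᵘ.≃-refl) below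
  where
  q = suc q-1
  k = suc (q ℕ./ suc p)
  p<q : suc p <ℕ q
  p<q = ℤ.drop‿+<+ (subst₂ ℤ._<_ (ℤ.*-identityʳ (pos (suc p))) (ℤ.*-identityˡ (pos q)) ε<1)
  above : q ≤ℕ k *ℕ suc p
  above = ℕ.≤-trans (ℕ.≤-reflexive (m≡m%n+[m/n]*n q (suc p)))
      (ℕ.+-monoˡ-≤ (q ℕ./ suc p *ℕ suc p) (ℕ.<⇒≤ (m%n<n q (suc p))))
  below : k *ℕ suc p ≤ℕ 2 *ℕ q
  below = ℕ.+-mono-≤ (ℕ.<⇒≤ p<q) (ℕ.≤-trans (m/n*n≤m q (suc p)) (ℕ.≤-reflexive (sym (ℕ.+-identityʳ q))))
reciprocal-bounds ε@(ℚ.mkℚ (pos zero) q-1 _) 0<ε _ = ⊥-elim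
    (ℚ.<-irrefl refl (ℚ.positive⁻¹ 0ℚ {{ℚ.positive (subst (0ℚ <_) (ℚ.↥p≡0⇒p≡0 ε refl) 0<ε)}}))
reciprocal-bounds ε@(ℚ.mkℚ ℤ.-[1+ p ] q-1 _) (ℚ.*<* ()) _

≤ι : ∀ x → 0ℚ ≤ x → ∃[ B ] x ≤ ι B
≤ι x@(ℚ.mkℚ (pos p) q-1 _) _ = p , ℚ.toℚᵘ-cancel-≤ (ℚᵘ.≤-respʳ-≃ (ℚᵘ.≃-sym (ι-toℚᵘ p))
  (ℚᵘ.*≤* (subst₂ ℤ._≤_ (sym (ℤ.*-identityʳ (pos p))) (ℤ.pos-* p (suc q-1)) (ℤ.+≤+ (ℕ.m≤m*n p (suc q-1))))))
≤ι x@(ℚ.mkℚ ℤ.-[1+ p ] q-1 _) (ℚ.*≤* ())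

-- Multiplying by one more 1 + y creates the quadratic term 2 j y², which the smallness hypothesis
-- bounds by y; the doubled slope pays for it.
growth : ∀ k {y} → 0ℚ ≤ y → (ι k + ι k) * y ≤ 1ℚ → ∀ j → j ≤ℕ k → (1ℚ + y) ^ j ≤ 1ℚ + (ι j + ι j) * y
growth k {y} 0≤y small zero    j≤k = ≤-slack ((ι 0 + ι 0) * y) (0≤* (0≤+ (0≤ι 0) (0≤ι 0)) 0≤y) refl
growth k {y} 0≤y small (suc j) j<k = begin
  (1ℚ + y) * (1ℚ + y) ^ j                        ≤⟨ *-monoˡ (1ℚ + y) (0≤+ 0≤1 0≤y)
      (growth k 0≤y small j (ℕ.<⇒≤ j<k)) ⟩
  (1ℚ + y) * (1ℚ + (ι j + ι j) * y)              ≤⟨ ≤-slack (y * (1ℚ - (ι j + ι j) * y))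
      (0≤* 0≤y (0≤-diff small′)) (eq y (ι j)) ⟩
  1ℚ + (1ℚ + ι j + (1ℚ + ι j)) * y               ≡⟨ cong (λ z → 1ℚ + (z + z) * y) (ι-suc j) ⟨
  1ℚ + (ι (suc j) + ι (suc j)) * y               ∎
  where
  open ℚ.≤-Reasoning
  small′ : (ι j + ι j) * y ≤ 1ℚ
  small′ = ≤-trans (*-monoʳ y 0≤y (+-mono-≤ (ι-mono (ℕ.<⇒≤ j<k)) (ι-mono (ℕ.<⇒≤ j<k)))) small
  eq : ∀ y j → 1ℚ + (1ℚ + j + (1ℚ + j)) * y ≡ (1ℚ + y) * (1ℚ + (j + j) * y) + y * (1ℚ - (j + j) * y)
  eq = solve-∀ ℚ-ring

-- Requiring L ≥ 1 lets constants and lower powers be absorbed into the leading one.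
record Poly (a : ℕ) (f : ℕ → ℕ) : Set where
  constructor poly
  field
    coefficient : ℕ
    bounded     : ∀ L → 1 ≤ℕ L → f L ≤ℕ coefficient *ℕ L ^ℕ a

poly-const : ∀ x → Poly 0 (λ _ → x)
poly-const x = poly x λ L _ → ℕ.≤-reflexive (sym (ℕ.*-identityʳ x))

poly-id : Poly 1 id
poly-id = poly 1 λ L _ → ℕ.≤-reflexive (sym (trans (ℕ.*-identityˡ (L *ℕ 1)) (ℕ.*-identityʳ L)))

poly-* : ∀ {a b f g} → Poly a f → Poly b g → Poly (a +ℕ b) (λ L → f L *ℕ g L)
poly-* {a} {b} (poly c f≤) (poly e g≤) = poly (c *ℕ e) λ L 1≤L → ℕ.≤-trans (ℕ.*-mono-≤ (f≤ L 1≤L) (g≤ L 1≤L))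
  (ℕ.≤-reflexive (trans (eq c (L ^ℕ a) e (L ^ℕ b)) (cong (c *ℕ e *ℕ_) (sym (ℕ.^-distribˡ-+-* L a b)))))
  where
  eq : ∀ c x e y → c *ℕ x *ℕ (e *ℕ y) ≡ c *ℕ e *ℕ (x *ℕ y)
  eq = ℕ-solve-∀

poly-weaken : ∀ {a b f} → a ≤ℕ b → Poly a f → Poly b f
poly-weaken {a} {b} a≤b (poly c f≤) = poly c λ { L@(suc _) 1≤L → ℕ.≤-trans (f≤ L 1≤L)
    (ℕ.*-monoʳ-≤ c (ℕ.^-monoʳ-≤ L a≤b)) }

poly-+ : ∀ {a f g} → Poly a f → Poly a g → Poly a (λ L → f L +ℕ g L)
poly-+ {a} (poly c f≤) (poly e g≤) = poly (c +ℕ e) λ L 1≤L → ℕ.≤-trans (ℕ.+-mono-≤ (f≤ L 1≤L) (g≤ L 1≤L))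
    (ℕ.≤-reflexive (sym (ℕ.*-distribʳ-+ (L ^ℕ a) c e)))

poly-suc : ∀ {a f} → Poly a f → Poly a (λ L → suc (f L))
poly-suc = poly-+ (poly-weaken z≤n (poly-const 1))

poly-loss : ∀ r → Poly r (λ L → loss L r)
poly-loss zero    = poly-const 1
poly-loss (suc r) = poly-weaken (ℕ.≤-reflexive (ℕ.+-comm r 1))
  (poly-* (poly-loss r) (poly-* {1} {0} (poly-suc {1} (poly-* {1} {0} poly-id (poly-const r))) (poly-const 2)))

poly-odds : ∀ r → Poly r (λ L → odds L r)
poly-odds zero    = poly-const 1
poly-odds (suc r) = poly-* {1} (poly-* {0} (poly-const 2) (poly-suc poly-id)) (poly-odds r)

-- The algorithm

sumV-map : ∀ {A B : Set} {k} (f : A → B) (g : B → ℚ) (h : A → ℚ) → (∀ a → g (f a) ≡ h a) → (v : Vec A k) → sumV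
    g (Vec.map f v) ≡ sumV h v
sumV-map f g h eq []      = refl
sumV-map f g h eq (a ∷ v) = cong₂ _+_ (eq a) (sumV-map f g h eq v)

length-cartesianProduct : ∀ {A B : Set} (as : List A) (bs : List B) → length (cartesianProduct as bs) ≡ length
    as *ℕ length bs
length-cartesianProduct []       bs = refl
length-cartesianProduct (a ∷ as) bs = trans (List.length-++ (map (a ,_) bs))
    (cong₂ _+ℕ_ (List.length-map (a ,_) bs) (length-cartesianProduct as bs))

module Estimator (d-1 : ℕ) where

  open Colouring d-1

  rainbow⁻¹ : ℚ
  rainbow⁻¹ = ℚ.1/_ rainbow {{ℚ.>-nonZero 0<rainbow}}

  rainbow-inverse : rainbow * rainbow⁻¹ ≡ 1ℚ
  rainbow-inverse = ℚ.*-inverseʳ rainbow {{ℚ.>-nonZero 0<rainbow}}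

  0≤rainbow⁻¹ : 0ℚ ≤ rainbow⁻¹
  0≤rainbow⁻¹ = ℚ.<⇒≤ (ℚ.positive⁻¹ rainbow⁻¹ {{ℚ.1/pos⇒pos rainbow {{positive 0<rainbow}}}})

  B : ℕ
  B = proj₁ (≤ι rainbow⁻¹ 0≤rainbow⁻¹)

  tests : ∀ L → List (Fin d × Fin L)
  tests L = cartesianProduct (allFin d) (allFin L)

  length-tests : ∀ L → length (tests L) ≡ d *ℕ L
  length-tests L = trans (length-cartesianProduct (allFin d) (allFin L))
      (cong₂ _*ℕ_ (List.length-tabulate {n = d} id) (List.length-tabulate {n = L} id))

  trials : ℕ → ℕ
  trials L = (L *ℕ d) *ℕ odds L d

  -- The product is the factor β of a refinement step and `B` bounds the inverse of `rainbow`, the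
  -- corresponding factor of the random colouring; their sum serves for both.
  spread : ℕ → ℕ
  spread L = suc (trials L) *ℕ suc (loss L d) +ℕ B

  -- There are k = d L + 1 variance factors, and `growth` bounds their product by 1 + 2 k y with y =
  -- `spread` / N. Chebyshev's inequality needs 2 k y ≤ ε² / 16, that is, N ε² ≥ 32 k `spread`.
  scale : ℕ → ℕ
  scale L = 32 *ℕ (suc (d *ℕ L) *ℕ spread L)

  module Basic {n : ℕ} (L : ℕ) (n≤2^L : n ≤ℕ 2 ^ℕ L) (N-1 : ℕ) where

    open Particles {d} {n} L (binaryDigit n≤2^L)
    open Population {d} {n} {Test} Particle kid weigh decide N-1

    seed : Vec (Fin d) n → ℕ × Particle (tests L)
    seed c = 1 , boxOf c , λ i l → inj₁ (∈-cartesianProduct⁺ (∈-allFin i) (∈-allFin l))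

    initial : ℚ
    initial = rainbow⁻¹ * inv N

    basic : Prog d n ℚ
    basic = iid N (colouring n) >>= λ cs → run (tests L) initial (Vec.map seed cs)

    cost-basic : ∀ (O : Oracle d n) → cost O basic ≤ℕ N *ℕ suc (d *ℕ L *ℕ (2 *ℕ suc (trials L)))
    cost-basic O = ℕ.≤-trans
      (cost->>= O (iid N (colouring n)) _ (λ cs → PopulationCost.cost-run {d} {n} {Test} Particle kid weigh
          decide N-1 O (suc (trials L)) (cost-weigh O) (λ (f , _) → cost-askBox O f) (tests L) initial
          (Vec.map seed cs)))
      (ℕ.≤-trans (ℕ.+-monoˡ-≤ _ (cost-iid O (colouring n) N (cost-colouring O n))) (ℕ.≤-reflexive
        (trans (cong (λ k → N *ℕ 0 +ℕ (k *ℕ ((N +ℕ N) *ℕ suc (trials L)) +ℕ N)) (length-tests L))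
            (eq N (d *ℕ L) (suc (trials L))))))
      where
      eq : ∀ N k w → N *ℕ 0 +ℕ (k *ℕ ((N +ℕ N) *ℕ w) +ℕ N) ≡ N *ℕ (1 +ℕ k *ℕ (2 *ℕ w))
      eq = ℕ-solve-∀

    module Moments (H : Hypergraph n) (uniform : Uniform d H) where

      open Masses H uniform n≤2^L (digits-separate n≤2^L)
      open Analysis (gpis H) mass kid-mass decide-mass (suc (trials L)) (suc (loss L d)) (s≤s z≤n) (s≤s z≤n) weigh-law

      O : Oracle d n
      O = gpis H

      C : Prog d n (Vec (Fin d) n)
      C = colouring n

      x : Vec (Fin d) n → ℚ
      x c = ι (colouredMass H uniform c)

      seed-mass : ∀ {k} (cs : Vec (Vec (Fin d) n) k) → sumV wmass (Vec.map seed cs) ≡ sumV x cs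
      seed-mass = sumV-map seed wmass x (λ c → trans (cong (_* x c) ι-one) (*-identityˡ (x c)))

      basic-mean : E O basic id ≡ ι (m H)
      basic-mean = begin
        E O basic id
          ≡⟨ trans (E->>= O (iid N C) _ id) (E-cong O (iid N C)
              (λ cs → trans (run-mean (tests L) initial (Vec.map seed cs)) (cong (initial *_) (seed-mass cs)))) ⟩
        E O (iid N C) (λ cs → initial * sumV x cs)
          ≡⟨ trans (E-* O (iid N C) initial (sumV x))
              (cong (initial *_) (trans (E-iid-sum O C N x) (cong (ι N *_) (E-colouredMass H uniform O)))) ⟩
        rainbow⁻¹ * inv N * (ι N * (rainbow * ι (m H)))
          ≡⟨ eq rainbow⁻¹ (inv N) (ι N) rainbow (ι (m H)) ⟩
        (rainbow * rainbow⁻¹) * (ι N * inv N) * ι (m H)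
          ≡⟨ cong₂ (λ a b → a * b * ι (m H)) rainbow-inverse (inv-inverseʳ N-1) ⟩
        1ℚ * 1ℚ * ι (m H)
          ≡⟨ *-identityˡ (ι (m H)) ⟩
        ι (m H) ∎
        where
        open ≡-Reasoning
        eq : ∀ q i N r m → q * i * (N * (r * m)) ≡ (r * q) * (N * i) * m
        eq = solve-∀ ℚ-ring

      y : ℚ
      y = ι (spread L) * inv N

      0≤y : 0ℚ ≤ y
      0≤y = 0≤* (0≤ι (spread L)) (0≤inv N)

      -- The initial colouring acts as one more step: averaging N independent colourings costs a
      -- factor 1 + 1 / (`rainbow` N), each refinement costs `ρ`, and both are at most 1 + y.
      basic-square : E O basic (λ z → z * z) ≤ (1ℚ + y) ^ suc (d *ℕ L) * (ι (m H) * ι (m H))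
      basic-square = begin
        E O basic (λ z → z * z)
          ≡⟨ E->>= O (iid N C) _ _ ⟩
        E O (iid N C) (λ cs → E O (run (tests L) initial (Vec.map seed cs)) (λ z → z * z))
          ≤⟨ E-mono O (iid N C) (λ cs → ≤-trans (run-square (tests L) initial (Vec.map seed cs))
              (≤-reflexive (cong (R *_) (trans (cong (λ z → initial * z * (initial * z)) (seed-mass cs))
              (square-* initial (sumV x cs)))))) ⟩
        E O (iid N C) (λ cs → R * (initial * initial * (sumV x cs * sumV x cs)))
          ≡⟨ trans (E-* O (iid N C) R _) (cong (R *_)
              (E-* O (iid N C) (initial * initial) (λ cs → sumV x cs * sumV x cs))) ⟩
        R * (initial * initial * E O (iid N C) (λ cs → sumV x cs * sumV x cs))
          ≤⟨ *-monoˡ R (0≤ρ^ (length (tests L))) (*-monoˡ (initial * initial) (0≤square initial)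
              (≤-trans (E-iid-square O C N x)
               (+-mono-≤ (*-monoˡ (ι N) (0≤ι N) (E-colouredMass² H uniform O))
                   (≤-reflexive (cong (λ z → ι N * ι N * (z * z)) (E-colouredMass H uniform O)))))) ⟩
        R * (initial * initial * (ι N * (rainbow * M²) + ι N * ι N * (rainbow * ι (m H) * (rainbow * ι (m H)))))
          ≡⟨ cong (R *_) (eq rainbow⁻¹ (inv N) (ι N) rainbow (ι (m H))) ⟩
        R * ((rainbow * rainbow⁻¹) * (ι N * inv N) * (rainbow⁻¹ * inv N) * M² + (rainbow * rainbow⁻¹) *
            (rainbow * rainbow⁻¹) * ((ι N * inv N) * (ι N * inv N)) * M²)
          ≡⟨ cong (R *_) (cong₂ (λ a b → a * b * (rainbow⁻¹ * inv N) * M² + a * a * (b * b) * M²)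
              rainbow-inverse (inv-inverseʳ N-1)) ⟩
        R * (1ℚ * 1ℚ * (rainbow⁻¹ * inv N) * M² + 1ℚ * 1ℚ * (1ℚ * 1ℚ) * M²)
          ≡⟨ collect R (rainbow⁻¹ * inv N) M² ⟩
        (1ℚ + rainbow⁻¹ * inv N) * R * M²
          ≤⟨ *-monoʳ M² (0≤square (ι (m H))) (*-mono-≤ (0≤+ 0≤1 (0≤* 0≤rainbow⁻¹ (0≤inv N))) first
              (0≤ρ^ (length (tests L))) later) ⟩
        (1ℚ + y) * (1ℚ + y) ^ (d *ℕ L) * M² ∎
        where
        open ℚ.≤-Reasoning
        R = ρ ^ length (tests L)
        M² = ι (m H) * ι (m H)
        square-* : ∀ a b → a * b * (a * b) ≡ a * a * (b * b)
        square-* = solve-∀ ℚ-ring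
        eq : ∀ q i N r m → q * i * (q * i) * (N * (r * (m * m)) + N * N * (r * m * (r * m)))
          ≡ (r * q) * (N * i) * (q * i) * (m * m) + (r * q) * (r * q) * ((N * i) * (N * i)) * (m * m)
        eq = solve-∀ ℚ-ring
        collect : ∀ R z M → R * (1ℚ * 1ℚ * z * M + 1ℚ * 1ℚ * (1ℚ * 1ℚ) * M) ≡ (1ℚ + z) * R * M
        collect = solve-∀ ℚ-ring
        first : 1ℚ + rainbow⁻¹ * inv N ≤ 1ℚ + y
        first = +-monoʳ-≤ 1ℚ (*-monoʳ (inv N) (0≤inv N)
            (≤-trans (proj₂ (≤ι rainbow⁻¹ 0≤rainbow⁻¹)) (ι-mono (ℕ.m≤n+m B _))))
        later : R ≤ (1ℚ + y) ^ (d *ℕ L)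
        later = ≤-trans (^-mono (length (tests L)) (0≤+ 0≤1 (0≤* (0≤ι β) (0≤inv N)))
            (+-monoʳ-≤ 1ℚ (*-monoʳ (inv N) (0≤inv N) (ι-mono (ℕ.m≤m+n β B)))))
          (≤-reflexive (cong ((1ℚ + y) ^_) (length-tests L)))

      basic-moment : ∀ {ε} → ε < 1ℚ → 0ℚ ≤ ε → ι (scale L) ≤ ε * ε * ι N →
        E O basic (λ z → z * z) ≤ (1ℚ + ε * ε * (pos 1 / 16)) * (ι (m H) * ι (m H))
      basic-moment {ε} ε<1 0≤ε scale≤ = ≤-trans basic-square (*-monoʳ (ι (m H) * ι (m H)) (0≤square (ι (m H)))
        (≤-trans (growth k 0≤y (≤-trans small ε²/16≤1) k ℕ.≤-refl) (+-monoʳ-≤ 1ℚ small)))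
        where
        k = suc (d *ℕ L)
        sixteenth : (ι k + ι k) * y ≡ ι (scale L) * inv N * (pos 1 / 16)
        sixteenth = trans (eq (ι k) (ι (spread L)) (inv N)) (cong (λ z → z * inv N * (pos 1 / 16))
          (sym (trans (ι-* 32 (k *ℕ spread L)) (cong₂ _*_ (ι-def 32) (ι-* k (spread L))))))
          where
          eq : ∀ k s i → (k + k) * (s * i) ≡ ℕ→ℚ 32 * (k * s) * i * (pos 1 / 16)
          eq = solve-∀ ℚ-ring
        small : (ι k + ι k) * y ≤ ε * ε * (pos 1 / 16)
        small = ≤-trans (≤-reflexive sixteenth) (*-monoʳ (pos 1 / 16) (ℚ.nonNegative⁻¹ (pos 1 / 16))
          (≤-trans (*-monoʳ (inv N) (0≤inv N) scale≤)
              (≤-reflexive (trans (*-assoc (ε * ε) (ι N) (inv N))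
              (trans (cong (ε * ε *_) (inv-inverseʳ N-1)) (*-identityʳ (ε * ε)))))))
        ε²/16≤1 : ε * ε * (pos 1 / 16) ≤ 1ℚ
        ε²/16≤1 = *-mono-≤ {b = 1ℚ} {d = 1ℚ} (0≤square ε) (*-mono-≤ 0≤ε (ℚ.<⇒≤ ε<1) 0≤ε (ℚ.<⇒≤ ε<1))
            (ℚ.nonNegative⁻¹ (pos 1 / 16)) (ℚ.≤ᵇ⇒≤ _)

  -- `reciprocal ε` times ε lies between 1 and 2, so `scale L` is reached after multiplication by ε²
  -- and exceeded by a factor of at most 4. The actual population is one larger, hence nonempty.
  population : ℕ → ℚ → ℕ
  population L ε = scale L *ℕ (reciprocal ε *ℕ reciprocal ε)

  boosted : ∀ {n} L → n ≤ℕ 2 ^ℕ L → ℚ → Prog d n ℚ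
  boosted L n≤2^L ε = iid L (Basic.basic L n≤2^L (population L ε)) >>= λ v → ret (median (toList v))

  -- ⌈log₂ n⌉ repetitions, times the queries per particle, times 5 · scale ≥ N ε².
  budget : ℕ → ℕ
  budget L = L *ℕ (suc (d *ℕ L *ℕ (2 *ℕ suc (trials L))) *ℕ (5 *ℕ scale L))

  poly-budget : Poly (5 *ℕ d +ℕ 5) budget
  poly-budget = poly-weaken exponent
    (poly-* {1} poly-id (poly-* {1 +ℕ (0 +ℕ (1 +ℕ d))}
        (poly-suc (poly-* (poly-* {0} {1} (poly-const d) poly-id) (poly-* {0} (poly-const 2) (poly-suc poly-trials))))
      (poly-* {0} (poly-const 5) (poly-* {0} (poly-const 32)
          (poly-* {1} (poly-suc (poly-* {0} {1} (poly-const d) poly-id)) poly-spread)))))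
    where
    poly-trials : Poly (1 +ℕ d) trials
    poly-trials = poly-* {1} (poly-* {1} {0} poly-id (poly-const d)) (poly-odds d)
    poly-spread : Poly (1 +ℕ d +ℕ d) spread
    poly-spread = poly-+ (poly-* (poly-suc poly-trials) (poly-suc (poly-loss d))) (poly-weaken z≤n (poly-const B))
    -- The left side is 3 d + 5.
    exponent : 1 +ℕ (1 +ℕ (0 +ℕ (1 +ℕ d)) +ℕ (0 +ℕ (0 +ℕ (1 +ℕ (1 +ℕ d +ℕ d))))) ≤ℕ 5 *ℕ d +ℕ 5
    exponent = ℕ.≤-trans (ℕ.m≤m+n _ (2 *ℕ d)) (ℕ.≤-reflexive (eq d))
      where
      eq : ∀ d → 1 +ℕ (1 +ℕ (0 +ℕ (1 +ℕ d)) +ℕ (0 +ℕ (0 +ℕ (1 +ℕ (1 +ℕ d +ℕ d))))) +ℕ 2 *ℕ d ≡ 5 *ℕ d +ℕ 5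
      eq = ℕ-solve-∀

  budget≤ : ∀ L → budget L ≤ℕ Poly.coefficient poly-budget *ℕ L ^ℕ (5 *ℕ d +ℕ 5)
  -- L = 0 occurs for n = 1, where the bound itself is 0; the leading factor L, the number of
  -- repetitions, makes the budget 0 as well.
  budget≤ zero    = z≤n
  budget≤ (suc L) = Poly.bounded poly-budget (suc L) (s≤s z≤n)

  module Guarantee {n : ℕ} (L : ℕ) (n≤2^L : n ≤ℕ 2 ^ℕ L) (ε : ℚ) (H : Hypergraph n) (0<ε : 0ℚ < ε) (ε<1 : ε < 1ℚ) (uniform : Uniform d H) where

    r N : ℕ
    r = reciprocal ε
    N = suc (population L ε)

    open Basic L n≤2^L (population L ε) using (basic; cost-basic)
    open Basic.Moments L n≤2^L (population L ε) H uniform using (basic-mean; basic-moment)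

    0≤ε′ : 0ℚ ≤ ε
    0≤ε′ = ℚ.<⇒≤ 0<ε

    ιN : ι N ≡ 1ℚ + ι (scale L) * (ι r * ι r)
    ιN = trans (ι-suc (population L ε)) (cong (1ℚ +_)
        (trans (ι-* (scale L) (r *ℕ r)) (cong (ι (scale L) *_) (ι-* r r))))

    rε² : ∀ S ε r → ε * ε * (1ℚ + S * (r * r)) ≡ S * (r * ε * (r * ε)) + ε * ε
    rε² = solve-∀ ℚ-ring

    scale≤ : ι (scale L) ≤ ε * ε * ι N
    scale≤ = begin
      ι (scale L)                                       ≡⟨ *-identityʳ (ι (scale L)) ⟨
      ι (scale L) * (1ℚ * 1ℚ)                           ≤⟨ *-monoˡ (ι (scale L)) (0≤ι (scale L))
          (square-mono 0≤1 (proj₁ (reciprocal-bounds ε 0<ε ε<1))) ⟩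
      ι (scale L) * (ι r * ε * (ι r * ε))               ≤⟨ ≤-slack (ε * ε) (0≤square ε) refl ⟩
      ι (scale L) * (ι r * ε * (ι r * ε)) + ε * ε       ≡⟨ rε² (ι (scale L)) ε (ι r) ⟨
      ε * ε * (1ℚ + ι (scale L) * (ι r * ι r))          ≡⟨ cong (ε * ε *_) ιN ⟨
      ε * ε * ι N                                       ∎
      where open ℚ.≤-Reasoning

    1≤scale : 1 ≤ℕ scale L
    1≤scale = ℕ.*-mono-≤ {1} {32} (s≤s z≤n) (ℕ.*-mono-≤ {1} {suc (d *ℕ L)} (s≤s z≤n)
        (ℕ.≤-trans (s≤s z≤n) (ℕ.m≤m+n (suc (trials L) *ℕ suc (loss L d)) B)))

    ε²≤1 : ε * ε ≤ 1ℚ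
    ε²≤1 = *-mono-≤ 0≤ε′ (ℚ.<⇒≤ ε<1) 0≤ε′ (ℚ.<⇒≤ ε<1)

    N≤scale : ε * ε * ι N ≤ ι (5 *ℕ scale L)
    N≤scale = begin
      ε * ε * ι N                                                    ≡⟨ trans (cong (ε * ε *_) ιN)
          (rε² (ι (scale L)) ε (ι r)) ⟩
      -- The square of `ι r * ε` is at most 4, and the extra particle contributes ε² ≤ 1 ≤
      -- `scale L`: together the factor 5.
      ι (scale L) * (ι r * ε * (ι r * ε)) + ε * ε                    ≤⟨ +-mono-≤
          (*-monoˡ (ι (scale L)) (0≤ι (scale L)) (square-mono (0≤* (0≤ι r) 0≤ε′)
          (proj₂ (reciprocal-bounds ε 0<ε ε<1)))) (≤-trans ε²≤1 (1≤ι 1≤scale)) ⟩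
      ι (scale L) * ((1ℚ + 1ℚ) * (1ℚ + 1ℚ)) + ι (scale L)            ≡⟨ eq (ι (scale L)) ⟩
      ℕ→ℚ 5 * ι (scale L)                                            ≡⟨ trans (ι-* 5 (scale L))
          (cong (_* ι (scale L)) (ι-def 5)) ⟨
      ι (5 *ℕ scale L)                                               ∎
      where
      open ℚ.≤-Reasoning
      eq : ∀ s → s * ((1ℚ + 1ℚ) * (1ℚ + 1ℚ)) + s ≡ ℕ→ℚ 5 * s
      eq = solve-∀ ℚ-ring

    accuracy : HighProbability 1ℚ n (Pr (approximates? ε (m H)) (gpis H) (toAlgorithm (boosted L n≤2^L ε)))
    accuracy = highProbability (gpis H) (boosted L n≤2^L ε) (approximates? ε (m H)) L n≤2^L
      (amplification _ _ (approximates? ε (m H)) (gpis H) basic L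
        (chebyshev 0<ε (gpis H) basic (m H) basic-mean (basic-moment ε<1 0≤ε′ scale≤)))

    perParticle : ℕ
    perParticle = suc (d *ℕ L *ℕ (2 *ℕ suc (trials L)))

    cost-boosted : cost (gpis H) (boosted L n≤2^L ε) ≤ℕ L *ℕ (N *ℕ perParticle)
    cost-boosted = ℕ.≤-trans (cost->>= (gpis H) (iid L basic) _ (λ v → z≤n))
        (ℕ.≤-trans (ℕ.≤-reflexive (ℕ.+-identityʳ _)) (cost-iid (gpis H) basic L (cost-basic (gpis H))))

    efficiency : ℕ→ℚ (queries (gpis H) (toAlgorithm (boosted L n≤2^L ε))) * ε ^ 4 ≤ ℕ→ℚ
        (Poly.coefficient poly-budget *ℕ L ^ℕ (5 *ℕ d +ℕ 5))
    efficiency = subst₂ (λ a b → a * ε ^ 4 ≤ b) (trans (ι-def _)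
        (cong ℕ→ℚ (sym (queries-toAlgorithm (gpis H) (boosted L n≤2^L ε))))) (ι-def _) (begin
      ι (cost (gpis H) (boosted L n≤2^L ε)) * ε ^ 4              ≤⟨ *-monoʳ (ε ^ 4) (0≤^ 4 0≤ε′)
          (ι-mono cost-boosted) ⟩
      ι (L *ℕ (N *ℕ perParticle)) * ε ^ 4                  ≡⟨ cong (_* ε ^ 4)
          (trans (ι-* L (N *ℕ perParticle)) (cong (ι L *_) (ι-* N perParticle))) ⟩
      ι L * (ι N * ι perParticle) * ε ^ 4                  ≡⟨ eq (ι L) (ι N) (ι perParticle) ε ⟩
      -- Two of the four powers of ε cancel the ε-dependence of N; the other two are bounded by 1.
      ι L * ι perParticle * (ε * ε * ι N * (ε * ε))        ≤⟨ *-monoˡ (ι L * ι perParticle)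
          (0≤* (0≤ι L) (0≤ι perParticle)) (*-mono-≤ (0≤* (0≤square ε) (0≤ι N)) N≤scale (0≤square ε) ε²≤1) ⟩
      ι L * ι perParticle * (ι (5 *ℕ scale L) * 1ℚ)        ≡⟨ trans
          (assoc (ι L) (ι perParticle) (ι (5 *ℕ scale L)))
          (sym (trans (ι-* L (perParticle *ℕ (5 *ℕ scale L))) (cong (ι L *_) (ι-* perParticle (5 *ℕ scale L))))) ⟩
      ι (budget L)                                         ≤⟨ ι-mono (budget≤ L) ⟩
      ι (Poly.coefficient poly-budget *ℕ L ^ℕ (5 *ℕ d +ℕ 5)) ∎)
      where
      open ℚ.≤-Reasoning
      eq : ∀ l n p e → l * (n * p) * (e * (e * (e * (e * 1ℚ)))) ≡ l * p * (e * e * n * (e * e))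
      eq = solve-∀ ℚ-ring
      assoc : ∀ a b c → a * b * (c * 1ℚ) ≡ a * (b * c)
      assoc = solve-∀ ℚ-ring

theorem1p2 : ∃[ c ] (0ℚ < c) × (∀ (d : ℕ) → 1 ≤ℕ d →
    Σ[ C ∈ ℕ ] Σ[ alg ∈ ((n : ℕ) → ℚ → Algorithm d n) ]
    (∀ (n : ℕ) (ε : ℚ) (H : Hypergraph n) →
    1 ≤ℕ n → 0ℚ < ε → ε < 1ℚ → Uniform d H →
    HighProbability c n (Pr (approximates? ε (m H)) (gpis H) (alg n ε))
    × (ℕ→ℚ (queries (gpis H) (alg n ε)) * ε ^ 4
    ≤ ℕ→ℚ (C *ℕ ⌈log₂ n ⌉ ^ℕ (5 *ℕ d +ℕ 5)))))
theorem1p2 = 1ℚ , ℚ.positive⁻¹ 1ℚ , λ where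
  (suc d-1) _ → let open Estimator d-1 in
    Poly.coefficient poly-budget , (λ n ε → toAlgorithm (boosted ⌈log₂ n ⌉ (n≤2^⌈log₂n⌉ n) ε)) , λ n ε H _ 0<ε
        ε<1 uniform →
      Guarantee.accuracy ⌈log₂ n ⌉ (n≤2^⌈log₂n⌉ n) ε H 0<ε ε<1 uniform , Guarantee.efficiency ⌈log₂ n ⌉
          (n≤2^⌈log₂n⌉ n) ε H 0<ε ε<1 uniform
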